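{- Let $d\ge 2$ be an integer and $s\in[\tfrac14,\tfrac12]$. Then $$\alpha(d,4,s)\ \le\ \min\Big\{\frac{d+2}{4s+1},\ \frac{d+4}{8s}\Big\}.$$ In particular: (i) if $s\le \frac14+\frac1d$, then $\alpha(d,4,s)\le \frac{d+2}{4s+1}$; (ii) if $s\ge \frac14+\frac1d$, then $\alpha(d,4,s)\le \frac{d+4}{8s}$. Here $\alpha(d,4,s)$ denotes the smallest exponent $\alpha$ such that every $(4,s)$-Salem set $E\subseteq\mathbb{F}_q^d$ with $|E|\gg q^{\alpha}$ satisfies $|\Delta(E)|\gg q$.
   Context: $\mathbb{F}_q$ is a finite field of odd order $q$; for $\mathbf{x}\in\mathbb{F}_q^d$, $\|\mathbf{x}\|=x_1^2+\cdots+x_d^2$, and $\Delta(E)=\{\|\mathbf{x}-\mathbf{y}\|:\mathbf{x},\mathbf{y}\in E\}\subseteq\mathbb{F}_q$. Fix a nontrivial additive character $\chi$ of $\mathbb{F}_q$ and put $\widehat{E}(\mathbf{x})=q^{ -d}\sum_{\mathbf{y}\in E}\chi(-\mathbf{x}\cdot\mathbf{y})$ and $\|\widehat{E}\|_4=\big(q^{ -d}\sum_{\mathbf{x}\in\mathbb{F}_q^d\setminus\{\mathbf{0}\}}|\widehat{E}(\mathbf{x})|^4\big)^{1/4}$. A set $E\subseteq\mathbb{F}_q^d$ is $(4,s)$-Salem if $\|\widehat{E}\|_4\ll q^{ -d}|E|^{1-s}$. Notation: $A\ll B$ (equivalently $B\gg A$) means $A\le CB$ for a constant $C>0$ not depending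 on $q$ or on the sets involved. Implied constants in conclusions may depend on $d$, $s$ and on the implied constants in the hypotheses (including the one in the Salem condition). -}

module Defs where

open import Algebra.Bundles using (CommutativeRing)
open import Algebra.Core using (Op₁; Op₂)
open import Algebra.Structures using (IsCommutativeRing)
open import Data.Fin.Base using (Fin)
import Data.Fin.Properties as Fin
open import Data.List.Base as List
  using (List; length; allFin; deduplicate; cartesianProductWith; filter; foldr)
open import Data.List.Relation.Unary.Unique.Propositional using (Unique)
open import Data.Nat.Base as ℕ using (ℕ; zero; suc)
open import Data.Nat.Divisibility using (_∣_)
open import Data.Product.Base using (∃; ∃₂; _×_; _,_)
open import Data.Vec.Base as Vec using (Vec; []; _∷_)
import Data.Vec.Properties as Vec
open import Function.Bundles using (_↔_; Inverse)
open import Function.Properties.Inverse using (↔-sym; ↔⇒↣)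
open import Level using (0ℓ) renaming (suc to lsuc)
open import Relation.Binary.Bundles using (TotalOrder)
open import Relation.Binary.Core using (Rel)
open import Relation.Binary.Definitions using (DecidableEquality)
open import Relation.Binary.PropositionalEquality.Core using (_≡_; _≢_)
open import Relation.Binary.Structures using (IsDecTotalOrder)
open import Relation.Nullary.Decidable using (¬?; via-injection)
open import Relation.Nullary.Negation.Core using (¬_)
open import Relation.Unary using (Pred)

private
  1ℓ = lsuc 0ℓ

-- The classical real numbers, which this axiomatisation determines up to
-- unique isomorphism: a totally ordered field in which every nonempty set
-- that is bounded above has a least upper bound.  As usual `_⁻¹` and `sup`
-- are total functions with unspecified values outside their domains.
-- Everything lives in level 1 so that `sup` applies to predicates that
-- quantify over all (small) finite fields.
record CompleteOrderedField : Set (lsuc 1ℓ) where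
  infix  4 _≤_
  infix  8 _⁻¹
  field
    commutativeRing : CommutativeRing 1ℓ 1ℓ
  open CommutativeRing commutativeRing public
  field
    1≉0             : ¬ (1# ≈ 0#)
    _⁻¹             : Op₁ Carrier
    ⁻¹-inverseʳ     : ∀ x → ¬ (x ≈ 0#) → x * x ⁻¹ ≈ 1#

    _≤_             : Rel Carrier 1ℓ
    isDecTotalOrder : IsDecTotalOrder _≈_ _≤_
    +-monoʳ-≤       : ∀ z {x y} → x ≤ y → z + x ≤ z + y
    *-nonNegative   : ∀ {x y} → 0# ≤ x → 0# ≤ y → 0# ≤ x * y

  IsUpperBound : Pred Carrier 1ℓ → Carrier → Set 1ℓ
  IsUpperBound P b = ∀ x → P x → x ≤ b

  field
    sup       : Pred Carrier 1ℓ → Carrier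
    sup-upper : ∀ P → ∃ P → ∃ (IsUpperBound P) → IsUpperBound P (sup P)
    sup-least : ∀ P → ∃ P → ∃ (IsUpperBound P) →
                ∀ b → IsUpperBound P b → sup P ≤ b

  totalOrder : TotalOrder 1ℓ 1ℓ 1ℓ
  totalOrder = record
    { isTotalOrder = IsDecTotalOrder.isTotalOrder isDecTotalOrder }

record FiniteField (q : ℕ) : Set 1ℓ where
  infixl 6 _+_
  infixl 7 _*_
  infix  8 -_
  field
    Carrier           : Set
    _+_ _*_           : Op₂ Carrier
    -_                : Op₁ Carrier
    0# 1#             : Carrier
    isCommutativeRing : IsCommutativeRing _≡_ _+_ _*_ -_ 0# 1#
    1≢0               : 1# ≢ 0#
    inverse           : ∀ x → x ≢ 0# → ∃ λ y → x * y ≡ 1#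
    enumeration       : Fin q ↔ Carrier

  _≟_ : DecidableEquality Carrier
  _≟_ = via-injection (↔⇒↣ (↔-sym enumeration)) Fin._≟_

  elements : List Carrier
  elements = List.map (Inverse.to enumeration) (allFin q)

  Point : ℕ → Set
  Point d = Vec Carrier d

  points : ∀ d → List (Point d)
  points zero    = [] List.∷ List.[]
  points (suc d) = cartesianProductWith _∷_ elements (points d)

  origin : ∀ {d} → Point d
  origin = Vec.replicate _ 0#

  nonzeroPoints : ∀ d → List (Point d)
  nonzeroPoints d = filter (λ x → ¬? (Vec.≡-dec _≟_ x origin)) (points d)

  infixl 6 _∸ᵛ_
  infixl 7 _∙_

  _∸ᵛ_ : ∀ {d} → Point d → Point d → Point d
  _∸ᵛ_ = Vec.zipWith (λ a b → a + - b)

  _∙_ : ∀ {d} → Point d → Point d → Carrier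
  x ∙ y = Vec.foldr _ _+_ 0# (Vec.zipWith _*_ x y)

  ‖_‖ : ∀ {d} → Point d → Carrier
  ‖ x ‖ = Vec.foldr _ _+_ 0# (Vec.map (λ a → a * a) x)

  -- Subsets of 𝔽_q^d are represented by duplicate-free lists of points.
  -- Δ E is duplicate-free, so its length is the number of distances.
  Δ : ∀ {d} → List (Point d) → List Carrier
  Δ E = deduplicate _≟_ (cartesianProductWith (λ x y → ‖ x ∸ᵛ y ‖) E E)

module Reals (R : CompleteOrderedField) where

  open CompleteOrderedField R public
    using (_≈_; _+_; _*_; -_; _-_; _⁻¹; 0#; 1#; _≤_; sup)
    renaming (Carrier to ℝ)
  open CompleteOrderedField R using (semiring; totalOrder)
  open import Algebra.Properties.Semiring.Exp semiring public using (_^_)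
  open import Algebra.Properties.Semiring.Mult semiring
    renaming (_×_ to _times_) using ()
  open import Algebra.Construct.NaturalChoice.Min totalOrder public using (_⊓_)
  open import Relation.Binary.Construct.NonStrictToStrict _≈_ _≤_ public
    using (_<_)

  fromℕ : ℕ → ℝ
  fromℕ n = n times 1#

  infixl 7 _÷_

  _÷_ : Op₂ ℝ
  x ÷ y = x * y ⁻¹

  inf : Pred ℝ 1ℓ → ℝ
  inf P = - sup (λ x → P (- x))

  -- The nonnegative n-th root of x, for n ≥ 1 and x ≥ 0.
  root : ℕ → ℝ → ℝ
  root n x = sup (λ y → y ^ n ≤ x)

  -- b raised to the real exponent x > 0, as the supremum of all b ^ (m / n)
  -- with m, n ≥ 1 and m / n ≤ x.  This would be wrong for 0 < b < 1, whence
  -- the restriction to natural bases; note that power 0 x ≈ 0.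
  power : ℕ → ℝ → ℝ
  power b x = sup λ y → ∃₂ λ m n →
    fromℕ (suc m) ≤ x * fromℕ (suc n) × y ^ suc n ≤ fromℕ b ^ suc m

  record ℂ : Set 1ℓ where
    constructor _+i_
    field
      re im : ℝ

  open ℂ public

  infix  4 _≈ᶜ_
  infixl 6 _+ᶜ_
  infixl 7 _*ᶜ_

  _≈ᶜ_ : Rel ℂ 1ℓ
  z ≈ᶜ w = re z ≈ re w × im z ≈ im w

  0ᶜ 1ᶜ : ℂ
  0ᶜ = 0# +i 0#
  1ᶜ = 1# +i 0#

  _+ᶜ_ _*ᶜ_ : Op₂ ℂ
  z +ᶜ w = (re z + re w) +i (im z + im w)
  z *ᶜ w = (re z * re w - im z * im w) +i (re z * im w + im z * re w)

  ofReal : ℝ → ℂ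
  ofReal x = x +i 0#

  ∣_∣ : ℂ → ℝ
  ∣ z ∣ = root 2 (re z ^ 2 + im z ^ 2)

  ∑ : {A : Set} → List A → (A → ℝ) → ℝ
  ∑ xs f = foldr (λ x → f x +_) 0# xs

  ∑ᶜ : {A : Set} → List A → (A → ℂ) → ℂ
  ∑ᶜ xs f = foldr (λ x → f x +ᶜ_) 0ᶜ xs

  record AdditiveCharacter {q} (F : FiniteField q) : Set 1ℓ where
    private module F = FiniteField F
    field
      χ          : F.Carrier → ℂ
      χ-0        : χ F.0# ≈ᶜ 1ᶜ
      χ-+        : ∀ a b → χ (a F.+ b) ≈ᶜ χ a *ᶜ χ b
      nontrivial : ∃ λ a → ¬ (χ a ≈ᶜ 1ᶜ)

  module _ {q} {F : FiniteField q} (X : AdditiveCharacter F) where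
    open FiniteField F using (Point; nonzeroPoints; _∙_) renaming (-_ to -ᶠ_)
    open AdditiveCharacter X

    fourier : ∀ {d} → List (Point d) → Point d → ℂ
    fourier {d} E x =
      ofReal ((fromℕ q ^ d) ⁻¹) *ᶜ ∑ᶜ E (λ y → χ (-ᶠ (x ∙ y)))

    ‖_^‖₄ : ∀ {d} → List (Point d) → ℝ
    ‖_^‖₄ {d} E = root 4
      ((fromℕ q ^ d) ⁻¹ * ∑ (nonzeroPoints d) (λ x → ∣ fourier E x ∣ ^ 4))

    -- E is (4,s)-Salem with implied constant C.
    IsSalem₄ : ∀ {d} → ℝ → ℝ → List (Point d) → Set 1ℓ
    IsSalem₄ {d} s C E =
      ‖_^‖₄ E ≤ C * ((fromℕ q ^ d) ⁻¹ * power (length E) (1# - s))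

  -- Every (4,s)-Salem set E ⊆ 𝔽_q^d with |E| ≫ q^a satisfies |Δ(E)| ≫ q:
  -- the constant c′ may depend on d, s, a and the constants C, c of the two
  -- hypotheses, but not on q, the field, the character or E.
  Admissible : ℕ → ℝ → ℝ → Set 1ℓ
  Admissible d s a =
    ∀ C c → 0# < C → 0# < c → ∃ λ c′ → 0# < c′ ×
    (∀ {q} (F : FiniteField q) → ¬ (2 ∣ q) → (X : AdditiveCharacter F) →
     let open FiniteField F using (Point; Δ) in
     (E : List (Point d)) → Unique E →
     IsSalem₄ X s C E →
     c * power q a ≤ fromℕ (length E) →
     c′ * fromℕ q ≤ fromℕ (length (Δ E)))

  -- The smallest admissible exponent, as an infimum.  Exponents a ≤ 0 are
  -- never admissible, as one-point sets show, and are outside the domain of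
  -- `power`.
  α₄ : ℕ → ℝ → ℝ
  α₄ d s = inf (λ a → 0# < a × Admissible d s a)

  infix 4 α₄⟨_,_⟩≤_

  -- "α(d,4,s) ≤ b".  Calling α(d,4,s) the *smallest* exponent presupposes
  -- that the infimum is attained; since admissibility is upward closed, the
  -- bound then also says that b itself is admissible.
  α₄⟨_,_⟩≤_ : ℕ → ℝ → ℝ → Set 1ℓ
  α₄⟨ d , s ⟩≤ b = α₄ d s ≤ b × Admissible d s b

{-# OPTIONS --safe #-}

-- By orthogonality of characters, being (4,s)-Salem bounds the additive
-- energy: q^d Λ ≤ |E|⁴ + C⁴ q^d P, where P = |E|^(4-4s).  By Cauchy–Schwarz
-- |Δ(E)| ≥ |E|⁴ / M, where M = Σ ν(t)² and ν(t) counts the pairs at distance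
-- t, so it suffices that M ≪ |E|⁴ / q.  If q^d P ≤ |E|⁴, this follows
-- from M ≤ 2 q^(d-1) Λ, because spheres have at most 2 q^(d-1) points.
-- Otherwise Λ ≪ P, and q M is the sum over j of |B(j)|², where
-- B(j) = Σ χ(j‖x-y‖) over x , y ∈ E.  Here B(0) = |E|², and for j ≠ 0 opening
-- ‖x-y‖ and applying Cauchy–Schwarz to the resulting bilinear form gives both
-- |B(j)|⁴ ≤ |E|³ q^d Λ and |B(j)|⁸ ≤ |E|⁸ q^d Λ²; these are ≪ (|E|⁴/q)² and
-- ≪ (|E|⁴/q)⁴ as soon as |E|^(4s+1) ≫ q^(d+2) and |E|^(8s) ≫ q^(d+4).
module Submission where

open import Defs
open import Algebra.Bundles using (CommutativeRing; CommutativeSemiring; RawRing)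
open import Algebra.Structures using (IsCommutativeRing)
open import Data.Bool.Base using (if_then_else_)
open import Data.Fin.Base using (Fin)
import Data.Fin.Properties as Fin
open import Data.List.Base
  using (List; []; _∷_; length; foldr; map; _++_; cartesianProductWith; filter; allFin)
open import Data.List.Membership.Propositional using (_∈_; _∉_; lose)
import Data.List.Membership.DecPropositional as Membership
open import Data.List.Membership.Propositional.Properties
  using (∈-map⁺; ∈-allFin; ∈-cartesianProductWith⁺; ∈-deduplicate⁺)
import Data.List.Properties as List
import Data.List.Relation.Unary.All as All
open import Data.List.Relation.Unary.AllPairs using ([]; _∷_)
open import Data.List.Relation.Unary.Any using (Any; here; there; any?; satisfied)
open import Data.List.Relation.Unary.Unique.Propositional using (Unique)
import Data.List.Relation.Unary.Unique.DecPropositional.Properties as DecUnique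
import Data.List.Relation.Unary.Unique.Propositional.Properties as Unique
open import Data.Nat.Base as ℕ using (ℕ; zero; suc) renaming (_≤_ to _≤ⁿ_; _+_ to _+ⁿ_)
open import Data.Nat.Divisibility using (_∣_; divides)
import Data.Nat.Properties as ℕ
open import Data.Product.Base using (∃; ∃₂; _×_; _,_; proj₁; proj₂)
open import Data.Sum.Base using (_⊎_; inj₁; inj₂; [_,_]′)
open import Data.Vec.Base as Vec using ([]; _∷_)
import Data.Vec.Properties as Vec
open import Function.Base using (_∘_)
open import Function.Bundles using (Inverse)
open import Level using (0ℓ) renaming (suc to lsuc)
open import Relation.Binary.Bundles using (Poset)
open import Relation.Binary.Definitions using (DecidableEquality; tri<; tri≈; tri>)
import Relation.Binary.PropositionalEquality as ≡
open ≡ using (_≡_; _≢_)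
open import Relation.Binary.Structures using (IsDecTotalOrder)
open import Relation.Nullary.Decidable using (Dec; yes; no; does; ¬?; decidable-stable)
open import Relation.Nullary.Negation.Core using (¬_; contradiction)
open import Relation.Unary using (Pred; Decidable)

-- A solver for commutative rings, with integer coefficients

-- The Salem condition concerns one given character, whereas the bilinear form behind B(j) carries
-- the factor -2j. The two meet in Λ, a count of quadruples in which no character occurs: each
-- moment is taken with respect to a twisted character (by -1 for the Salem norm, by -2j for B(j))
-- and then expressed through Λ. That q is odd makes -2j nonzero.
--
-- The other obstacle is the real exponent, since `power` is a bare supremum. Apart from its sign,
-- only one fact about p = |E|^(1-s) is extracted from it: p^v q^m ≪ |E|^w with natural v, w, m.
-- Writing N = |B(j)|², the goal q N ≪ |E|⁴ becomes after squaring a condition with (v, w, m) = (4,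
-- 5, d+2), and after raising to the fourth power one with (8, 8, d+4). Then w - v(1-s) is 4s+1 or
-- 8s, the denominators of the two bounds. Estimates are kept between squares and higher powers, so
-- that roots are taken only at the very end, by cancelling squares.

module IntegerRingSolver {c ℓ} (R : CommutativeRing c ℓ) where
  open import Data.Integer.Base as ℤ using (ℤ; +_; -[1+_]; _⊖_)
  import Data.Integer.Properties as ℤ
  open import Data.Maybe.Base as Maybe using (Maybe)
  open import Relation.Nullary.Decidable using (dec⇒maybe)
  open CommutativeRing R
  open import Algebra.Properties.Ring ring
  open import Algebra.Properties.Semiring.Mult.TCOptimised semiring
    using (×-homo-+; ×1-homo-*; 1+×)
    renaming (_×_ to _times_)
  open import Algebra.Solver.Ring.AlmostCommutativeRing
    using (fromCommutativeRing; _-Raw-AlmostCommutative⟶_)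
  open import Relation.Binary.Reasoning.Setoid setoid

  private
    -- With the optimised multiples `1 times 1#` is `1#` by computation, so the constant `:1`
    -- denotes `1#` itself.
    ⟦_⟧ᶻ : ℤ → Carrier
    ⟦ + n ⟧ᶻ      = n times 1#
    ⟦ -[1+ n ] ⟧ᶻ = - (suc n times 1#)

    ℤ-rawRing : RawRing _ _
    ℤ-rawRing = record
      { Carrier = ℤ ; _≈_ = _≡_ ; _+_ = ℤ._+_ ; _*_ = ℤ._*_ ; -_ = ℤ.-_
      ; 0# = + 0 ; 1# = + 1 }

    cancel-1 : ∀ x y → (1# + x) - (1# + y) ≈ x - y
    cancel-1 x y = begin
      (1# + x) - (1# + y)      ≈⟨ +-congˡ (-‿+-comm 1# y) ⟨
      (1# + x) + (- 1# - y)    ≈⟨ +-congʳ (+-comm 1# x) ⟩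
      (x + 1#) + (- 1# - y)    ≈⟨ +-assoc x 1# _ ⟩
      x + (1# + (- 1# - y))    ≈⟨ +-congˡ (+-assoc 1# (- 1#) (- y)) ⟨
      x + ((1# - 1#) - y)      ≈⟨ +-congˡ (+-congʳ (-‿inverseʳ 1#)) ⟩
      x + (0# - y)             ≈⟨ +-congˡ (+-identityˡ (- y)) ⟩
      x - y                    ∎

    ⊖-homo : ∀ m n → ⟦ m ⊖ n ⟧ᶻ ≈ m times 1# - n times 1#
    ⊖-homo zero    zero    = sym (-‿inverseʳ 0#)
    ⊖-homo zero    (suc n) = sym (+-identityˡ _)
    ⊖-homo (suc m) zero    = begin
      suc m times 1#       ≈⟨ +-identityʳ _ ⟨
      suc m times 1# + 0#  ≈⟨ +-congˡ -0#≈0# ⟨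
      suc m times 1# - 0#  ∎
    ⊖-homo (suc m) (suc n) = begin
      ⟦ suc m ⊖ suc n ⟧ᶻ               ≡⟨ ≡.cong ⟦_⟧ᶻ (ℤ.[1+m]⊖[1+n]≡m⊖n m n) ⟩
      ⟦ m ⊖ n ⟧ᶻ                       ≈⟨ ⊖-homo m n ⟩
      m times 1# - n times 1#                  ≈⟨ cancel-1 _ _ ⟨
      (1# + m times 1#) - (1# + n times 1#)    ≈⟨ +-cong (1+× m 1#) (-‿cong (1+× n 1#)) ⟨
      suc m times 1# - suc n times 1#          ∎

    -‿homoᶻ : ∀ i → ⟦ ℤ.- i ⟧ᶻ ≈ - ⟦ i ⟧ᶻ
    -‿homoᶻ (+ zero)   = sym -0#≈0#
    -‿homoᶻ (+ suc n)  = refl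
    -‿homoᶻ -[1+ n ]   = sym (-‿involutive _)

    +-homoᶻ : ∀ i j → ⟦ i ℤ.+ j ⟧ᶻ ≈ ⟦ i ⟧ᶻ + ⟦ j ⟧ᶻ
    +-homoᶻ (+ m)    (+ n)    = ×-homo-+ 1# m n
    +-homoᶻ (+ m)    -[1+ n ] = ⊖-homo m (suc n)
    +-homoᶻ -[1+ m ] (+ n)    = trans (⊖-homo n (suc m)) (+-comm _ _)
    +-homoᶻ -[1+ m ] -[1+ n ] = begin
      - (suc (suc (m ℕ.+ n)) times 1#)      ≡⟨ ≡.cong (λ k → - (k times 1#)) (≡.sym (ℕ.+-suc (suc m) n)) ⟩
      - ((suc m ℕ.+ suc n) times 1#)        ≈⟨ -‿cong (×-homo-+ 1# (suc m) (suc n)) ⟩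
      - (suc m times 1# + suc n times 1#)       ≈⟨ -‿+-comm _ _ ⟨
      - (suc m times 1#) - (suc n times 1#)     ∎

    +◃-homo : ∀ n → ⟦ ℤ.sign (+ 0) ℤ.◃ n ⟧ᶻ ≈ n times 1#
    +◃-homo n = reflexive (≡.cong ⟦_⟧ᶻ (ℤ.+◃n≡+n n))

    -◃-homo : ∀ n → ⟦ ℤ.sign -[1+ 0 ] ℤ.◃ n ⟧ᶻ ≈ - (n times 1#)
    -◃-homo zero    = sym -0#≈0#
    -◃-homo (suc n) = refl

    *-homoᶻ : ∀ i j → ⟦ i ℤ.* j ⟧ᶻ ≈ ⟦ i ⟧ᶻ * ⟦ j ⟧ᶻ
    *-homoᶻ (+ m)    (+ n)    = trans (+◃-homo (m ℕ.* n)) (×1-homo-* m n)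
    *-homoᶻ (+ m)    -[1+ n ] = trans (-◃-homo (m ℕ.* suc n))
      (trans (-‿cong (×1-homo-* m (suc n))) (-‿distribʳ-* _ _))
    *-homoᶻ -[1+ m ] (+ n)    = trans (-◃-homo (suc m ℕ.* n))
      (trans (-‿cong (×1-homo-* (suc m) n)) (-‿distribˡ-* _ _))
    *-homoᶻ -[1+ m ] -[1+ n ] = trans (+◃-homo (suc m ℕ.* suc n))
      (trans (×1-homo-* (suc m) (suc n)) (sym (-x*-y≈x*y _ _)))
      where
      -x*-y≈x*y : ∀ x y → - x * - y ≈ x * y
      -x*-y≈x*y x y = begin
        - x * - y    ≈⟨ -‿distribˡ-* x (- y) ⟨
        - (x * - y)  ≈⟨ -‿cong (-‿distribʳ-* x y) ⟨
        - - (x * y)  ≈⟨ -‿involutive _ ⟩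
        x * y        ∎

    homomorphism : ℤ-rawRing -Raw-AlmostCommutative⟶ fromCommutativeRing R
    homomorphism = record
      { ⟦_⟧ = ⟦_⟧ᶻ ; +-homo = +-homoᶻ ; *-homo = *-homoᶻ ; -‿homo = -‿homoᶻ
      ; 0-homo = refl ; 1-homo = refl }

    ⟦⟧ᶻ-≟ : ∀ i j → Maybe (⟦ i ⟧ᶻ ≈ ⟦ j ⟧ᶻ)
    ⟦⟧ᶻ-≟ i j = Maybe.map (λ i≡j → reflexive (≡.cong ⟦_⟧ᶻ i≡j)) (dec⇒maybe (i ℤ.≟ j))

  open import Algebra.Solver.Ring ℤ-rawRing (fromCommutativeRing R) homomorphism ⟦⟧ᶻ-≟ public

  :0 :1 : ∀ {n} → Polynomial n
  :0 = con (+ 0)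
  :1 = con (+ 1)

  -- Follows the unoptimised recursion behind `fromℕ`, so that over the reals its value is `fromℕ k`
  -- by computation.
  :fromℕ : ∀ {n} → ℕ → Polynomial n
  :fromℕ zero    = :0
  :fromℕ (suc k) = :1 :+ :fromℕ k

-- Ordered fields

module OrderedField (R : CompleteOrderedField) where
  open CompleteOrderedField R public
    hiding (Carrier; _≈_; _+_; _*_; -_; _-_; _⁻¹; 0#; 1#; _≤_; sup)
  open Reals R public
  open IsDecTotalOrder isDecTotalOrder public
    using (_≤?_; antisym; ≤-respˡ-≈; ≤-respʳ-≈; isPartialOrder)
    renaming (reflexive to ≤-reflexive; refl to ≤-refl; trans to ≤-trans; total to ≤-total)
  open import Algebra.Properties.Ring (CompleteOrderedField.ring R) public using (-‿involutive; -0#≈0#)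
  open import Algebra.Properties.Semiring.Exp semiring public
    using (^-congˡ; ^-homo-*; ^-assocʳ)
  open import Algebra.Properties.CommutativeSemiring.Exp commutativeSemiring public
    using (^-distrib-*)
  open import Algebra.Properties.Semiring.Mult semiring public
    using (×1-homo-*; ×-homo-+)
  open IntegerRingSolver commutativeRing public using (solve; _:=_; _:+_; _:*_; _:-_; :-_; _:^_; :0; :1; :fromℕ)

  poset : Poset _ _ _
  poset = record { isPartialOrder = isPartialOrder }

  module ≤-Reasoning where
    open import Relation.Binary.Reasoning.PartialOrder poset public

  open ≤-Reasoning

  ≰⇒≥ : ∀ {x y} → ¬ x ≤ y → y ≤ x
  ≰⇒≥ {x} {y} x≰y with ≤-total x y
  ... | inj₁ x≤y = contradiction x≤y x≰y
  ... | inj₂ y≤x = y≤x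

  ≰⇒> : ∀ {x y} → ¬ x ≤ y → y < x
  ≰⇒> x≰y = ≰⇒≥ x≰y , λ y≈x → x≰y (≤-reflexive (sym y≈x))

  <⇒≤ : ∀ {x y} → x < y → x ≤ y
  <⇒≤ = proj₁

  <⇒≱ : ∀ {x y} → x < y → ¬ y ≤ x
  <⇒≱ (x≤y , x≉y) y≤x = x≉y (antisym x≤y y≤x)

  +-monoˡ-≤ : ∀ z {x y} → x ≤ y → x + z ≤ y + z
  +-monoˡ-≤ z x≤y = ≤-respˡ-≈ (+-comm z _) (≤-respʳ-≈ (+-comm z _) (+-monoʳ-≤ z x≤y))

  +-mono-≤ : ∀ {x x′ y y′} → x ≤ x′ → y ≤ y′ → x + y ≤ x′ + y′
  +-mono-≤ x≤x′ y≤y′ = ≤-trans (+-monoˡ-≤ _ x≤x′) (+-monoʳ-≤ _ y≤y′)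

  0≤y-x : ∀ {x y} → x ≤ y → 0# ≤ y - x
  0≤y-x {x} {y} x≤y = ≤-respˡ-≈ (-‿inverseʳ x) (+-monoˡ-≤ (- x) x≤y)

  x+[y-x]≈y : ∀ x y → x + (y - x) ≈ y
  x+[y-x]≈y = solve 2 (λ x y → x :+ (y :- x) := y) refl

  x+y-y≈x : ∀ x y → (x + y) - y ≈ x
  x+y-y≈x = solve 2 (λ x y → (x :+ y) :- y := x) refl

  x-y+y≈x : ∀ x y → (x - y) + y ≈ x
  x-y+y≈x = solve 2 (λ x y → (x :- y) :+ y := x) refl

  x-[x-y]≈y : ∀ x y → x - (x - y) ≈ y
  x-[x-y]≈y = solve 2 (λ x y → x :- (x :- y) := y) refl

  0≤y-x⇒x≤y : ∀ {x y} → 0# ≤ y - x → x ≤ y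
  0≤y-x⇒x≤y {x} {y} h = ≤-respˡ-≈ (+-identityʳ x) (≤-respʳ-≈ (x+[y-x]≈y x y) (+-monoʳ-≤ x h))

  neg-antitone-≤ : ∀ {x y} → x ≤ y → - y ≤ - x
  neg-antitone-≤ {x} {y} x≤y = 0≤y-x⇒x≤y (≤-respʳ-≈ (eq x y) (0≤y-x x≤y))
    where
    eq : ∀ x y → y - x ≈ - x - (- y)
    eq = solve 2 (λ x y → y :- x := :- x :- (:- y)) refl

  x≤x+y : ∀ {x y} → 0# ≤ y → x ≤ x + y
  x≤x+y {x} 0≤y = ≤-respˡ-≈ (+-identityʳ x) (+-monoʳ-≤ x 0≤y)

  +-nonNegative : ∀ {x y} → 0# ≤ x → 0# ≤ y → 0# ≤ x + y
  +-nonNegative 0≤x 0≤y = ≤-trans 0≤x (x≤x+y 0≤y)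

  *-monoˡ-≤ : ∀ {z} → 0# ≤ z → ∀ {x y} → x ≤ y → z * x ≤ z * y
  *-monoˡ-≤ {z} 0≤z {x} {y} x≤y = 0≤y-x⇒x≤y (≤-respʳ-≈ (eq z x y) (*-nonNegative 0≤z (0≤y-x x≤y)))
    where
    eq : ∀ z x y → z * (y - x) ≈ z * y - z * x
    eq = solve 3 (λ z x y → z :* (y :- x) := z :* y :- z :* x) refl

  *-monoʳ-≤ : ∀ {z} → 0# ≤ z → ∀ {x y} → x ≤ y → x * z ≤ y * z
  *-monoʳ-≤ 0≤z x≤y = ≤-respˡ-≈ (*-comm _ _) (≤-respʳ-≈ (*-comm _ _) (*-monoˡ-≤ 0≤z x≤y))

  *-mono-≤ : ∀ {x x′ y y′} → 0# ≤ x → 0# ≤ y → x ≤ x′ → y ≤ y′ → x * y ≤ x′ * y′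
  *-mono-≤ 0≤x 0≤y x≤x′ y≤y′ = ≤-trans (*-monoˡ-≤ 0≤x y≤y′) (*-monoʳ-≤ (≤-trans 0≤y y≤y′) x≤x′)

  0≤x*x : ∀ x → 0# ≤ x * x
  0≤x*x x with ≤-total 0# x
  ... | inj₁ 0≤x = *-nonNegative 0≤x 0≤x
  ... | inj₂ x≤0 = ≤-respʳ-≈ (eq x) (*-nonNegative 0≤-x 0≤-x)
    where
    0≤-x : 0# ≤ - x
    0≤-x = ≤-respˡ-≈ -0#≈0# (neg-antitone-≤ x≤0)
    eq : ∀ x → - x * - x ≈ x * x
    eq = solve 1 (λ x → (:- x) :* (:- x) := x :* x) refl

  0≤1 : 0# ≤ 1#
  0≤1 = ≤-respʳ-≈ (*-identityˡ 1#) (0≤x*x 1#)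

  0<1 : 0# < 1#
  0<1 = 0≤1 , λ 0≈1 → 1≉0 (sym 0≈1)

  0<⇒≉0 : ∀ {x} → 0# < x → ¬ (x ≈ 0#)
  0<⇒≉0 0<x x≈0 = proj₂ 0<x (sym x≈0)

  1≤⇒0< : ∀ {x} → 1# ≤ x → 0# < x
  1≤⇒0< 1≤x = begin-strict _ <⟨ 0<1 ⟩ _ ≤⟨ 1≤x ⟩ _ ∎

  ⁻¹-inverseˡ : ∀ x → ¬ (x ≈ 0#) → x ⁻¹ * x ≈ 1#
  ⁻¹-inverseˡ x x≉0 = trans (*-comm _ _) (⁻¹-inverseʳ x x≉0)

  ⁻¹-nonNegative : ∀ {x} → 0# < x → 0# ≤ x ⁻¹
  ⁻¹-nonNegative {x} 0<x with ≤-total 0# (x ⁻¹)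
  ... | inj₁ 0≤x⁻¹ = 0≤x⁻¹
  ... | inj₂ x⁻¹≤0 = contradiction 1≤0 (<⇒≱ 0<1)
    where
    1≤0 : 1# ≤ 0#
    1≤0 = begin
      1#        ≈⟨ ⁻¹-inverseʳ x (0<⇒≉0 0<x) ⟨
      x * x ⁻¹  ≤⟨ *-monoˡ-≤ (<⇒≤ 0<x) x⁻¹≤0 ⟩
      x * 0#    ≈⟨ zeroʳ x ⟩
      0#        ∎

  ⁻¹-positive : ∀ {x} → 0# < x → 0# < x ⁻¹
  ⁻¹-positive {x} 0<x = ⁻¹-nonNegative 0<x , λ 0≈x⁻¹ → 1≉0
    (trans (sym (⁻¹-inverseʳ x (0<⇒≉0 0<x))) (trans (*-congˡ (sym 0≈x⁻¹)) (zeroʳ x)))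

  *-cancelˡ-≤ : ∀ {z} → 0# < z → ∀ {x y} → z * x ≤ z * y → x ≤ y
  *-cancelˡ-≤ {z} 0<z {x} {y} h = begin
    x               ≈⟨ eq x ⟨
    z ⁻¹ * (z * x)  ≤⟨ *-monoˡ-≤ (⁻¹-nonNegative 0<z) h ⟩
    z ⁻¹ * (z * y)  ≈⟨ eq y ⟩
    y               ∎
    where
    eq : ∀ x → z ⁻¹ * (z * x) ≈ x
    eq x = trans (sym (*-assoc _ _ _)) (trans (*-congʳ (⁻¹-inverseˡ z (0<⇒≉0 0<z))) (*-identityˡ x))

  *-cancelʳ-≤ : ∀ {z} → 0# < z → ∀ {x y} → x * z ≤ y * z → x ≤ y
  *-cancelʳ-≤ 0<z h = *-cancelˡ-≤ 0<z (≤-respˡ-≈ (*-comm _ _) (≤-respʳ-≈ (*-comm _ _) h))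

  *-positive : ∀ {x y} → 0# < x → 0# < y → 0# < x * y
  *-positive {x} {y} 0<x 0<y = ≰⇒> λ xy≤0 →
    <⇒≱ 0<y (*-cancelˡ-≤ 0<x (≤-respʳ-≈ (sym (zeroʳ x)) xy≤0))

  +-positiveˡ : ∀ {x y} → 0# < x → 0# ≤ y → 0# < x + y
  +-positiveˡ 0<x 0≤y = begin-strict _ <⟨ 0<x ⟩ _ ≤⟨ x≤x+y 0≤y ⟩ _ ∎

  x≤y*z⇒x*y⁻¹≤z : ∀ {x y z} → 0# < y → x ≤ y * z → x * y ⁻¹ ≤ z
  x≤y*z⇒x*y⁻¹≤z {x} {y} {z} 0<y h = begin
    x * y ⁻¹        ≤⟨ *-monoʳ-≤ (⁻¹-nonNegative 0<y) h ⟩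
    y * z * y ⁻¹    ≈⟨ solve 3 (λ y z i → y :* z :* i := (y :* i) :* z) refl y z (y ⁻¹) ⟩
    (y * y ⁻¹) * z  ≈⟨ *-congʳ (⁻¹-inverseʳ y (0<⇒≉0 0<y)) ⟩
    1# * z          ≈⟨ *-identityˡ z ⟩
    z               ∎

  ÷-*-cancel : ∀ x {y} → ¬ (y ≈ 0#) → x ÷ y * y ≈ x
  ÷-*-cancel x y≉0 = trans (*-assoc _ _ _) (trans (*-congˡ (⁻¹-inverseˡ _ y≉0)) (*-identityʳ x))

  square-cancel-≤ : ∀ {x y} → 0# ≤ y → x * x ≤ y * y → x ≤ y
  square-cancel-≤ {x} {y} 0≤y h with x ≤? y
  ... | yes x≤y = x≤y
  ... | no  x≰y = contradiction (begin
      x      ≤⟨ *-cancelˡ-≤ 0<x (≤-trans h (*-monoʳ-≤ 0≤y (<⇒≤ y<x))) ⟩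
      y      ∎) x≰y
    where
    y<x = ≰⇒> x≰y
    0<x : 0# < x
    0<x = begin-strict 0# ≤⟨ 0≤y ⟩ y <⟨ y<x ⟩ x ∎

  ^-nonNegative : ∀ {x} → 0# ≤ x → ∀ n → 0# ≤ x ^ n
  ^-nonNegative 0≤x zero    = 0≤1
  ^-nonNegative 0≤x (suc n) = *-nonNegative 0≤x (^-nonNegative 0≤x n)

  ^-positive : ∀ {x} → 0# < x → ∀ n → 0# < x ^ n
  ^-positive 0<x zero    = 0<1
  ^-positive 0<x (suc n) = *-positive 0<x (^-positive 0<x n)

  ^-monoˡ-≤ : ∀ {x y} → 0# ≤ x → x ≤ y → ∀ n → x ^ n ≤ y ^ n
  ^-monoˡ-≤ 0≤x x≤y zero    = ≤-refl
  ^-monoˡ-≤ 0≤x x≤y (suc n) = *-mono-≤ 0≤x (^-nonNegative 0≤x n) x≤y (^-monoˡ-≤ 0≤x x≤y n)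

  1≤x^n : ∀ {x} → 1# ≤ x → ∀ n → 1# ≤ x ^ n
  1≤x^n 1≤x zero    = ≤-refl
  1≤x^n 1≤x (suc n) = ≤-respˡ-≈ (*-identityˡ 1#) (*-mono-≤ 0≤1 0≤1 1≤x (1≤x^n 1≤x n))

  ^-monoʳ-≤ : ∀ {x} → 1# ≤ x → ∀ {m n} → m ℕ.≤ n → x ^ m ≤ x ^ n
  ^-monoʳ-≤ {x} 1≤x {n = n} ℕ.z≤n = 1≤x^n 1≤x n
  ^-monoʳ-≤ 1≤x (ℕ.s≤s m≤n) = *-monoˡ-≤ (≤-trans 0≤1 1≤x) (^-monoʳ-≤ 1≤x m≤n)

  ^-cancel-≤ : ∀ {x y} → 0# ≤ y → ∀ n → x ^ suc n ≤ y ^ suc n → x ≤ y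
  ^-cancel-≤ {x} {y} 0≤y n h with x ≤? y
  ... | yes x≤y = x≤y
  ... | no  x≰y = contradiction (*-cancelʳ-≤ (^-positive 0<x n) (begin
      x * x ^ n  ≤⟨ h ⟩
      y * y ^ n  ≤⟨ *-monoˡ-≤ 0≤y (^-monoˡ-≤ 0≤y (≰⇒≥ x≰y) n) ⟩
      y * x ^ n  ∎)) x≰y
    where
    0<x : 0# < x
    0<x = begin-strict 0# ≤⟨ 0≤y ⟩ y <⟨ ≰⇒> x≰y ⟩ x ∎

  1^n≈1 : ∀ n → 1# ^ n ≈ 1#
  1^n≈1 zero    = refl
  1^n≈1 (suc n) = trans (*-identityˡ _) (1^n≈1 n)

  fromℕ-nonNegative : ∀ n → 0# ≤ fromℕ n
  fromℕ-nonNegative zero    = ≤-refl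
  fromℕ-nonNegative (suc n) = +-nonNegative 0≤1 (fromℕ-nonNegative n)

  1≤fromℕ-suc : ∀ n → 1# ≤ fromℕ (suc n)
  1≤fromℕ-suc n = x≤x+y (fromℕ-nonNegative n)

  fromℕ-positive : ∀ n → 0# < fromℕ (suc n)
  fromℕ-positive n = 1≤⇒0< (1≤fromℕ-suc n)

  fromℕ-homo-+ : ∀ m n → fromℕ (m ℕ.+ n) ≈ fromℕ m + fromℕ n
  fromℕ-homo-+ = ×-homo-+ 1#

  fromℕ-homo-* : ∀ m n → fromℕ (m ℕ.* n) ≈ fromℕ m * fromℕ n
  fromℕ-homo-* = ×1-homo-*

  fromℕ-mono-≤ : ∀ {m n} → m ℕ.≤ n → fromℕ m ≤ fromℕ n
  fromℕ-mono-≤ {n = n} ℕ.z≤n = fromℕ-nonNegative n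
  fromℕ-mono-≤ (ℕ.s≤s m≤n)   = +-monoʳ-≤ 1# (fromℕ-mono-≤ m≤n)

  fromℕ-cancel-≤ : ∀ {m n} → fromℕ m ≤ fromℕ n → m ℕ.≤ n
  fromℕ-cancel-≤ {m} {n} h with m ℕ.≤? n
  ... | yes m≤n = m≤n
  ... | no  m≰n = contradiction (≤-trans (fromℕ-mono-≤ (ℕ.≰⇒> m≰n)) h) λ 1+n≤n →
    <⇒≱ 0<1 (0≤y-x⇒x≤y (≤-respʳ-≈ (eq (fromℕ n)) (0≤y-x 1+n≤n)))
    where
    eq : ∀ x → x - (1# + x) ≈ 0# - 1#
    eq x = begin-equality
      x - (1# + x)   ≈⟨ solve 2 (λ x o → x :- (o :+ x) := :- o) refl x 1# ⟩
      - 1#           ≈⟨ +-identityˡ _ ⟨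
      0# - 1#        ∎

-- Roots and real powers

module Powers (R : CompleteOrderedField) where
  open OrderedField R
  open ≤-Reasoning
  open import Algebra.Properties.Semiring.Exp semiring using (^-congʳ)

  -- A bound for the difference quotients of the n-th power at points of [0, r] with increments at
  -- most 1. The recursion comes from multiplying the bound for n by x + ε, where x ≤ r and ε ≤ 1.
  slope : ℝ → ℕ → ℝ
  slope r zero    = 0#
  slope r (suc n) = r ^ n + (r + 1#) * slope r n

  slope-nonNegative : ∀ {r} → 0# ≤ r → ∀ n → 0# ≤ slope r n
  slope-nonNegative 0≤r zero    = ≤-refl
  slope-nonNegative 0≤r (suc n) = +-nonNegative (^-nonNegative 0≤r n)
    (*-nonNegative (+-nonNegative 0≤r 0≤1) (slope-nonNegative 0≤r n))

  [x+ε]^n≤x^n+ε*slope : ∀ {x r ε} → 0# ≤ x → x ≤ r → 0# ≤ ε → ε ≤ 1# →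
    ∀ n → (x + ε) ^ n ≤ x ^ n + ε * slope r n
  [x+ε]^n≤x^n+ε*slope 0≤x x≤r 0≤ε ε≤1 zero = x≤x+y (≤-reflexive (sym (zeroʳ _)))
  [x+ε]^n≤x^n+ε*slope {x} {r} {ε} 0≤x x≤r 0≤ε ε≤1 (suc n) = begin
    (x + ε) * (x + ε) ^ n
      ≤⟨ *-monoˡ-≤ (+-nonNegative 0≤x 0≤ε) ([x+ε]^n≤x^n+ε*slope 0≤x x≤r 0≤ε ε≤1 n) ⟩
    (x + ε) * (x ^ n + ε * slope r n)
      ≈⟨ solve 4 (λ x ε p k → (x :+ ε) :* (p :+ ε :* k) := x :* p :+ ε :* (p :+ (x :+ ε) :* k))
           refl x ε (x ^ n) (slope r n) ⟩
    x * x ^ n + ε * (x ^ n + (x + ε) * slope r n)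
      ≤⟨ +-monoʳ-≤ _ (*-monoˡ-≤ 0≤ε (+-mono-≤ (^-monoˡ-≤ 0≤x x≤r n)
           (*-monoʳ-≤ (slope-nonNegative 0≤r n) (+-mono-≤ x≤r ε≤1)))) ⟩
    x * x ^ n + ε * (r ^ n + (r + 1#) * slope r n) ∎
    where
    0≤r : 0# ≤ r
    0≤r = ≤-trans 0≤x x≤r

  common-lower-bound : ∀ {x y} → 0# < x → 0# < y → ∃ λ z → 0# < z × z ≤ x × z ≤ y
  common-lower-bound {x} {y} 0<x 0<y with ≤-total x y
  ... | inj₁ x≤y = x , 0<x , ≤-refl , x≤y
  ... | inj₂ y≤x = y , 0<y , y≤x , ≤-refl

  small-multiple : ∀ {δ k} → 0# < δ → 0# ≤ k → ∃ λ ε → 0# < ε × ε ≤ 1# × ε * k ≤ δ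
  small-multiple {δ} {k} 0<δ 0≤k = ε , 0<ε , proj₁ ε≤ , (begin
    ε * k                         ≤⟨ *-monoˡ-≤ (<⇒≤ 0<ε) (≤-respʳ-≈ (+-comm k 1#) (x≤x+y 0≤1)) ⟩
    ε * (1# + k)                  ≤⟨ *-monoʳ-≤ (<⇒≤ 0<1+k) (proj₂ ε≤) ⟩
    δ * (1# + k) ⁻¹ * (1# + k)    ≈⟨ ÷-*-cancel δ (0<⇒≉0 0<1+k) ⟩
    δ                             ∎)
    where
    0<1+k : 0# < 1# + k
    0<1+k = 1≤⇒0< (x≤x+y 0≤k)
    -- The denominator is `1# + k` because k may be zero.
    bound = common-lower-bound 0<1 (*-positive 0<δ (⁻¹-positive 0<1+k))
    ε = proj₁ bound
    0<ε : 0# < ε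
    0<ε = proj₁ (proj₂ bound)
    ε≤ : ε ≤ 1# × ε ≤ δ * (1# + k) ⁻¹
    ε≤ = proj₂ (proj₂ bound)

  x≤x^[1+n] : ∀ {x} → 1# ≤ x → ∀ n → x ≤ x ^ suc n
  x≤x^[1+n] {x} 1≤x n = ≤-respˡ-≈ (*-identityʳ x) (*-monoˡ-≤ (≤-trans 0≤1 1≤x) (1≤x^n 1≤x n))

  0<y-x : ∀ {x y} → x < y → 0# < y - x
  0<y-x x<y = ≰⇒> λ y-x≤0 → <⇒≱ x<y (begin
    _              ≈⟨ x+[y-x]≈y _ _ ⟨
    _ + (_ - _)    ≤⟨ +-monoʳ-≤ _ y-x≤0 ⟩
    _ + 0#         ≈⟨ +-identityʳ _ ⟩
    _              ∎)

  x<x+ε : ∀ {x ε} → 0# < ε → x < x + ε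
  x<x+ε {x} {ε} 0<ε = ≰⇒> λ x+ε≤x → <⇒≱ 0<ε (begin
    ε            ≈⟨ x+y-y≈x ε x ⟨
    ε + x - x    ≈⟨ +-congʳ (+-comm ε x) ⟩
    x + ε - x    ≤⟨ +-monoˡ-≤ (- x) x+ε≤x ⟩
    x - x        ≈⟨ -‿inverseʳ x ⟩
    0#           ∎)

  x-ε<x : ∀ {x ε} → 0# < ε → x - ε < x
  x-ε<x {x} {ε} 0<ε = begin-strict
    x - ε        <⟨ x<x+ε 0<ε ⟩
    x - ε + ε    ≈⟨ x-y+y≈x x ε ⟩
    x            ∎

  -- Common ground of `root` and `power`, both suprema of bounded sets that contain 0. Such sets may
  -- have negative elements, so estimates on n-th powers are asked only of the nonnegative ones.
  module Sup {P : Pred ℝ (lsuc 0ℓ)} (0∈P : P 0#) (bounded : ∃ (IsUpperBound P)) where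

    sup-nonNegative : 0# ≤ sup P
    sup-nonNegative = sup-upper P (_ , 0∈P) bounded 0# 0∈P

    y≤sup : ∀ {y} → P y → y ≤ sup P
    y≤sup = sup-upper P (_ , 0∈P) bounded _

    -- Continuity of the n-th power: if r = sup P had r^n > x, then (r - ε)^n ≥ x for some small ε >
    -- 0, and r - ε would already be an upper bound.
    sup^n≤ : ∀ n {x} → 0# ≤ x → (∀ y → P y → 0# ≤ y → y ^ suc n ≤ x) → sup P ^ suc n ≤ x
    sup^n≤ n {x} 0≤x y^n≤x = decidable-stable (r ^ suc n ≤? x) λ r^n≰x →
      no-gap (≰⇒> r^n≰x) (≰⇒> λ r≤0 → r^n≰x (begin
        r * r ^ n   ≤⟨ *-monoʳ-≤ (^-nonNegative sup-nonNegative n) r≤0 ⟩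
        0# * r ^ n  ≈⟨ zeroˡ _ ⟩
        0#          ≤⟨ 0≤x ⟩
        x           ∎))
      where
      r = sup P
      k = slope r (suc n)
      0≤k : 0# ≤ k
      0≤k = slope-nonNegative sup-nonNegative (suc n)

      no-gap : x < r ^ suc n → ¬ (0# < r)
      no-gap x<r^n 0<r = <⇒≱ (x-ε<x 0<ε) (sup-least P (_ , 0∈P) bounded (r - ε) bound)
        where
        δ = small-multiple (0<y-x x<r^n) 0≤k
        ε₁ = proj₁ δ
        -- Here `ε₁` controls the drop of the n-th power, and the cap by r keeps r - ε nonnegative,
        -- as needed to compare bases by their powers.
        η = common-lower-bound (proj₁ (proj₂ δ)) 0<r
        ε = proj₁ η
        0<ε : 0# < ε
        0<ε = proj₁ (proj₂ η)
        ε≤ε₁ : ε ≤ ε₁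
        ε≤ε₁ = proj₁ (proj₂ (proj₂ η))
        0≤r-ε : 0# ≤ r - ε
        0≤r-ε = 0≤y-x (proj₂ (proj₂ (proj₂ η)))
        x≤[r-ε]^n : x ≤ (r - ε) ^ suc n
        x≤[r-ε]^n = begin
          x                                  ≈⟨ x-[x-y]≈y (r ^ suc n) x ⟨
          r ^ suc n - (r ^ suc n - x)        ≤⟨ +-monoʳ-≤ _ (neg-antitone-≤ (proj₂ (proj₂ (proj₂ δ)))) ⟩
          r ^ suc n - ε₁ * k                 ≤⟨ +-monoʳ-≤ _ (neg-antitone-≤ (*-monoʳ-≤ 0≤k ε≤ε₁)) ⟩
          r ^ suc n - ε * k                  ≈⟨ +-congʳ (^-congˡ (suc n) (x-y+y≈x r ε)) ⟨
          ((r - ε) + ε) ^ suc n - ε * k      ≤⟨ +-monoˡ-≤ _ ([x+ε]^n≤x^n+ε*slope 0≤r-ε (<⇒≤ (x-ε<x 0<ε))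
                                                  (<⇒≤ 0<ε) (≤-trans ε≤ε₁ (proj₁ (proj₂ (proj₂ δ)))) (suc n)) ⟩
          ((r - ε) ^ suc n + ε * k) - ε * k  ≈⟨ x+y-y≈x _ _ ⟩
          (r - ε) ^ suc n                    ∎
        bound : IsUpperBound P (r - ε)
        bound y y∈P = [ (λ 0≤y → ^-cancel-≤ 0≤r-ε n (≤-trans (y^n≤x y y∈P 0≤y) x≤[r-ε]^n))
                      , (λ y≤0 → ≤-trans y≤0 0≤r-ε) ]′ (≤-total 0# y)

  module Root (n : ℕ) {x : ℝ} (0≤x : 0# ≤ x) where
    private
      P : Pred ℝ (lsuc 0ℓ)
      P y = y ^ suc n ≤ x

      bounded : ∃ (IsUpperBound P)
      -- As 1 + x is at least 1, it lies below its own positive powers.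
      bounded = 1# + x , λ y y^n≤x → ^-cancel-≤ (+-nonNegative 0≤1 0≤x) n (begin
        y ^ suc n         ≤⟨ y^n≤x ⟩
        x                 ≤⟨ ≤-respʳ-≈ (+-comm x 1#) (x≤x+y 0≤1) ⟩
        1# + x            ≤⟨ x≤x^[1+n] (x≤x+y 0≤x) n ⟩
        (1# + x) ^ suc n  ∎)

      0∈P : P 0#
      0∈P = ≤-respˡ-≈ (sym (zeroˡ _)) 0≤x

    open Sup {P} 0∈P bounded

    root-nonNegative : 0# ≤ root (suc n) x
    root-nonNegative = sup-nonNegative

    root^n≤x : root (suc n) x ^ suc n ≤ x
    root^n≤x = sup^n≤ n 0≤x λ _ y^n≤x _ → y^n≤x

    -- If r^n < x, the slope estimate leaves room for some r + ε with ε > 0 in the set, above its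
    -- supremum r.
    x≤root^n : x ≤ root (suc n) x ^ suc n
    x≤root^n = decidable-stable (x ≤? r ^ suc n) λ x≰r^n → no-gap (≰⇒> x≰r^n)
      where
      r = root (suc n) x
      no-gap : ¬ (r ^ suc n < x)
      no-gap r^n<x = <⇒≱ (x<x+ε 0<ε) (y≤sup (begin
        (r + ε) ^ suc n                    ≤⟨ [x+ε]^n≤x^n+ε*slope root-nonNegative ≤-refl (<⇒≤ 0<ε)
                                                (proj₁ (proj₂ (proj₂ δ))) (suc n) ⟩
        r ^ suc n + ε * slope r (suc n)    ≤⟨ +-monoʳ-≤ _ (proj₂ (proj₂ (proj₂ δ))) ⟩
        r ^ suc n + (x - r ^ suc n)        ≈⟨ x+[y-x]≈y _ _ ⟩
        x                                  ∎))
        where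
        δ = small-multiple (0<y-x r^n<x) (slope-nonNegative root-nonNegative (suc n))
        ε = proj₁ δ
        0<ε : 0# < ε
        0<ε = proj₁ (proj₂ δ)

  module Power (b : ℕ) (1≤b : 1# ≤ fromℕ b) {x : ℝ} {N : ℕ} (x≤N : x ≤ fromℕ N)
    (1≤2x : 1# ≤ x * fromℕ 2) where
    private
      P : Pred ℝ (lsuc 0ℓ)
      P y = ∃₂ λ m n → fromℕ (suc m) ≤ x * fromℕ (suc n) × y ^ suc n ≤ fromℕ b ^ suc m

      0≤b : 0# ≤ fromℕ b
      0≤b = ≤-trans 0≤1 1≤b

      bounded : ∃ (IsUpperBound P)
      bounded = fromℕ b ^ N , λ y (m , n , m≤xn , y^n≤b^m) → ^-cancel-≤ (^-nonNegative 0≤b N) n (begin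
        y ^ suc n                  ≤⟨ y^n≤b^m ⟩
        fromℕ b ^ suc m            ≤⟨ ^-monoʳ-≤ 1≤b (fromℕ-cancel-≤ {suc m} {N ℕ.* suc n} (begin
             fromℕ (suc m)             ≤⟨ m≤xn ⟩
             x * fromℕ (suc n)         ≤⟨ *-monoʳ-≤ (fromℕ-nonNegative (suc n)) x≤N ⟩
             fromℕ N * fromℕ (suc n)   ≈⟨ fromℕ-homo-* N (suc n) ⟨
             fromℕ (N ℕ.* suc n)       ∎)) ⟩
        fromℕ b ^ (N ℕ.* suc n)    ≈⟨ ^-assocʳ (fromℕ b) N (suc n) ⟨
        (fromℕ b ^ N) ^ suc n      ∎)

      0∈P : P 0#
      -- Indices are predecessors: this is the exponent m / n = 1 / 2.
      0∈P = 0 , 1 , ≤-respˡ-≈ (sym (+-identityʳ 1#)) 1≤2x ,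
            ≤-respˡ-≈ (sym (zeroˡ _)) (^-nonNegative 0≤b 1)

    open Sup {P} 0∈P bounded public
      renaming (sup-nonNegative to power-nonNegative; y≤sup to y≤power; sup^n≤ to power^n≤)

  x*z≤y⇒x≤y*z⁻¹ : ∀ {x y z} → 0# < z → x * z ≤ y → x ≤ y * z ⁻¹
  x*z≤y⇒x≤y*z⁻¹ {x} {y} {z} 0<z h = *-cancelʳ-≤ 0<z (≤-respʳ-≈ (sym (÷-*-cancel y (0<⇒≉0 0<z))) h)

  0<fromℕ⇒1≤fromℕ : ∀ n → 0# < fromℕ n → 1# ≤ fromℕ n
  0<fromℕ⇒1≤fromℕ zero    0<0 = contradiction ≤-refl (<⇒≱ 0<0)
  0<fromℕ⇒1≤fromℕ (suc n) _   = 1≤fromℕ-suc n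

  -- The hypothesis on a says that q ^ D is (q ^ a) ^ (w - u x); since
  -- powers are suprema over rational exponents m / n, the inequality is
  -- proved after raising to the n-th power, with p = w n - u m.
  power-transfer : ∀ {q L : ℕ} {c x a : ℝ} (u w D N : ℕ) →
    1# ≤ fromℕ q → 0# < c → c ≤ 1# →
    x ≤ 1# → 1# ≤ x * fromℕ 2 →
    1# ≤ a → a ≤ fromℕ N →
    0# < fromℕ w - fromℕ (suc u) * x →
    fromℕ (suc D) ≤ a * (fromℕ w - fromℕ (suc u) * x) →
    c * power q a ≤ fromℕ L →
    1# ≤ fromℕ L ×
    power L x ^ suc u * (fromℕ q ^ suc D * c ^ w) ≤ fromℕ L ^ w
  power-transfer {q} {L} {c} {x} {a} u w D N 1≤q 0<c c≤1 x≤1 1≤2x 1≤a a≤N 0<e D≤ae cqᵃ≤L =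
    1≤L , (begin
      power L x ^ suc u * (fromℕ q ^ suc D * c ^ w)
        ≤⟨ *-monoʳ-≤ (<⇒≤ 0<g) (Lx.power^n≤ u (*-nonNegative (^-nonNegative 0≤L w) (⁻¹-nonNegative 0<g)) key) ⟩
      fromℕ L ^ w * (fromℕ q ^ suc D * c ^ w) ⁻¹ * (fromℕ q ^ suc D * c ^ w)
        ≈⟨ ÷-*-cancel _ (0<⇒≉0 0<g) ⟩
      fromℕ L ^ w ∎)
    where
    e = fromℕ w - fromℕ (suc u) * x
    g = fromℕ q ^ suc D * c ^ w
    0<q = 1≤⇒0< 1≤q

    0<g : 0# < g
    0<g = *-positive (^-positive 0<q (suc D)) (^-positive 0<c w)

    0≤x : 0# ≤ x
    0≤x = *-cancelʳ-≤ (fromℕ-positive 1) (≤-respˡ-≈ (sym (zeroˡ _)) (≤-trans 0≤1 1≤2x))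

    1≤2a : 1# ≤ a * fromℕ 2
    1≤2a = begin
      1#            ≤⟨ 1≤fromℕ-suc 1 ⟩
      fromℕ 2       ≈⟨ *-identityˡ _ ⟨
      1# * fromℕ 2  ≤⟨ *-monoʳ-≤ (fromℕ-nonNegative 2) 1≤a ⟩
      a * fromℕ 2   ∎

    module qa = Power q 1≤q {a} {N} a≤N 1≤2a

    1≤power : 1# ≤ power q a
    -- The value 1 is in the set with exponent 1 / 1, which is at most a.
    1≤power = qa.y≤power (0 , 0 ,
      ≤-respˡ-≈ (*-identityˡ _) (*-monoʳ-≤ (fromℕ-nonNegative 1) 1≤a) , ^-monoˡ-≤ 0≤1 1≤q 1)

    0<L : 0# < fromℕ L
    0<L = begin-strict
      0#             <⟨ 0<c ⟩
      c              ≈⟨ *-identityʳ c ⟨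
      c * 1#         ≤⟨ *-monoˡ-≤ (<⇒≤ 0<c) 1≤power ⟩
      c * power q a  ≤⟨ cqᵃ≤L ⟩
      fromℕ L        ∎

    0≤L = <⇒≤ 0<L

    1≤L = 0<fromℕ⇒1≤fromℕ L 0<L

    module Lx = Power L 1≤L {x} {1} (≤-respʳ-≈ (sym (+-identityʳ 1#)) x≤1) 1≤2x

    exponent : ∀ m n → fromℕ (suc m) ≤ x * fromℕ (suc n) →
      ∃ λ p → w ℕ.* suc n ≡ suc p ℕ.+ suc u ℕ.* suc m ×
      fromℕ (suc D ℕ.* suc n) ≤ a * fromℕ (suc p)
    exponent m n m≤xn = p , ≡.sym eq , (begin
      fromℕ (suc D ℕ.* suc n)      ≈⟨ fromℕ-homo-* (suc D) (suc n) ⟩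
      fromℕ (suc D) * fromℕ (suc n) ≤⟨ *-monoʳ-≤ (fromℕ-nonNegative (suc n)) D≤ae ⟩
      a * e * fromℕ (suc n)        ≈⟨ *-assoc a e _ ⟩
      a * (e * fromℕ (suc n))      ≤⟨ *-monoˡ-≤ (≤-trans 0≤1 1≤a) en≤p ⟩
      a * fromℕ (suc p)            ∎)
      where
      v = suc u ℕ.* suc m
      um+en≤wn : fromℕ v + e * fromℕ (suc n) ≤ fromℕ (w ℕ.* suc n)
      um+en≤wn = begin
        fromℕ v + e * fromℕ (suc n)
          ≈⟨ +-congʳ (fromℕ-homo-* (suc u) (suc m)) ⟩
        fromℕ (suc u) * fromℕ (suc m) + e * fromℕ (suc n)
          ≤⟨ +-monoˡ-≤ _ (*-monoˡ-≤ (fromℕ-nonNegative (suc u)) m≤xn) ⟩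
        fromℕ (suc u) * (x * fromℕ (suc n)) + e * fromℕ (suc n)
          ≈⟨ solve 4 (λ u x n w → u :* (x :* n) :+ (w :- u :* x) :* n := w :* n) refl
               (fromℕ (suc u)) x (fromℕ (suc n)) (fromℕ w) ⟩
        fromℕ w * fromℕ (suc n)
          ≈⟨ fromℕ-homo-* w (suc n) ⟨
        fromℕ (w ℕ.* suc n) ∎
      v<wn : v ℕ.< w ℕ.* suc n
      v<wn = ℕ.≰⇒> λ wn≤v → <⇒≱ (*-positive 0<e (fromℕ-positive n)) (begin
        e * fromℕ (suc n)                          ≈⟨ trans (+-congʳ (+-comm _ _)) (x+y-y≈x _ (fromℕ v)) ⟨
        (fromℕ v + e * fromℕ (suc n)) - fromℕ v    ≤⟨ +-monoˡ-≤ _ (≤-trans um+en≤wn (fromℕ-mono-≤ wn≤v)) ⟩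
        fromℕ v - fromℕ v                          ≈⟨ -‿inverseʳ _ ⟩
        0#                                         ∎)
      -- By `v<wn` the truncated subtraction is exact. Exponents are indexed by predecessors, so
      -- `suc v` is removed and `suc p` is w n - v.
      p = w ℕ.* suc n ℕ.∸ suc v
      eq : suc p ℕ.+ v ≡ w ℕ.* suc n
      eq = ≡.trans (≡.sym (ℕ.+-suc p v)) (ℕ.m∸n+n≡m v<wn)
      en≤p : e * fromℕ (suc n) ≤ fromℕ (suc p)
      en≤p = begin
        e * fromℕ (suc n)                        ≈⟨ trans (+-congʳ (+-comm _ _)) (x+y-y≈x _ (fromℕ v)) ⟨
        (fromℕ v + e * fromℕ (suc n)) - fromℕ v  ≤⟨ +-monoˡ-≤ _ um+en≤wn ⟩
        fromℕ (w ℕ.* suc n) - fromℕ v            ≡⟨ ≡.cong (λ k → fromℕ k - fromℕ v) eq ⟨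
        fromℕ (suc p ℕ.+ v) - fromℕ v            ≈⟨ +-congʳ (fromℕ-homo-+ (suc p) v) ⟩
        (fromℕ (suc p) + fromℕ v) - fromℕ v      ≈⟨ x+y-y≈x _ _ ⟩
        fromℕ (suc p)                            ∎

    ^-*-comm : ∀ y m n → (y ^ m) ^ n ≈ (y ^ n) ^ m
    ^-*-comm y m n = trans (^-assocʳ y m n)
      (trans (^-congʳ y (ℕ.*-comm m n)) (sym (^-assocʳ y n m)))

    key : ∀ y → (∃₂ λ m n → fromℕ (suc m) ≤ x * fromℕ (suc n) × y ^ suc n ≤ fromℕ L ^ suc m) →
      0# ≤ y → y ^ suc u ≤ fromℕ L ^ w * g ⁻¹
    key y (m , n , m≤xn , y^n≤L^m) 0≤y = x*z≤y⇒x≤y*z⁻¹ 0<g (^-cancel-≤ (^-nonNegative 0≤L w) n (begin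
      (y ^ suc u * (fromℕ q ^ suc D * c ^ w)) ^ suc n
        ≈⟨ trans (^-distrib-* _ _ (suc n)) (*-cong (^-*-comm y (suc u) (suc n))
             (trans (^-distrib-* _ _ (suc n)) (*-cong (^-assocʳ _ (suc D) (suc n))
               (trans (^-assocʳ c w (suc n)) (trans (^-congʳ c wn≡p+um) (^-homo-* c (suc p) um)))))) ⟩
      (y ^ suc n) ^ suc u * (fromℕ q ^ Dn * (c ^ suc p * c ^ um))
        -- Of the factor c^(wn) only c^(p+1) is kept, just enough to pair with z^(p+1); the
        -- remaining power of c is at most 1.
        ≤⟨ *-mono-≤ (^-nonNegative (^-nonNegative 0≤y (suc n)) (suc u))
             (*-nonNegative 0≤Q (*-nonNegative (0≤c^ (suc p)) (0≤c^ um)))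
             (^-monoˡ-≤ (^-nonNegative 0≤y (suc n)) y^n≤L^m (suc u))
             (*-mono-≤ 0≤Q (*-nonNegative (0≤c^ (suc p)) (0≤c^ um)) rt.x≤root^n (*-monoˡ-≤ (0≤c^ (suc p)) (c^n≤1 um))) ⟩
      (fromℕ L ^ suc m) ^ suc u * (z ^ suc p * (c ^ suc p * 1#))
        ≈⟨ *-cong (^-*-comm _ (suc m) (suc u)) (trans (*-congˡ (*-identityʳ _))
             (trans (*-comm _ _) (sym (^-distrib-* c z (suc p))))) ⟩
      (fromℕ L ^ suc u) ^ suc m * (c * z) ^ suc p
        ≤⟨ *-monoˡ-≤ (^-nonNegative (^-nonNegative 0≤L (suc u)) (suc m))
             (^-monoˡ-≤ (*-nonNegative (<⇒≤ 0<c) rt.root-nonNegative) cz≤L (suc p)) ⟩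
      (fromℕ L ^ suc u) ^ suc m * fromℕ L ^ suc p
        ≈⟨ trans (*-congʳ (^-assocʳ _ (suc u) (suc m))) (trans (*-comm _ _) (sym (^-homo-* _ (suc p) um))) ⟩
      fromℕ L ^ (suc p ℕ.+ um)
        ≈⟨ trans (^-congʳ _ (≡.sym wn≡p+um)) (sym (^-assocʳ _ w (suc n))) ⟩
      (fromℕ L ^ w) ^ suc n ∎))
      where
      um = suc u ℕ.* suc m
      P = exponent m n m≤xn
      p = proj₁ P
      wn≡p+um = proj₁ (proj₂ P)
      Dn≤ap = proj₂ (proj₂ P)
      Dn = suc D ℕ.* suc n
      0≤Q = ^-nonNegative (<⇒≤ 0<q) Dn
      module rt = Root p 0≤Q
      -- This is q^(Dn/(p+1)). Its exponent is at most a, so z is among the values whose supremum is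
      -- `power q a`.
      z = root (suc p) (fromℕ q ^ Dn)
      0≤c^ = ^-nonNegative (<⇒≤ 0<c)
      c^n≤1 : ∀ n → c ^ n ≤ 1#
      c^n≤1 n = ≤-respʳ-≈ (1^n≈1 n) (^-monoˡ-≤ (<⇒≤ 0<c) c≤1 n)
      cz≤L : c * z ≤ fromℕ L
      -- The first index is the predecessor of `suc D ℕ.* suc n`, by computation.
      cz≤L = ≤-trans (*-monoˡ-≤ (<⇒≤ 0<c) (qa.y≤power (n ℕ.+ D ℕ.* suc n , p , Dn≤ap , rt.root^n≤x))) cqᵃ≤L

-- Finite sums

record IsEnumeration {A : Set} (xs : List A) : Set where
  field
    unique   : Unique xs
    complete : ∀ x → x ∈ xs

-- Stated over a commutative semiring to serve ℝ, ℂ and also ℕ, in which the parity argument for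
-- finite fields counts.
module Sum {c ℓ} (S : CommutativeSemiring c ℓ) where
  open CommutativeSemiring S
  open import Relation.Binary.Reasoning.Setoid setoid

  private variable
    A B C : Set
    P Q : Set

  sum : List A → (A → Carrier) → Carrier
  sum xs f = foldr (λ x → f x +_) 0# xs

  indicator : Dec P → Carrier
  indicator p = if does p then 1# else 0#

  indicator-yes : (p : Dec P) → P → indicator p ≈ 1#
  indicator-yes (yes _) _ = refl
  indicator-yes (no ¬p) p = contradiction p ¬p

  indicator-no : (p : Dec P) → ¬ P → indicator p ≈ 0#
  indicator-no (yes p) ¬p = contradiction p ¬p
  indicator-no (no _)  _  = refl

  indicator-cong : (p : Dec P) (q : Dec Q) → (P → Q) → (Q → P) → indicator p ≈ indicator q
  indicator-cong (yes p) q to from = sym (indicator-yes q (to p))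
  indicator-cong (no ¬p) q to from = sym (indicator-no q (¬p ∘ from))

  sum-cong : ∀ (xs : List A) {f g : A → Carrier} → (∀ x → f x ≈ g x) → sum xs f ≈ sum xs g
  sum-cong []       f≈g = refl
  sum-cong (x ∷ xs) f≈g = +-cong (f≈g x) (sum-cong xs f≈g)

  sum-zero : ∀ (xs : List A) → sum xs (λ _ → 0#) ≈ 0#
  sum-zero []       = refl
  sum-zero (x ∷ xs) = trans (+-identityˡ _) (sum-zero xs)

  sum-distrib-+ : ∀ (xs : List A) (f g : A → Carrier) →
    sum xs (λ x → f x + g x) ≈ sum xs f + sum xs g
  sum-distrib-+ []       f g = sym (+-identityˡ 0#)
  sum-distrib-+ (x ∷ xs) f g = begin
    (f x + g x) + sum xs (λ x → f x + g x)  ≈⟨ +-congˡ (sum-distrib-+ xs f g) ⟩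
    (f x + g x) + (sum xs f + sum xs g)     ≈⟨ +-assoc _ _ _ ⟩
    f x + (g x + (sum xs f + sum xs g))     ≈⟨ +-congˡ (+-assoc _ _ _) ⟨
    f x + ((g x + sum xs f) + sum xs g)     ≈⟨ +-congˡ (+-congʳ (+-comm _ _)) ⟩
    f x + ((sum xs f + g x) + sum xs g)     ≈⟨ +-congˡ (+-assoc _ _ _) ⟩
    f x + (sum xs f + (g x + sum xs g))     ≈⟨ +-assoc _ _ _ ⟨
    (f x + sum xs f) + (g x + sum xs g)     ∎

  *-distribˡ-sum : ∀ (xs : List A) a (f : A → Carrier) → a * sum xs f ≈ sum xs (λ x → a * f x)
  *-distribˡ-sum []       a f = zeroʳ a
  *-distribˡ-sum (x ∷ xs) a f = trans (distribˡ a _ _) (+-congˡ (*-distribˡ-sum xs a f))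

  *-distribʳ-sum : ∀ (xs : List A) a (f : A → Carrier) → sum xs f * a ≈ sum xs (λ x → f x * a)
  *-distribʳ-sum xs a f = trans (*-comm _ a)
    (trans (*-distribˡ-sum xs a f) (sum-cong xs λ _ → *-comm a _))

  sum-swap : ∀ (xs : List A) (ys : List B) (f : A → B → Carrier) →
    sum xs (λ x → sum ys (f x)) ≈ sum ys (λ y → sum xs (λ x → f x y))
  sum-swap []       ys f = sym (sum-zero ys)
  sum-swap (x ∷ xs) ys f = begin
    sum ys (f x) + sum xs (λ x → sum ys (f x))            ≈⟨ +-congˡ (sum-swap xs ys f) ⟩
    sum ys (f x) + sum ys (λ y → sum xs (λ x → f x y))    ≈⟨ sum-distrib-+ ys (f x) _ ⟨
    sum ys (λ y → f x y + sum xs (λ x → f x y))           ∎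

  sum*sum : ∀ (xs : List A) (ys : List B) (f : A → Carrier) (g : B → Carrier) →
    sum xs f * sum ys g ≈ sum xs (λ x → sum ys (λ y → f x * g y))
  sum*sum xs ys f g = trans (*-distribʳ-sum xs _ f) (sum-cong xs λ x → *-distribˡ-sum ys (f x) g)

  sum-++ : ∀ (xs ys : List A) (f : A → Carrier) → sum (xs ++ ys) f ≈ sum xs f + sum ys f
  sum-++ []       ys f = sym (+-identityˡ _)
  sum-++ (x ∷ xs) ys f = trans (+-congˡ (sum-++ xs ys f)) (sym (+-assoc _ _ _))

  sum-map : ∀ (g : A → B) (xs : List A) (f : B → Carrier) → sum (map g xs) f ≈ sum xs (f ∘ g)
  sum-map g []       f = refl
  sum-map g (x ∷ xs) f = +-congˡ (sum-map g xs f)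

  sum-cartesianProductWith : ∀ (g : A → B → C) (xs : List A) (ys : List B) (f : C → Carrier) →
    sum (cartesianProductWith g xs ys) f ≈ sum xs (λ x → sum ys (λ y → f (g x y)))
  sum-cartesianProductWith g []       ys f = refl
  sum-cartesianProductWith g (x ∷ xs) ys f = trans (sum-++ (map (g x) ys) _ f)
    (+-cong (sum-map (g x) ys f) (sum-cartesianProductWith g xs ys f))

  sum-filter : ∀ {P : Pred A _} (P? : Decidable P) (xs : List A) (f : A → Carrier) →
    sum (filter P? xs) f ≈ sum xs (λ x → indicator (P? x) * f x)
  sum-filter P? []       f = refl
  sum-filter P? (x ∷ xs) f with P? x
  ... | yes _ = +-cong (sym (*-identityˡ _)) (sum-filter P? xs f)
  ... | no  _ = trans (sum-filter P? xs f) (sym (trans (+-congʳ (zeroˡ _)) (+-identityˡ _)))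

  module _ (_≟_ : DecidableEquality A) where

    sift-∉ : ∀ {a} (xs : List A) → a ∉ xs → (f : A → Carrier) →
      sum xs (λ x → indicator (a ≟ x) * f x) ≈ 0#
    sift-∉ []       a∉xs f = refl
    sift-∉ (x ∷ xs) a∉xs f = trans
      (+-cong (trans (*-congʳ (indicator-no (_ ≟ x) λ a≡x → a∉xs (here a≡x))) (zeroˡ _))
              (sift-∉ xs (a∉xs ∘ there) f))
      (+-identityˡ 0#)

    sift-∈ : ∀ {a} {xs : List A} → Unique xs → a ∈ xs → (f : A → Carrier) →
      sum xs (λ x → indicator (a ≟ x) * f x) ≈ f a
    sift-∈ {a} {_ ∷ xs} (a∉xs ∷ _) (here ≡.refl) f = trans
      (+-cong (trans (*-congʳ (indicator-yes (a ≟ a) ≡.refl)) (*-identityˡ _))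
              (sift-∉ xs (λ a∈xs → All.lookup a∉xs a∈xs ≡.refl) f))
      (+-identityʳ _)
    sift-∈ {a} {x ∷ xs} (x∉xs ∷ xs!) (there a∈xs) f = trans
      (+-cong (trans (*-congʳ (indicator-no (a ≟ x) λ a≡x → All.lookup x∉xs a∈xs (≡.sym a≡x))) (zeroˡ _))
              (sift-∈ xs! a∈xs f))
      (+-identityˡ _)

    module _ {ys : List A} (enum : IsEnumeration ys) where
      open IsEnumeration enum

      sift : ∀ a (f : A → Carrier) → sum ys (λ y → indicator (a ≟ y) * f y) ≈ f a
      sift a = sift-∈ unique (complete a)

      sum-indicator : ∀ a → sum ys (λ y → indicator (a ≟ y)) ≈ 1#
      sum-indicator a = trans (sum-cong ys λ _ → sym (*-identityʳ _)) (sift a λ _ → 1#)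

      -- Groups the terms by the value of φ. When φ is the difference or the distance of a pair of
      -- points, the fibre counts are `r` and `ν`.
      sum-fibres : ∀ (xs : List B) (φ : B → A) (f : A → Carrier) →
        sum xs (f ∘ φ) ≈ sum ys (λ y → sum xs (λ x → indicator (φ x ≟ y)) * f y)
      sum-fibres xs φ f = begin
        sum xs (f ∘ φ)                                           ≈⟨ sum-cong xs (λ x → sift (φ x) f) ⟨
        sum xs (λ x → sum ys (λ y → indicator (φ x ≟ y) * f y))  ≈⟨ sum-swap xs ys _ ⟩
        sum ys (λ y → sum xs (λ x → indicator (φ x ≟ y) * f y))  ≈⟨ sum-cong ys (λ y → *-distribʳ-sum xs (f y) _) ⟨
        sum ys (λ y → sum xs (λ x → indicator (φ x ≟ y)) * f y)  ∎

      sum-weighted-fibres : ∀ (xs : List B) (φ : B → A) (c : B → Carrier) (f : A → Carrier) →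
        sum xs (λ x → c x * f (φ x)) ≈
        sum ys (λ y → sum xs (λ x → indicator (φ x ≟ y) * c x) * f y)
      sum-weighted-fibres xs φ c f = begin
        sum xs (λ x → c x * f (φ x))
          ≈⟨ sum-cong xs (λ x → trans (sym (sift (φ x) (λ y → c x * f y)))
                                      (sum-cong ys λ y → sym (*-assoc _ _ _))) ⟩
        sum xs (λ x → sum ys (λ y → indicator (φ x ≟ y) * c x * f y))
          ≈⟨ sum-swap xs ys _ ⟩
        sum ys (λ y → sum xs (λ x → indicator (φ x ≟ y) * c x * f y))
          ≈⟨ sum-cong ys (λ y → *-distribʳ-sum xs (f y) _) ⟨
        sum ys (λ y → sum xs (λ x → indicator (φ x ≟ y) * c x) * f y) ∎

      -- The fibre of a bijection over y is the single point ψ y.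
      sum-reindex : ∀ (φ ψ : A → A) → (∀ x → ψ (φ x) ≡ x) → (∀ x → φ (ψ x) ≡ x) →
        (f : A → Carrier) → sum ys (f ∘ φ) ≈ sum ys f
      sum-reindex φ ψ ψφ φψ f = begin
        sum ys (f ∘ φ)                                           ≈⟨ sum-fibres ys φ f ⟩
        sum ys (λ y → sum ys (λ x → indicator (φ x ≟ y)) * f y)  ≈⟨ sum-cong ys (λ y → *-congʳ (fibre y)) ⟩
        sum ys (λ y → 1# * f y)                                  ≈⟨ sum-cong ys (λ y → *-identityˡ (f y)) ⟩
        sum ys f                                                 ∎
        where
        fibre : ∀ y → sum ys (λ x → indicator (φ x ≟ y)) ≈ 1#
        fibre y = trans (sum-cong ys λ x → indicator-cong (φ x ≟ y) (ψ y ≟ x)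
                          (λ e → ≡.trans (≡.cong ψ (≡.sym e)) (ψφ x))
                          (λ e → ≡.trans (≡.cong φ (≡.sym e)) (φψ y)))
                        (sum-indicator (ψ y))

-- Finite fields

module FieldProperties {q : ℕ} (F : FiniteField q) where
  open FiniteField F
  open ≡

  commutativeRing : CommutativeRing _ _
  commutativeRing = record { isCommutativeRing = isCommutativeRing }

  open CommutativeRing commutativeRing public
    using (+-identityˡ; +-identityʳ; +-comm; *-comm; *-assoc; distribˡ; distribʳ; zeroˡ; zeroʳ; -‿inverseʳ; *-identityˡ; *-identityʳ)
  open IntegerRingSolver commutativeRing public using (solve; _:=_; _:+_; _:*_; _:-_; :-_; :0; :1)

  _≟ᵖ_ : ∀ {d} → DecidableEquality (Point d)
  _≟ᵖ_ = Vec.≡-dec _≟_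

  private
    to   = Inverse.to enumeration
    from = Inverse.from enumeration

    to∘from : ∀ x → to (from x) ≡ x
    to∘from x = Inverse.inverseˡ enumeration refl

    from∘to : ∀ i → from (to i) ≡ i
    from∘to i = Inverse.inverseʳ enumeration refl

  elements-isEnumeration : IsEnumeration elements
  elements-isEnumeration = record
    { unique   = Unique.map⁺ (λ {i} {j} eq → trans (sym (from∘to i)) (trans (cong from eq) (from∘to j)))
                   (Unique.allFin⁺ q)
    ; complete = λ x → subst (_∈ elements) (to∘from x) (∈-map⁺ to (∈-allFin (from x)))
    }

  length-elements : length elements ≡ q
  length-elements = trans (List.length-map to (allFin q)) (List.length-tabulate _)

  0<q : 0 ℕ.< q
  0<q = ℕ.≤-<-trans ℕ.z≤n (Fin.toℕ<n (from 0#))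

  points-isEnumeration : ∀ d → IsEnumeration (points d)
  points-isEnumeration zero    = record
    { unique = All.[] ∷ [] ; complete = λ { [] → here refl } }
  points-isEnumeration (suc d) = record
    { unique   = Unique.cartesianProductWith⁺ _∷_ (λ { refl → refl , refl })
                   (unique elements-isEnumeration) (unique (points-isEnumeration d))
    ; complete = λ { (a ∷ x) → ∈-cartesianProductWith⁺ _∷_
                   (complete elements-isEnumeration a) (complete (points-isEnumeration d) x) }
    }
    where open IsEnumeration

  x+y-y≡x : ∀ x y → (x + y) + - y ≡ x
  x+y-y≡x = solve 2 (λ x y → (x :+ y) :- y := x) refl

  x-y+y≡x : ∀ x y → (x + - y) + y ≡ x
  x-y+y≡x = solve 2 (λ x y → (x :- y) :+ y := x) refl

  ab-ac≡a[b-c] : ∀ a b c → a * b + - (a * c) ≡ a * (b + - c)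
  ab-ac≡a[b-c] = solve 3 (λ a b c → a :* b :- a :* c := a :* (b :- c)) refl

  x*y*z≡x : ∀ x {y z} → y * z ≡ 1# → (x * y) * z ≡ x
  x*y*z≡x x yz≡1 = trans (*-assoc x _ _) (trans (cong (x *_) yz≡1) (*-identityʳ x))

  -x≡0⇒x≡0 : ∀ {x} → - x ≡ 0# → x ≡ 0#
  -x≡0⇒x≡0 {x} -x≡0 = trans (sym (+-identityʳ x)) (trans (cong (x +_) (sym -x≡0)) (-‿inverseʳ x))

  -1≢0 : - 1# ≢ 0#
  -1≢0 -1≡0 = 1≢0 (-x≡0⇒x≡0 -1≡0)

  -1*x≡-x : ∀ x → - 1# * x ≡ - x
  -1*x≡-x = solve 1 (λ x → (:- :1) :* x := :- x) refl

  [1+1]*x≡x+x : ∀ x → (1# + 1#) * x ≡ x + x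
  [1+1]*x≡x+x = solve 1 (λ x → (:1 :+ :1) :* x := x :+ x) refl

  expand-distance : ∀ j s t p → j * (s + (t + - (p + p))) ≡ j * s + (j * t + - (j + j) * p)
  expand-distance = solve 4 (λ j s t p → j :* (s :+ (t :- (p :+ p))) := j :* s :+ (j :* t :+ (:- (j :+ j)) :* p)) refl

  +-cancelʳ : ∀ z {x y} → x + z ≡ y + z → x ≡ y
  +-cancelʳ z {x} {y} eq = trans (sym (x+y-y≡x x z)) (trans (cong (_+ - z) eq) (x+y-y≡x y z))

  x-y≡0⇒x≡y : ∀ {x y} → x + - y ≡ 0# → x ≡ y
  x-y≡0⇒x≡y {x} {y} eq = trans (lemma x y) (trans (cong (y +_) eq) (+-identityʳ y))
    where
    lemma : ∀ x y → x ≡ y + (x + - y)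
    lemma = solve 2 (λ x y → x := y :+ (x :- y)) refl

  x*y≡0⇒y≡0 : ∀ {x y} → x ≢ 0# → x * y ≡ 0# → y ≡ 0#
  x*y≡0⇒y≡0 {x} {y} x≢0 xy≡0 with inverse x x≢0
  ... | z , xz≡1 = begin
    y            ≡⟨ *-identityˡ y ⟨
    1# * y       ≡⟨ cong (_* y) xz≡1 ⟨
    x * z * y    ≡⟨ solve 3 (λ x z y → x :* z :* y := z :* (x :* y)) refl x z y ⟩
    z * (x * y)  ≡⟨ cong (z *_) xy≡0 ⟩
    z * 0#       ≡⟨ zeroʳ z ⟩
    0#           ∎
    where open ≡-Reasoning

  square-roots : ∀ {x y} → x * x ≡ y * y → x ≡ y ⊎ x ≡ - y
  square-roots {x} {y} x²≡y² with x ≟ y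
  ... | yes x≡y = inj₁ x≡y
  ... | no  x≢y = inj₂ (x-y≡0⇒x≡y (trans (lemma₂ x y)
    (x*y≡0⇒y≡0 (x≢y ∘ x-y≡0⇒x≡y) (trans (lemma₁ x y) (trans (cong (_+ - (y * y)) x²≡y²) (-‿inverseʳ _))))))
    where
    lemma₁ : ∀ x y → (x + - y) * (x + y) ≡ x * x + - (y * y)
    lemma₁ = solve 2 (λ x y → (x :- y) :* (x :+ y) := x :* x :- y :* y) refl
    lemma₂ : ∀ x y → x + - (- y) ≡ x + y
    lemma₂ = solve 2 (λ x y → x :- (:- y) := x :+ y) refl

  module _ (2∤q : ¬ (2 ∣ q)) where

    open Sum ℕ.+-*-commutativeSemiring
      using (sum; indicator; sum-cong; sum-reindex; sum-distrib-+; indicator-yes; indicator-no)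

    private
      index : Carrier → Fin q
      index = from

      index-injective : ∀ {x y} → index x ≡ index y → x ≡ y
      index-injective {x} {y} eq = trans (sym (to∘from x)) (trans (cong to eq) (to∘from y))

      sum-1 : ∀ {A : Set} (xs : List A) → sum xs (λ _ → 1) ≡ length xs
      sum-1 []       = refl
      sum-1 (x ∷ xs) = cong suc (sum-1 xs)

    -- Otherwise x ↦ x + 1 is an involution without fixed points, and half of
    -- the elements precede their image in the enumeration.
    1+1≢0 : 1# + 1# ≢ 0#
    1+1≢0 1+1≡0 = 2∤q (divides (sum elements below) (begin
      q                                                         ≡⟨ length-elements ⟨
      length elements                                           ≡⟨ sum-1 elements ⟨
      sum elements (λ _ → 1)                                    ≡⟨ sum-cong elements below+above ⟨
      sum elements (λ x → below x ℕ.+ above x)                  ≡⟨ sum-distrib-+ elements below above ⟩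
      sum elements below ℕ.+ sum elements above                 ≡⟨ cong (sum elements below ℕ.+_) above≡below ⟩
      sum elements below ℕ.+ sum elements below                 ≡⟨ cong (sum elements below ℕ.+_) (ℕ.+-identityʳ _) ⟨
      2 ℕ.* sum elements below                                  ≡⟨ ℕ.*-comm 2 (sum elements below) ⟩
      sum elements below ℕ.* 2                                  ∎))
      where
      open ≡-Reasoning
      below above : Carrier → ℕ
      below x = indicator (index x Fin.<? index (x + 1#))
      above x = indicator (index (x + 1#) Fin.<? index x)

      x+1+1≡x : ∀ x → (x + 1#) + 1# ≡ x
      x+1+1≡x x = begin
        (x + 1#) + 1#  ≡⟨ solve 2 (λ x o → (x :+ o) :+ o := x :+ (o :+ o)) refl x 1# ⟩
        x + (1# + 1#)  ≡⟨ cong (x +_) 1+1≡0 ⟩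
        x + 0#         ≡⟨ +-identityʳ x ⟩
        x              ∎

      x≢x+1 : ∀ x → x ≢ x + 1#
      x≢x+1 x x≡x+1 = 1≢0 (begin
        1#              ≡⟨ solve 2 (λ x o → o := (x :+ o) :- x) refl x 1# ⟩
        (x + 1#) + - x  ≡⟨ cong (_+ - x) x≡x+1 ⟨
        x + - x         ≡⟨ -‿inverseʳ x ⟩
        0#              ∎)

      below+above : ∀ x → below x ℕ.+ above x ≡ 1
      below+above x with Fin.<-cmp (index x) (index (x + 1#))
      ... | tri< i<j _ j≮i = cong₂ ℕ._+_ (indicator-yes (_ Fin.<? _) i<j) (indicator-no (_ Fin.<? _) j≮i)
      ... | tri≈ _ i≡j _   = contradiction (index-injective i≡j) (x≢x+1 x)
      ... | tri> i≮j _ j<i = cong₂ ℕ._+_ (indicator-no (_ Fin.<? _) i≮j) (indicator-yes (_ Fin.<? _) j<i)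

      above≡below : sum elements above ≡ sum elements below
      above≡below = begin
        sum elements above
          ≡⟨ sum-cong elements (λ x → cong (λ y → indicator (index (x + 1#) Fin.<? index y)) (x+1+1≡x x)) ⟨
        sum elements (below ∘ (_+ 1#))
          ≡⟨ sum-reindex _≟_ elements-isEnumeration (_+ 1#) (_+ 1#) x+1+1≡x x+1+1≡x below ⟩
        sum elements below ∎

  ∙-comm : ∀ {d} (x y : Point d) → x ∙ y ≡ y ∙ x
  ∙-comm []      []      = refl
  ∙-comm (a ∷ x) (b ∷ y) = cong₂ _+_ (*-comm a b) (∙-comm x y)

  ∙-∸ᵛ : ∀ {d} (v x y : Point d) → v ∙ (x ∸ᵛ y) ≡ v ∙ x + - (v ∙ y)
  ∙-∸ᵛ []      []      []      = sym (-‿inverseʳ 0#)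
  ∙-∸ᵛ (c ∷ v) (a ∷ x) (b ∷ y) = trans (cong (c * (a + - b) +_) (∙-∸ᵛ v x y))
    (solve 5 (λ c a b s t → c :* (a :- b) :+ (s :- t) := (c :* a :+ s) :- (c :* b :+ t)) refl
      c a b (v ∙ x) (v ∙ y))

  ‖∸ᵛ‖ : ∀ {d} (x y : Point d) → ‖ x ∸ᵛ y ‖ ≡ ‖ x ‖ + (‖ y ‖ + - (x ∙ y + x ∙ y))
  ‖∸ᵛ‖ []      []      = solve 0 (:0 := :0 :+ (:0 :- (:0 :+ :0))) refl
  ‖∸ᵛ‖ (a ∷ x) (b ∷ y) = trans (cong ((a + - b) * (a + - b) +_) (‖∸ᵛ‖ x y))
    (solve 5 (λ a b s t p → (a :- b) :* (a :- b) :+ (s :+ (t :- (p :+ p)))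
                := (a :* a :+ s) :+ ((b :* b :+ t) :- ((a :* b :+ p) :+ (a :* b :+ p)))) refl
      a b ‖ x ‖ ‖ y ‖ (x ∙ y))

  x∸ᵛy≡0⇒x≡y : ∀ {d} {x y : Point d} → x ∸ᵛ y ≡ origin → x ≡ y
  x∸ᵛy≡0⇒x≡y {x = []}    {[]}    _  = refl
  x∸ᵛy≡0⇒x≡y {x = a ∷ x} {b ∷ y} eq = cong₂ _∷_
    (x-y≡0⇒x≡y (cong Vec.head eq)) (x∸ᵛy≡0⇒x≡y (cong Vec.tail eq))

  x∸ᵛx≡0 : ∀ {d} (x : Point d) → x ∸ᵛ x ≡ origin
  x∸ᵛx≡0 []      = refl
  x∸ᵛx≡0 (a ∷ x) = cong₂ _∷_ (-‿inverseʳ a) (x∸ᵛx≡0 x)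

  origin∙ : ∀ {d} (x : Point d) → origin ∙ x ≡ 0#
  origin∙ []      = refl
  origin∙ (a ∷ x) = trans (cong₂ _+_ (zeroˡ a) (origin∙ x)) (+-identityʳ 0#)

-- Sums of real and complex numbers

module RealSums (R : CompleteOrderedField) where
  open OrderedField R
  open Sum commutativeSemiring public
  open ≤-Reasoning

  private variable
    A B : Set
    P : Set

  sum-mono-≤ : ∀ (xs : List A) {f g : A → ℝ} → (∀ x → f x ≤ g x) → sum xs f ≤ sum xs g
  sum-mono-≤ []       f≤g = ≤-refl
  sum-mono-≤ (x ∷ xs) f≤g = +-mono-≤ (f≤g x) (sum-mono-≤ xs f≤g)

  sum-mono-∈ : ∀ (xs : List A) {f g : A → ℝ} → (∀ x → x ∈ xs → f x ≤ g x) → sum xs f ≤ sum xs g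
  sum-mono-∈ []       f≤g = ≤-refl
  sum-mono-∈ (x ∷ xs) f≤g = +-mono-≤ (f≤g x (here ≡.refl)) (sum-mono-∈ xs λ y y∈xs → f≤g y (there y∈xs))

  sum-nonNegative : ∀ (xs : List A) {f : A → ℝ} → (∀ x → 0# ≤ f x) → 0# ≤ sum xs f
  sum-nonNegative []       0≤f = ≤-refl
  sum-nonNegative (x ∷ xs) 0≤f = +-nonNegative (0≤f x) (sum-nonNegative xs 0≤f)

  sum-const : ∀ (xs : List A) c → sum xs (λ _ → c) ≈ fromℕ (length xs) * c
  sum-const []       c = sym (zeroˡ c)
  sum-const (x ∷ xs) c = begin-equality
    c + sum xs (λ _ → c)            ≈⟨ +-cong (sym (*-identityˡ c)) (sum-const xs c) ⟩
    1# * c + fromℕ (length xs) * c  ≈⟨ distribʳ c 1# _ ⟨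
    (1# + fromℕ (length xs)) * c    ∎

  indicator-nonNegative : (p : Dec P) → 0# ≤ indicator p
  indicator-nonNegative (yes _) = 0≤1
  indicator-nonNegative (no _)  = ≤-refl

  -- In this root-free form only u² ≤ f g is asked termwise, so the same lemma covers weighted sums
  -- and real parts of complex terms. Induction reduces it to two summands.
  cauchy-schwarz : ∀ (xs : List A) {u f g : A → ℝ} → (∀ x → 0# ≤ f x) → (∀ x → 0# ≤ g x) →
    (∀ x → u x * u x ≤ f x * g x) → sum xs u * sum xs u ≤ sum xs f * sum xs g
  cauchy-schwarz []       0≤f 0≤g u²≤fg = ≤-refl
  cauchy-schwarz (x ∷ xs) {u} {f} {g} 0≤f 0≤g u²≤fg = step (u x) (f x) (g x) (sum xs u) (sum xs f) (sum xs g)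
    (0≤f x) (0≤g x) (sum-nonNegative xs 0≤f) (sum-nonNegative xs 0≤g)
    (u²≤fg x) (cauchy-schwarz xs 0≤f 0≤g u²≤fg)
    where
    -- The cross term satisfies (2uU)² ≤ 4fgFG ≤ (fG + gF)².
    step : ∀ u f g U F G → 0# ≤ f → 0# ≤ g → 0# ≤ F → 0# ≤ G → u * u ≤ f * g → U * U ≤ F * G →
      (u + U) * (u + U) ≤ (f + F) * (g + G)
    step u f g U F G 0≤f 0≤g 0≤F 0≤G u²≤fg U²≤FG = begin
      (u + U) * (u + U)
        ≈⟨ solve 2 (λ u U → (u :+ U) :* (u :+ U) := u :* u :+ (u :* U :+ u :* U) :+ U :* U) refl u U ⟩
      u * u + (u * U + u * U) + U * U
        ≤⟨ +-mono-≤ (+-mono-≤ u²≤fg (square-cancel-≤ (+-nonNegative (*-nonNegative 0≤f 0≤G) (*-nonNegative 0≤g 0≤F)) cross)) U²≤FG ⟩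
      f * g + (f * G + g * F) + F * G
        ≈⟨ solve 4 (λ f g F G → f :* g :+ (f :* G :+ g :* F) :+ F :* G := (f :+ F) :* (g :+ G)) refl f g F G ⟩
      (f + F) * (g + G) ∎
      where
      cross : (u * U + u * U) * (u * U + u * U) ≤ (f * G + g * F) * (f * G + g * F)
      cross = begin
        (u * U + u * U) * (u * U + u * U)
          ≈⟨ solve 2 (λ u U → (u :* U :+ u :* U) :* (u :* U :+ u :* U)
               := (u :* u) :* (U :* U) :+ (u :* u) :* (U :* U) :+ (u :* u) :* (U :* U) :+ (u :* u) :* (U :* U)) refl u U ⟩
        (u * u) * (U * U) + (u * u) * (U * U) + (u * u) * (U * U) + (u * u) * (U * U)
          ≤⟨ +-mono-≤ (+-mono-≤ (+-mono-≤ prod prod) prod) prod ⟩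
        (f * g) * (F * G) + (f * g) * (F * G) + (f * g) * (F * G) + (f * g) * (F * G)
          ≤⟨ x≤x+y (0≤x*x (f * G - g * F)) ⟩
        (f * g) * (F * G) + (f * g) * (F * G) + (f * g) * (F * G) + (f * g) * (F * G)
          + (f * G - g * F) * (f * G - g * F)
          ≈⟨ solve 4 (λ f g F G → (f :* g) :* (F :* G) :+ (f :* g) :* (F :* G) :+ (f :* g) :* (F :* G)
                 :+ (f :* g) :* (F :* G) :+ (f :* G :- g :* F) :* (f :* G :- g :* F)
               := (f :* G :+ g :* F) :* (f :* G :+ g :* F)) refl f g F G ⟩
        (f * G + g * F) * (f * G + g * F) ∎
        where
        prod : (u * u) * (U * U) ≤ (f * g) * (F * G)
        prod = *-mono-≤ (0≤x*x u) (0≤x*x U) u²≤fg U²≤FG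

  module _ (_≟_ : DecidableEquality A) {ys : List A} (enum : IsEnumeration ys) where
    open Membership _≟_ using (_∈?_)

    -- A list without repetitions meets every element at most once, so the fibres of its inclusion
    -- have multiplicity at most 1.
    sum-≤-enumeration : ∀ {xs : List A} → Unique xs → {f : A → ℝ} → (∀ x → 0# ≤ f x) →
      sum xs f ≤ sum ys f
    sum-≤-enumeration {xs} xs! {f} 0≤f = begin
      sum xs f                                            ≈⟨ sum-fibres _≟_ enum xs (λ x → x) f ⟩
      sum ys (λ y → sum xs (λ x → indicator (x ≟ y)) * f y) ≤⟨ sum-mono-≤ ys (λ y → *-monoʳ-≤ (0≤f y) (multiplicity≤1 y)) ⟩
      sum ys (λ y → 1# * f y)                             ≈⟨ sum-cong ys (λ y → *-identityˡ (f y)) ⟩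
      sum ys f                                            ∎
      where
      multiplicity : ∀ y → sum xs (λ x → indicator (x ≟ y)) ≈ sum xs (λ x → indicator (y ≟ x) * 1#)
      multiplicity y = sum-cong xs λ x →
        trans (indicator-cong (x ≟ y) (y ≟ x) ≡.sym ≡.sym) (sym (*-identityʳ _))
      multiplicity≤1 : ∀ y → sum xs (λ x → indicator (x ≟ y)) ≤ 1#
      multiplicity≤1 y = ≤-respˡ-≈ (sym (multiplicity y)) (bound (y ∈? xs))
        where
        bound : Dec (y ∈ xs) → sum xs (λ x → indicator (y ≟ x) * 1#) ≤ 1#
        bound (yes y∈xs) = ≤-reflexive (sift-∈ _≟_ xs! y∈xs (λ _ → 1#))
        bound (no  y∉xs) = ≤-trans (≤-reflexive (sift-∉ _≟_ xs y∉xs (λ _ → 1#))) 0≤1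

-- Complex numbers, squared moduli and Parseval's identity

module Complex (R : CompleteOrderedField) where
  open OrderedField R
  open RealSums R

  infix 8 -ᶜ_
  -ᶜ_ : ℂ → ℂ
  -ᶜ z = (- re z) +i (- im z)

  conj : ℂ → ℂ
  conj z = re z +i (- im z)

  -- The squared modulus, polynomial in the real and imaginary parts. The modulus itself, a root, is
  -- met only in the Salem condition.
  norm : ℂ → ℝ
  norm z = re z * re z + im z * im z

  ℂ-isCommutativeRing : IsCommutativeRing _≈ᶜ_ _+ᶜ_ _*ᶜ_ -ᶜ_ 0ᶜ 1ᶜ
  ℂ-isCommutativeRing = record
    { isRing = record
      { +-isAbelianGroup = record
        { isGroup = record
          { isMonoid = record
            { isSemigroup = record
              { isMagma = record
                { isEquivalence = record
                  { refl  = refl , refl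
                  ; sym   = λ (p , q) → sym p , sym q
                  ; trans = λ (p , q) (p′ , q′) → trans p p′ , trans q q′
                  }
                ; ∙-cong = λ (p , q) (p′ , q′) → +-cong p p′ , +-cong q q′
                }
              ; assoc = λ _ _ _ → +-assoc _ _ _ , +-assoc _ _ _
              }
            ; identity = (λ _ → +-identityˡ _ , +-identityˡ _) , (λ _ → +-identityʳ _ , +-identityʳ _)
            }
          ; inverse = (λ _ → -‿inverseˡ _ , -‿inverseˡ _) , (λ _ → -‿inverseʳ _ , -‿inverseʳ _)
          ; ⁻¹-cong = λ (p , q) → -‿cong p , -‿cong q
          }
        ; comm = λ _ _ → +-comm _ _ , +-comm _ _
        }
      ; *-cong = λ (p , q) (p′ , q′) →
          +-cong (*-cong p p′) (-‿cong (*-cong q q′)) , +-cong (*-cong p q′) (*-cong q p′)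
      ; *-assoc = λ (a +i b) (c +i d) (e +i f) →
          solve 6 (λ a b c d e f → (a :* c :- b :* d) :* e :- (a :* d :+ b :* c) :* f
            := a :* (c :* e :- d :* f) :- b :* (c :* f :+ d :* e)) refl a b c d e f ,
          solve 6 (λ a b c d e f → (a :* c :- b :* d) :* f :+ (a :* d :+ b :* c) :* e
            := a :* (c :* f :+ d :* e) :+ b :* (c :* e :- d :* f)) refl a b c d e f
      ; *-identity =
          (λ (a +i b) → solve 2 (λ a b → :1 :* a :- :0 :* b := a) refl a b ,
                        solve 2 (λ a b → :1 :* b :+ :0 :* a := b) refl a b) ,
          (λ (a +i b) → solve 2 (λ a b → a :* :1 :- b :* :0 := a) refl a b ,
                        solve 2 (λ a b → a :* :0 :+ b :* :1 := b) refl a b)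
      ; distrib =
          (λ (a +i b) (c +i d) (e +i f) →
            solve 6 (λ a b c d e f → a :* (c :+ e) :- b :* (d :+ f)
              := (a :* c :- b :* d) :+ (a :* e :- b :* f)) refl a b c d e f ,
            solve 6 (λ a b c d e f → a :* (d :+ f) :+ b :* (c :+ e)
              := (a :* d :+ b :* c) :+ (a :* f :+ b :* e)) refl a b c d e f) ,
          (λ (a +i b) (c +i d) (e +i f) →
            solve 6 (λ a b c d e f → (c :+ e) :* a :- (d :+ f) :* b
              := (c :* a :- d :* b) :+ (e :* a :- f :* b)) refl a b c d e f ,
            solve 6 (λ a b c d e f → (c :+ e) :* b :+ (d :+ f) :* a
              := (c :* b :+ d :* a) :+ (e :* b :+ f :* a)) refl a b c d e f)
      }
    ; *-comm = λ (a +i b) (c +i d) →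
        solve 4 (λ a b c d → a :* c :- b :* d := c :* a :- d :* b) refl a b c d ,
        solve 4 (λ a b c d → a :* d :+ b :* c := c :* b :+ d :* a) refl a b c d
    }

  ℂ-commutativeRing : CommutativeRing _ _
  ℂ-commutativeRing = record { isCommutativeRing = ℂ-isCommutativeRing }

  module ℂ-ring = CommutativeRing ℂ-commutativeRing
  module ℂ-sum = Sum ℂ-ring.commutativeSemiring

  norm-cong : ∀ {z w} → z ≈ᶜ w → norm z ≈ norm w
  norm-cong (p , q) = +-cong (*-cong p p) (*-cong q q)

  norm-nonNegative : ∀ z → 0# ≤ norm z
  norm-nonNegative z = +-nonNegative (0≤x*x (re z)) (0≤x*x (im z))

  norm-* : ∀ z w → norm (z *ᶜ w) ≈ norm z * norm w
  norm-* (a +i b) (c +i d) = solve 4 (λ a b c d →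
      (a :* c :- b :* d) :* (a :* c :- b :* d) :+ (a :* d :+ b :* c) :* (a :* d :+ b :* c)
      := (a :* a :+ b :* b) :* (c :* c :+ d :* d)) refl a b c d

  norm-ofReal : ∀ x → norm (ofReal x) ≈ x * x
  norm-ofReal = solve 1 (λ x → x :* x :+ :0 :* :0 := x :* x) refl

  norm-conj : ∀ z → norm (conj z) ≈ norm z
  norm-conj (a +i b) = solve 2 (λ a b → a :* a :+ (:- b) :* (:- b) := a :* a :+ b :* b) refl a b

  z*conj-z : ∀ z → z *ᶜ conj z ≈ᶜ ofReal (norm z)
  z*conj-z (a +i b) =
    solve 2 (λ a b → a :* a :- b :* (:- b) := a :* a :+ b :* b) refl a b ,
    solve 2 (λ a b → a :* (:- b) :+ b :* a := :0) refl a b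

  conj-* : ∀ z w → conj (z *ᶜ w) ≈ᶜ conj z *ᶜ conj w
  conj-* (a +i b) (c +i d) =
    solve 4 (λ a b c d → a :* c :- b :* d := a :* c :- (:- b) :* (:- d)) refl a b c d ,
    solve 4 (λ a b c d → :- (a :* d :+ b :* c) := a :* (:- d) :+ (:- b) :* c) refl a b c d

  ofReal-cong : ∀ {x y} → x ≈ y → ofReal x ≈ᶜ ofReal y
  ofReal-cong p = p , refl

  ofReal-* : ∀ x y → ofReal (x * y) ≈ᶜ ofReal x *ᶜ ofReal y
  ofReal-* x y = solve 2 (λ x y → x :* y := x :* y :- :0 :* :0) refl x y ,
    solve 2 (λ x y → :0 := x :* :0 :+ :0 :* y) refl x y

  re[z]²≤norm : ∀ z → re z * re z ≤ norm z
  re[z]²≤norm z = x≤x+y (0≤x*x (im z))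

  private variable
    A B : Set
    P : Set

  re-sum : ∀ (xs : List A) (f : A → ℂ) → re (ℂ-sum.sum xs f) ≡ sum xs (λ x → re (f x))
  re-sum []       f = ≡.refl
  re-sum (x ∷ xs) f = ≡.cong (re (f x) +_) (re-sum xs f)

  im-sum : ∀ (xs : List A) (f : A → ℂ) → im (ℂ-sum.sum xs f) ≡ sum xs (λ x → im (f x))
  im-sum []       f = ≡.refl
  im-sum (x ∷ xs) f = ≡.cong (im (f x) +_) (im-sum xs f)

  conj-sum : ∀ (xs : List A) (f : A → ℂ) → conj (ℂ-sum.sum xs f) ≈ᶜ ℂ-sum.sum xs (λ x → conj (f x))
  conj-sum []       f = refl , -0#≈0#
  conj-sum (x ∷ xs) f = ℂ-ring.trans
    (refl , solve 2 (λ a b → :- (a :+ b) := (:- a) :+ (:- b)) refl _ _)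
    (ℂ-ring.+-congˡ (conj-sum xs f))

  ofReal-sum : ∀ (xs : List A) (f : A → ℝ) → ofReal (sum xs f) ≈ᶜ ℂ-sum.sum xs (λ x → ofReal (f x))
  ofReal-sum []       f = ℂ-ring.refl
  ofReal-sum (x ∷ xs) f = ℂ-ring.trans (refl , sym (+-identityˡ 0#)) (ℂ-ring.+-congˡ (ofReal-sum xs f))

  ofReal-indicator : (p : Dec P) → ofReal (indicator p) ≡ ℂ-sum.indicator p
  ofReal-indicator (yes _) = ≡.refl
  ofReal-indicator (no _)  = ≡.refl

  -- Cauchy-Schwarz with weights f, applied to the real and to the imaginary parts and added up.
  norm-weighted-sum : ∀ (xs : List A) {f : A → ℝ} (z : A → ℂ) → (∀ x → 0# ≤ f x) →
    norm (ℂ-sum.sum xs (λ x → ofReal (f x) *ᶜ z x)) ≤ sum xs f * sum xs (λ x → f x * norm (z x))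
  norm-weighted-sum xs {f} z 0≤f = begin
    norm (ℂ-sum.sum xs w)
      ≡⟨ ≡.cong₂ (λ a b → a * a + b * b) (re-sum xs w) (im-sum xs w) ⟩
    sum xs (λ x → re (w x)) * sum xs (λ x → re (w x)) + sum xs (λ x → im (w x)) * sum xs (λ x → im (w x))
      ≤⟨ +-mono-≤
           (cauchy-schwarz xs 0≤f (λ x → *-nonNegative (0≤f x) (0≤x*x (re (z x))))
             λ x → ≤-reflexive (re² (f x) (re (z x)) (im (z x))))
           (cauchy-schwarz xs 0≤f (λ x → *-nonNegative (0≤f x) (0≤x*x (im (z x))))
             λ x → ≤-reflexive (im² (f x) (re (z x)) (im (z x)))) ⟩
    sum xs f * sum xs (λ x → f x * (re (z x) * re (z x))) + sum xs f * sum xs (λ x → f x * (im (z x) * im (z x)))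
      ≈⟨ distribˡ _ _ _ ⟨
    sum xs f * (sum xs (λ x → f x * (re (z x) * re (z x))) + sum xs (λ x → f x * (im (z x) * im (z x))))
      ≈⟨ *-congˡ (sum-distrib-+ xs _ _) ⟨
    sum xs f * sum xs (λ x → f x * (re (z x) * re (z x)) + f x * (im (z x) * im (z x)))
      ≈⟨ *-congˡ (sum-cong xs λ x → distribˡ (f x) _ _) ⟨
    sum xs f * sum xs (λ x → f x * norm (z x)) ∎
    where
    open ≤-Reasoning
    w : _ → ℂ
    w x = ofReal (f x) *ᶜ z x
    re² : ∀ f a b → (f * a - 0# * b) * (f * a - 0# * b) ≈ f * (f * (a * a))
    re² = solve 3 (λ f a b → (f :* a :- :0 :* b) :* (f :* a :- :0 :* b) := f :* (f :* (a :* a))) refl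
    im² : ∀ f a b → (f * b + 0# * a) * (f * b + 0# * a) ≈ f * (f * (b * b))
    im² = solve 3 (λ f a b → (f :* b :+ :0 :* a) :* (f :* b :+ :0 :* a) := f :* (f :* (b :* b))) refl

  interchange : ∀ v w v′ w′ → (v *ᶜ w) *ᶜ (v′ *ᶜ w′) ≈ᶜ (v *ᶜ v′) *ᶜ (w *ᶜ w′)
  interchange = ℂ-solve 4 (λ a b c d → (a ⊗ b) ⊗ (c ⊗ d) ⊜ (a ⊗ c) ⊗ (b ⊗ d)) ℂ-ring.refl
    where open IntegerRingSolver ℂ-commutativeRing renaming (solve to ℂ-solve; _:*_ to _⊗_; _:=_ to _⊜_)

  norm≈0⇒≈0 : ∀ z → norm z ≈ 0# → z ≈ᶜ 0ᶜ
  norm≈0⇒≈0 (a +i b) eq = zero-of a b eq , zero-of b a (trans (+-comm _ _) eq)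
    where
    open ≤-Reasoning
    zero-of : ∀ a b → a * a + b * b ≈ 0# → a ≈ 0#
    zero-of a b eq = antisym (square-cancel-≤ ≤-refl (≤-trans a²≤0 0≤0²))
      (≤-respʳ-≈ (-‿involutive a) (≤-respˡ-≈ -0#≈0# (neg-antitone-≤ (square-cancel-≤ ≤-refl (begin
        - a * - a  ≈⟨ solve 1 (λ a → (:- a) :* (:- a) := a :* a) refl a ⟩
        a * a      ≤⟨ a²≤0 ⟩
        0#         ≤⟨ 0≤0² ⟩
        0# * 0#    ∎)))))
      where
      0≤0² : 0# ≤ 0# * 0#
      0≤0² = ≤-reflexive (sym (zeroˡ 0#))
      a²≤0 : a * a ≤ 0#
      a²≤0 = ≤-trans (x≤x+y (0≤x*x b)) (≤-reflexive eq)

  xy≈0⇒y≈0 : ∀ {x y} → x * y ≈ 0# → ¬ (x ≈ 0#) → y ≈ 0#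
  xy≈0⇒y≈0 {x} {y} xy≈0 x≉0 = begin-equality
    y               ≈⟨ *-identityˡ y ⟨
    1# * y          ≈⟨ *-congʳ (⁻¹-inverseˡ x x≉0) ⟨
    x ⁻¹ * x * y    ≈⟨ *-assoc _ _ _ ⟩
    x ⁻¹ * (x * y)  ≈⟨ *-congˡ xy≈0 ⟩
    x ⁻¹ * 0#       ≈⟨ zeroʳ _ ⟩
    0#              ∎
    where open ≤-Reasoning

  -- Here (z - 1) w = 0, and since the norm is multiplicative the question passes to a product of
  -- reals. This is how translation invariance annihilates character sums.
  z*w≈w⇒w≈0 : ∀ {z w} → ¬ (z ≈ᶜ 1ᶜ) → z *ᶜ w ≈ᶜ w → w ≈ᶜ 0ᶜ
  z*w≈w⇒w≈0 {z} {w} z≉1 zw≈w = norm≈0⇒≈0 w (xy≈0⇒y≈0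
    (trans (sym (norm-* (z +ᶜ -ᶜ 1ᶜ) w)) (trans (norm-cong [z-1]w≈0) (trans (norm-ofReal 0#) (zeroˡ 0#))))
    λ norm≈0 → z≉1 (z≈1 (norm≈0⇒≈0 (z +ᶜ -ᶜ 1ᶜ) norm≈0)))
    where
    open import Algebra.Properties.Ring (ℂ-ring.ring) using (x∙y⁻¹≈ε⇒x≈y; [y-z]x≈yx-zx)
    z≈1 : z +ᶜ -ᶜ 1ᶜ ≈ᶜ 0ᶜ → z ≈ᶜ 1ᶜ
    z≈1 = x∙y⁻¹≈ε⇒x≈y z 1ᶜ
    [z-1]w≈0 : (z +ᶜ -ᶜ 1ᶜ) *ᶜ w ≈ᶜ 0ᶜ
    [z-1]w≈0 = ℂ-ring.trans ([y-z]x≈yx-zx w z 1ᶜ) (ℂ-ring.trans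
      (ℂ-ring.+-cong zw≈w (ℂ-ring.-‿cong (ℂ-ring.*-identityˡ w))) (ℂ-ring.-‿inverseʳ w))

  module _ (I : List A) {V : List B} (_≟_ : DecidableEquality B) (enum : IsEnumeration V)
    (k : A → B → ℂ) (M : ℝ)
    (orthogonal : ∀ v w → ℂ-sum.sum I (λ i → k i v *ᶜ conj (k i w)) ≈ᶜ ofReal M *ᶜ ℂ-sum.indicator (v ≟ w))
    where
    open import Relation.Binary.Reasoning.Setoid ℂ-ring.setoid

    -- Expanding the squared modulus and summing over i first leaves only the diagonal v = w. The
    -- kernel χ(v∙w) on points yields the energy, the kernel χ(jt) on the field the second moment of
    -- the distance counts.
    parseval : ∀ (g : B → ℂ) →
      sum I (λ i → norm (ℂ-sum.sum V (λ v → g v *ᶜ k i v))) ≈ M * sum V (λ v → norm (g v))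
    parseval g = proj₁ (begin
      ofReal (sum I (λ i → norm (ĝ i)))
        ≈⟨ ofReal-sum I _ ⟩
      ℂ-sum.sum I (λ i → ofReal (norm (ĝ i)))
        ≈⟨ ℂ-sum.sum-cong I expand ⟩
      ℂ-sum.sum I (λ i → ℂ-sum.sum V (λ v → ℂ-sum.sum V (λ w → c v w *ᶜ (k i v *ᶜ conj (k i w)))))
        ≈⟨ ℂ-sum.sum-swap I V _ ⟩
      ℂ-sum.sum V (λ v → ℂ-sum.sum I (λ i → ℂ-sum.sum V (λ w → c v w *ᶜ (k i v *ᶜ conj (k i w)))))
        ≈⟨ ℂ-sum.sum-cong V (λ v → ℂ-sum.sum-swap I V _) ⟩
      ℂ-sum.sum V (λ v → ℂ-sum.sum V (λ w → ℂ-sum.sum I (λ i → c v w *ᶜ (k i v *ᶜ conj (k i w)))))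
        ≈⟨ ℂ-sum.sum-cong V (λ v → ℂ-sum.sum-cong V λ w → collapse v w) ⟩
      ℂ-sum.sum V (λ v → ℂ-sum.sum V (λ w → ℂ-sum.indicator (v ≟ w) *ᶜ (ofReal M *ᶜ c v w)))
        ≈⟨ ℂ-sum.sum-cong V (λ v → ℂ-sum.sift _≟_ enum v _) ⟩
      ℂ-sum.sum V (λ v → ofReal M *ᶜ c v v)
        ≈⟨ ℂ-sum.*-distribˡ-sum V (ofReal M) _ ⟨
      ofReal M *ᶜ ℂ-sum.sum V (λ v → c v v)
        ≈⟨ ℂ-ring.*-congˡ (ℂ-sum.sum-cong V λ v → z*conj-z (g v)) ⟩
      ofReal M *ᶜ ℂ-sum.sum V (λ v → ofReal (norm (g v)))
        ≈⟨ ℂ-ring.*-congˡ (ofReal-sum V _) ⟨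
      ofReal M *ᶜ ofReal (sum V (λ v → norm (g v)))
        ≈⟨ ofReal-* M _ ⟨
      ofReal (M * sum V (λ v → norm (g v))) ∎)
      where
      ĝ : A → ℂ
      ĝ i = ℂ-sum.sum V (λ v → g v *ᶜ k i v)
      c : B → B → ℂ
      c v w = g v *ᶜ conj (g w)
      expand : ∀ i → ofReal (norm (ĝ i)) ≈ᶜ
        ℂ-sum.sum V (λ v → ℂ-sum.sum V (λ w → c v w *ᶜ (k i v *ᶜ conj (k i w))))
      expand i = begin
        ofReal (norm (ĝ i))
          ≈⟨ z*conj-z (ĝ i) ⟨
        ĝ i *ᶜ conj (ĝ i)
          ≈⟨ ℂ-ring.*-congˡ (conj-sum V _) ⟩
        ĝ i *ᶜ ℂ-sum.sum V (λ w → conj (g w *ᶜ k i w))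
          ≈⟨ ℂ-sum.sum*sum V V _ _ ⟩
        ℂ-sum.sum V (λ v → ℂ-sum.sum V (λ w → (g v *ᶜ k i v) *ᶜ conj (g w *ᶜ k i w)))
          ≈⟨ ℂ-sum.sum-cong V (λ v → ℂ-sum.sum-cong V λ w →
               ℂ-ring.trans (ℂ-ring.*-congˡ (conj-* _ _)) (interchange _ _ _ _)) ⟩
        ℂ-sum.sum V (λ v → ℂ-sum.sum V (λ w → c v w *ᶜ (k i v *ᶜ conj (k i w)))) ∎
      collapse : ∀ v w → ℂ-sum.sum I (λ i → c v w *ᶜ (k i v *ᶜ conj (k i w))) ≈ᶜ
        ℂ-sum.indicator (v ≟ w) *ᶜ (ofReal M *ᶜ c v w)
      collapse v w = begin
        ℂ-sum.sum I (λ i → c v w *ᶜ (k i v *ᶜ conj (k i w)))    ≈⟨ ℂ-sum.*-distribˡ-sum I (c v w) _ ⟨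
        c v w *ᶜ ℂ-sum.sum I (λ i → k i v *ᶜ conj (k i w))      ≈⟨ ℂ-ring.*-congˡ (orthogonal v w) ⟩
        c v w *ᶜ (ofReal M *ᶜ ℂ-sum.indicator (v ≟ w))          ≈⟨ ℂ-ring.*-comm _ _ ⟩
        (ofReal M *ᶜ ℂ-sum.indicator (v ≟ w)) *ᶜ c v w          ≈⟨ ℂ-ring.*-congʳ (ℂ-ring.*-comm _ _) ⟩
        (ℂ-sum.indicator (v ≟ w) *ᶜ ofReal M) *ᶜ c v w          ≈⟨ ℂ-ring.*-assoc _ _ _ ⟩
        ℂ-sum.indicator (v ≟ w) *ᶜ (ofReal M *ᶜ c v w)          ∎

-- Additive characters

module Characters (R : CompleteOrderedField) {q : ℕ} (F : FiniteField q) where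
  open OrderedField R
  open RealSums R
  open Complex R
  private module F where
    open FiniteField F public
    open FieldProperties F public
  open F using (Point; points; origin; elements; _∙_; _∸ᵛ_; ‖_‖; _≟ᵖ_)

  module CharacterProperties (X : AdditiveCharacter F) where
    open AdditiveCharacter X

    χ-cong : ∀ {a b} → a ≡ b → χ a ≈ᶜ χ b
    χ-cong ≡.refl = ℂ-ring.refl

    norm-χ-+ : ∀ a b → norm (χ (a F.+ b)) ≈ norm (χ a) * norm (χ b)
    norm-χ-+ a b = trans (norm-cong (χ-+ a b)) (norm-* (χ a) (χ b))

    norm-1 : norm 1ᶜ ≈ 1#
    norm-1 = trans (norm-ofReal 1#) (*-identityˡ 1#)

    -- The sum of |χ|² over the field is positive, and it is multiplied by
    -- |χ(b)|² under the translation by b.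
    norm-χ : ∀ b → norm (χ b) ≈ 1#
    norm-χ b = begin-equality
      norm (χ b)                ≈⟨ *-identityˡ _ ⟨
      1# * norm (χ b)           ≈⟨ *-congʳ (⁻¹-inverseˡ S (0<⇒≉0 0<S)) ⟨
      S ⁻¹ * S * norm (χ b)     ≈⟨ *-assoc _ _ _ ⟩
      S ⁻¹ * (S * norm (χ b))   ≈⟨ *-congˡ translate ⟩
      S ⁻¹ * S                  ≈⟨ ⁻¹-inverseˡ S (0<⇒≉0 0<S) ⟩
      1#                        ∎
      where
      open ≤-Reasoning
      S = sum elements (λ a → norm (χ a))
      0<S : 0# < S
      0<S = 1≤⇒0< (begin
        1#              ≈⟨ norm-1 ⟨
        norm 1ᶜ         ≈⟨ norm-cong χ-0 ⟨
        norm (χ F.0#)   ≈⟨ sift F._≟_ F.elements-isEnumeration F.0# (λ a → norm (χ a)) ⟨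
        sum elements (λ a → indicator (F.0# F.≟ a) * norm (χ a))
          ≤⟨ sum-mono-≤ elements (λ a → indicator*≤ (F.0# F.≟ a) (norm-nonNegative (χ a))) ⟩
        S               ∎)
        where
        indicator*≤ : ∀ {P : Set} (p : Dec P) {x} → 0# ≤ x → indicator p * x ≤ x
        indicator*≤ (yes _) _   = ≤-reflexive (*-identityˡ _)
        indicator*≤ (no _)  0≤x = ≤-respˡ-≈ (sym (zeroˡ _)) 0≤x
      translate : S * norm (χ b) ≈ S
      translate = begin-equality
        S * norm (χ b)                               ≈⟨ *-distribʳ-sum elements _ _ ⟩
        sum elements (λ a → norm (χ a) * norm (χ b)) ≈⟨ sum-cong elements (λ a → norm-χ-+ a b) ⟨
        sum elements (λ a → norm (χ (a F.+ b)))
          ≈⟨ sum-reindex F._≟_ F.elements-isEnumeration (F._+ b) (F._+ (F.- b))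
               (λ a → F.x+y-y≡x a b) (λ a → F.x-y+y≡x a b) (λ a → norm (χ a)) ⟩
        S ∎

    -- χ(-a) is inverse to χ(a), and on the unit circle the inverse is the conjugate.
    χ-neg : ∀ a → χ (F.- a) ≈ᶜ conj (χ a)
    χ-neg a = begin
      χ (F.- a)                            ≈⟨ ℂ-ring.*-identityˡ _ ⟨
      1ᶜ *ᶜ χ (F.- a)                      ≈⟨ ℂ-ring.*-congʳ (ofReal-cong (norm-χ a)) ⟨
      ofReal (norm (χ a)) *ᶜ χ (F.- a)     ≈⟨ ℂ-ring.*-congʳ (z*conj-z (χ a)) ⟨
      (χ a *ᶜ conj (χ a)) *ᶜ χ (F.- a)     ≈⟨ ℂ-ring.*-congʳ (ℂ-ring.*-comm _ _) ⟩
      (conj (χ a) *ᶜ χ a) *ᶜ χ (F.- a)     ≈⟨ ℂ-ring.*-assoc _ _ _ ⟩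
      conj (χ a) *ᶜ (χ a *ᶜ χ (F.- a))     ≈⟨ ℂ-ring.*-congˡ (χ-+ a (F.- a)) ⟨
      conj (χ a) *ᶜ χ (a F.+ F.- a)        ≈⟨ ℂ-ring.*-congˡ (χ-cong (F.-‿inverseʳ a)) ⟩
      conj (χ a) *ᶜ χ F.0#                 ≈⟨ ℂ-ring.*-congˡ χ-0 ⟩
      conj (χ a) *ᶜ 1ᶜ                     ≈⟨ ℂ-ring.*-identityʳ _ ⟩
      conj (χ a)                           ∎
      where open import Relation.Binary.Reasoning.Setoid ℂ-ring.setoid

    χ-∸ : ∀ a b → χ (a F.+ F.- b) ≈ᶜ χ a *ᶜ conj (χ b)
    χ-∸ a b = ℂ-ring.trans (χ-+ a (F.- b)) (ℂ-ring.*-congˡ (χ-neg b))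

    open import Relation.Binary.Reasoning.Setoid ℂ-ring.setoid

    -- For b ≠ 0 choose c so that χ(cb) ≠ 1. Translating a by c multiplies the sum by χ(cb) and also
    -- permutes its terms, so it vanishes.
    sum-χ : ∀ b → ℂ-sum.sum elements (λ a → χ (a F.* b)) ≈ᶜ
      ofReal (fromℕ q) *ᶜ ℂ-sum.indicator (b F.≟ F.0#)
    sum-χ b = by-cases (b F.≟ F.0#)
      where
      by-cases : (p : Dec (b ≡ F.0#)) → ℂ-sum.sum elements (λ a → χ (a F.* b)) ≈ᶜ
        ofReal (fromℕ q) *ᶜ ℂ-sum.indicator p
      by-cases (yes ≡.refl) = begin
        ℂ-sum.sum elements (λ a → χ (a F.* F.0#))
          ≈⟨ ℂ-sum.sum-cong elements (λ a → ℂ-ring.trans (χ-cong (F.zeroʳ a)) χ-0) ⟩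
        ℂ-sum.sum elements (λ _ → ofReal 1#)
          ≈⟨ ofReal-sum elements (λ _ → 1#) ⟨
        ofReal (sum elements (λ _ → 1#))
          ≈⟨ ofReal-cong (trans (sum-const elements 1#)
               (trans (*-identityʳ _) (reflexive (≡.cong fromℕ F.length-elements)))) ⟩
        ofReal (fromℕ q)
          ≈⟨ ℂ-ring.*-identityʳ _ ⟨
        ofReal (fromℕ q) *ᶜ 1ᶜ ∎
      by-cases (no b≢0) = ℂ-ring.trans (z*w≈w⇒w≈0 χ[cb]≉1 translate) (ℂ-ring.sym (ℂ-ring.zeroʳ _))
        where
        a₀ = proj₁ nontrivial
        c = a₀ F.* proj₁ (F.inverse b b≢0)
        cb≡a₀ : c F.* b ≡ a₀
        cb≡a₀ = F.x*y*z≡x a₀ (≡.trans (F.*-comm _ b) (proj₂ (F.inverse b b≢0)))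
        χ[cb]≉1 : ¬ (χ (c F.* b) ≈ᶜ 1ᶜ)
        χ[cb]≉1 χ≈1 = proj₂ nontrivial (ℂ-ring.trans (χ-cong (≡.sym cb≡a₀)) χ≈1)
        translate : χ (c F.* b) *ᶜ ℂ-sum.sum elements (λ a → χ (a F.* b)) ≈ᶜ
          ℂ-sum.sum elements (λ a → χ (a F.* b))
        translate = begin
          χ (c F.* b) *ᶜ ℂ-sum.sum elements (λ a → χ (a F.* b))
            ≈⟨ ℂ-sum.*-distribˡ-sum elements _ _ ⟩
          ℂ-sum.sum elements (λ a → χ (c F.* b) *ᶜ χ (a F.* b))
            ≈⟨ ℂ-sum.sum-cong elements (λ a → ℂ-ring.trans (ℂ-ring.*-comm _ _)
                 (ℂ-ring.trans (ℂ-ring.sym (χ-+ _ _)) (χ-cong (≡.sym (F.distribʳ b a c))))) ⟩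
          ℂ-sum.sum elements (λ a → χ ((a F.+ c) F.* b))
            ≈⟨ ℂ-sum.sum-reindex F._≟_ F.elements-isEnumeration (F._+ c) (F._+ (F.- c))
                 (λ a → F.x+y-y≡x a c) (λ a → F.x-y+y≡x a c) (λ a → χ (a F.* b)) ⟩
          ℂ-sum.sum elements (λ a → χ (a F.* b)) ∎

    orthogonality₁ : ∀ s t → ℂ-sum.sum elements (λ a → χ (a F.* s) *ᶜ conj (χ (a F.* t))) ≈ᶜ
      ofReal (fromℕ q) *ᶜ ℂ-sum.indicator (s F.≟ t)
    orthogonality₁ s t = begin
      ℂ-sum.sum elements (λ a → χ (a F.* s) *ᶜ conj (χ (a F.* t)))
        ≈⟨ ℂ-sum.sum-cong elements (λ a → ℂ-ring.trans (ℂ-ring.sym (χ-∸ _ _)) (χ-cong (F.ab-ac≡a[b-c] a s t))) ⟩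
      ℂ-sum.sum elements (λ a → χ (a F.* (s F.+ F.- t)))
        ≈⟨ sum-χ (s F.+ F.- t) ⟩
      ofReal (fromℕ q) *ᶜ ℂ-sum.indicator ((s F.+ F.- t) F.≟ F.0#)
        ≈⟨ ℂ-ring.*-congˡ (ℂ-sum.indicator-cong ((s F.+ F.- t) F.≟ F.0#) (s F.≟ t)
             F.x-y≡0⇒x≡y (λ { ≡.refl → F.-‿inverseʳ s })) ⟩
      ofReal (fromℕ q) *ᶜ ℂ-sum.indicator (s F.≟ t) ∎

    -- The sum factors over the coordinates, and a nonzero coordinate of u kills its factor.
    sum-χ-∙ : ∀ {d} (u : Point d) → ℂ-sum.sum (points d) (λ x → χ (x ∙ u)) ≈ᶜ
      ofReal (fromℕ q ^ d) *ᶜ ℂ-sum.indicator (u ≟ᵖ origin)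
    sum-χ-∙ [] = begin
      χ F.0# +ᶜ 0ᶜ         ≈⟨ ℂ-ring.+-identityʳ _ ⟩
      χ F.0#               ≈⟨ χ-0 ⟩
      1ᶜ                   ≈⟨ ℂ-ring.*-identityʳ 1ᶜ ⟨
      ofReal 1# *ᶜ 1ᶜ      ∎
    sum-χ-∙ {suc d} (b ∷ u) = begin
      ℂ-sum.sum (points (suc d)) (λ x → χ (x ∙ (b ∷ u)))
        ≈⟨ ℂ-sum.sum-cartesianProductWith _∷_ elements (points d) _ ⟩
      ℂ-sum.sum elements (λ a → ℂ-sum.sum (points d) (λ x → χ (a F.* b F.+ x ∙ u)))
        ≈⟨ ℂ-sum.sum-cong elements (λ a → ℂ-sum.sum-cong (points d) λ x → χ-+ _ _) ⟩
      ℂ-sum.sum elements (λ a → ℂ-sum.sum (points d) (λ x → χ (a F.* b) *ᶜ χ (x ∙ u)))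
        ≈⟨ ℂ-sum.sum*sum elements (points d) _ _ ⟨
      ℂ-sum.sum elements (λ a → χ (a F.* b)) *ᶜ ℂ-sum.sum (points d) (λ x → χ (x ∙ u))
        ≈⟨ ℂ-ring.*-cong (sum-χ b) (sum-χ-∙ u) ⟩
      (ofReal (fromℕ q) *ᶜ ℂ-sum.indicator (b F.≟ F.0#)) *ᶜ
        (ofReal (fromℕ q ^ d) *ᶜ ℂ-sum.indicator (u ≟ᵖ origin))
        ≈⟨ interchange _ _ _ _ ⟩
      (ofReal (fromℕ q) *ᶜ ofReal (fromℕ q ^ d)) *ᶜ
        (ℂ-sum.indicator (b F.≟ F.0#) *ᶜ ℂ-sum.indicator (u ≟ᵖ origin))
        ≈⟨ ℂ-ring.*-cong (ℂ-ring.sym (ofReal-* _ _)) (indicator-∷ (b F.≟ F.0#) (u ≟ᵖ origin)) ⟩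
      ofReal (fromℕ q ^ suc d) *ᶜ ℂ-sum.indicator ((b ∷ u) ≟ᵖ origin) ∎
      where
      indicator-∷ : (p : Dec (b ≡ F.0#)) (r : Dec (u ≡ origin)) →
        ℂ-sum.indicator p *ᶜ ℂ-sum.indicator r ≈ᶜ ℂ-sum.indicator ((b ∷ u) ≟ᵖ origin)
      indicator-∷ (yes b≡0) (yes u≡0) = ℂ-ring.trans (ℂ-ring.*-identityˡ _)
        (ℂ-ring.sym (ℂ-sum.indicator-yes ((b ∷ u) ≟ᵖ origin) (≡.cong₂ _∷_ b≡0 u≡0)))
      indicator-∷ (yes b≡0) (no u≢0)  = ℂ-ring.trans (ℂ-ring.zeroʳ _)
        (ℂ-ring.sym (ℂ-sum.indicator-no ((b ∷ u) ≟ᵖ origin) λ eq → u≢0 (≡.cong Vec.tail eq)))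
      indicator-∷ (no b≢0)  r         = ℂ-ring.trans (ℂ-ring.zeroˡ _)
        (ℂ-ring.sym (ℂ-sum.indicator-no ((b ∷ u) ≟ᵖ origin) λ eq → b≢0 (≡.cong Vec.head eq)))

    χ-∙-∸ᵛ : ∀ {d} (v x y : Point d) → χ (v ∙ x) *ᶜ conj (χ (v ∙ y)) ≈ᶜ χ (v ∙ (x ∸ᵛ y))
    χ-∙-∸ᵛ v x y = ℂ-ring.trans (ℂ-ring.sym (χ-∸ _ _)) (χ-cong (≡.sym (F.∙-∸ᵛ v x y)))

    orthogonality : ∀ {d} (x y : Point d) →
      ℂ-sum.sum (points d) (λ v → χ (v ∙ x) *ᶜ conj (χ (v ∙ y))) ≈ᶜ
      ofReal (fromℕ q ^ d) *ᶜ ℂ-sum.indicator (x ≟ᵖ y)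
    orthogonality {d} x y = begin
      ℂ-sum.sum (points d) (λ v → χ (v ∙ x) *ᶜ conj (χ (v ∙ y)))
        ≈⟨ ℂ-sum.sum-cong (points d) (λ v → χ-∙-∸ᵛ v x y) ⟩
      ℂ-sum.sum (points d) (λ v → χ (v ∙ (x ∸ᵛ y)))
        ≈⟨ sum-χ-∙ (x ∸ᵛ y) ⟩
      ofReal (fromℕ q ^ d) *ᶜ ℂ-sum.indicator ((x ∸ᵛ y) ≟ᵖ origin)
        ≈⟨ ℂ-ring.*-congˡ (ℂ-sum.indicator-cong ((x ∸ᵛ y) ≟ᵖ origin) (x ≟ᵖ y)
             F.x∸ᵛy≡0⇒x≡y (λ { ≡.refl → F.x∸ᵛx≡0 x })) ⟩
      ofReal (fromℕ q ^ d) *ᶜ ℂ-sum.indicator (x ≟ᵖ y) ∎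

  -- Absorbs a nonzero factor t into the character, so that χ(t (x∙y)) is again of the form χ(x∙y).
  -- Nontriviality is witnessed at a₀ / t.
  twist : AdditiveCharacter F → ∀ t → t ≢ F.0# → AdditiveCharacter F
  twist X t t≢0 = record
    { χ          = λ a → χ (t F.* a)
    ; χ-0        = ℂ-ring.trans (χ-cong (F.zeroʳ t)) χ-0
    ; χ-+        = λ a b → ℂ-ring.trans (χ-cong (F.distribˡ t a b)) (χ-+ _ _)
    ; nontrivial = proj₁ (F.inverse t t≢0) F.* a₀ , λ χ≈1 → proj₂ nontrivial
        (ℂ-ring.trans (χ-cong (≡.sym ta≡a₀)) χ≈1)
    }
    where
    open AdditiveCharacter X
    open CharacterProperties X
    a₀ = proj₁ nontrivial
    ta≡a₀ : t F.* (proj₁ (F.inverse t t≢0) F.* a₀) ≡ a₀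
    ta≡a₀ = ≡.trans (≡.sym (F.*-assoc t _ a₀))
      (≡.trans (≡.cong (F._* a₀) (proj₂ (F.inverse t t≢0))) (F.*-identityˡ a₀))

-- Additive energy and distances

module Energy (R : CompleteOrderedField) {q : ℕ} (F : FiniteField q)
  {d : ℕ} (E : List (FiniteField.Point F d)) where
  open OrderedField R
  open RealSums R
  open Complex R
  open Characters R F
  private module F where
    open FiniteField F public
    open FieldProperties F public
  open F using (Point; points; origin; elements; _∙_; _∸ᵛ_; ‖_‖; _≟ᵖ_)

  pairs : List (Point d × Point d)
  pairs = cartesianProductWith _,_ E E

  δ : Point d × Point d → Point d
  δ (x , y) = x ∸ᵛ y

  -- The representation function of E - E, whose second moment Λ is the
  -- additive energy of E.
  r : Point d → ℝ
  r w = sum pairs (λ p → indicator (δ p ≟ᵖ w))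

  Λ L Q : ℝ
  Λ = sum (points d) (λ w → r w * r w)
  L = fromℕ (length E)
  Q = fromℕ q ^ d

  0≤L : 0# ≤ L
  0≤L = fromℕ-nonNegative (length E)

  0≤Q : 0# ≤ Q
  0≤Q = ^-nonNegative (fromℕ-nonNegative q) d

  0≤Λ : 0# ≤ Λ
  0≤Λ = sum-nonNegative (points d) (λ w → 0≤x*x (r w))

  sum-E-1 : sum E (λ _ → 1#) ≈ L
  sum-E-1 = trans (sum-const E 1#) (*-identityʳ L)

  sum-pairs-1 : sum pairs (λ _ → 1#) ≈ L * L
  sum-pairs-1 = begin-equality
    sum pairs (λ _ → 1#)                       ≈⟨ sum-cartesianProductWith _,_ E E _ ⟩
    sum E (λ _ → sum E (λ _ → 1#))             ≈⟨ sum-const E _ ⟩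
    L * sum E (λ _ → 1#)                       ≈⟨ *-congˡ sum-E-1 ⟩
    L * L                                      ∎
    where open ≤-Reasoning

  sum-δ : ∀ (f : Point d → ℝ) → sum pairs (f ∘ δ) ≈ sum (points d) (λ w → r w * f w)
  sum-δ f = sum-fibres _≟ᵖ_ (F.points-isEnumeration d) pairs δ f

  Unimodular : (Point d → ℂ) → Set _
  Unimodular a = ∀ y → norm (a y) ≈ 1#

  module Transform (X : AdditiveCharacter F) where
    open AdditiveCharacter X
    open CharacterProperties X

    -- The Fourier transform of the weight `a` on E, without normalisation and without the minus
    -- sign of `fourier`.
    transform : (Point d → ℂ) → Point d → ℂ
    transform a v = ℂ-sum.sum E (λ y → a y *ᶜ χ (v ∙ y))

    coefficient : (Point d → ℂ) → Point d × Point d → ℂ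
    coefficient a (y , y′) = a y *ᶜ conj (a y′)

    -- The coefficient of χ(v∙w) in |transform a v|². For the constant weight `one` it is the
    -- representation function `r`.
    correlation : (Point d → ℂ) → Point d → ℂ
    correlation a w = ℂ-sum.sum pairs (λ p → ℂ-sum.indicator (δ p ≟ᵖ w) *ᶜ coefficient a p)

    one : Point d → ℂ
    one _ = 1ᶜ

    -- The restriction of the second moment to E itself, bounded in terms of
    -- the additive energy in two ways: by extending the fourth moment to all
    -- points, and by duality (exchanging the roles of x and of y , y′).
    restricted : (Point d → ℂ) → ℝ
    restricted a = sum E (λ x → norm (transform a x))

    private
      fourth-moment : (Point d → ℂ) → ℝ
      fourth-moment a = sum (points d) (λ v → norm (transform a v) * norm (transform a v))

    module _ where
      open import Relation.Binary.Reasoning.Setoid ℂ-ring.setoid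

      norm-transform : ∀ a v → ofReal (norm (transform a v)) ≈ᶜ
        ℂ-sum.sum pairs (λ p → coefficient a p *ᶜ χ (v ∙ δ p))
      norm-transform a v = begin
        ofReal (norm (transform a v))
          ≈⟨ z*conj-z (transform a v) ⟨
        transform a v *ᶜ conj (transform a v)
          ≈⟨ ℂ-ring.*-congˡ (conj-sum E _) ⟩
        transform a v *ᶜ ℂ-sum.sum E (λ y → conj (a y *ᶜ χ (v ∙ y)))
          ≈⟨ ℂ-sum.sum*sum E E _ _ ⟩
        ℂ-sum.sum E (λ y → ℂ-sum.sum E (λ y′ → (a y *ᶜ χ (v ∙ y)) *ᶜ conj (a y′ *ᶜ χ (v ∙ y′))))
          ≈⟨ ℂ-sum.sum-cong E (λ y → ℂ-sum.sum-cong E λ y′ → expand y y′) ⟩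
        ℂ-sum.sum E (λ y → ℂ-sum.sum E (λ y′ → coefficient a (y , y′) *ᶜ χ (v ∙ (y ∸ᵛ y′))))
          ≈⟨ ℂ-sum.sum-cartesianProductWith _,_ E E _ ⟨
        ℂ-sum.sum pairs (λ p → coefficient a p *ᶜ χ (v ∙ δ p)) ∎
        where
        expand : ∀ y y′ → (a y *ᶜ χ (v ∙ y)) *ᶜ conj (a y′ *ᶜ χ (v ∙ y′)) ≈ᶜ
          coefficient a (y , y′) *ᶜ χ (v ∙ (y ∸ᵛ y′))
        expand y y′ = begin
          (a y *ᶜ χ (v ∙ y)) *ᶜ conj (a y′ *ᶜ χ (v ∙ y′))
            ≈⟨ ℂ-ring.*-congˡ (conj-* _ _) ⟩
          (a y *ᶜ χ (v ∙ y)) *ᶜ (conj (a y′) *ᶜ conj (χ (v ∙ y′)))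
            ≈⟨ interchange _ _ _ _ ⟩
          (a y *ᶜ conj (a y′)) *ᶜ (χ (v ∙ y) *ᶜ conj (χ (v ∙ y′)))
            ≈⟨ ℂ-ring.*-congˡ (χ-∙-∸ᵛ v y y′) ⟩
          coefficient a (y , y′) *ᶜ χ (v ∙ (y ∸ᵛ y′)) ∎

      norm-transform-correlation : ∀ a v → ofReal (norm (transform a v)) ≈ᶜ
        ℂ-sum.sum (points d) (λ w → correlation a w *ᶜ χ (v ∙ w))
      norm-transform-correlation a v = ℂ-ring.trans (norm-transform a v)
        (ℂ-sum.sum-weighted-fibres _≟ᵖ_ (F.points-isEnumeration d) pairs δ (coefficient a) (λ w → χ (v ∙ w)))

      -- Once x is summed first, the symmetry of the dot product lets the difference y - y′ act as
      -- the frequency. The inner sum then carries no weight, and `a` survives only in the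
      -- coefficients.
      restricted-dual : ∀ a → ofReal (restricted a) ≈ᶜ
        ℂ-sum.sum pairs (λ p → coefficient a p *ᶜ transform one (δ p))
      restricted-dual a = begin
        ofReal (restricted a)
          ≈⟨ ofReal-sum E _ ⟩
        ℂ-sum.sum E (λ x → ofReal (norm (transform a x)))
          ≈⟨ ℂ-sum.sum-cong E (norm-transform a) ⟩
        ℂ-sum.sum E (λ x → ℂ-sum.sum pairs (λ p → coefficient a p *ᶜ χ (x ∙ δ p)))
          ≈⟨ ℂ-sum.sum-swap E pairs _ ⟩
        ℂ-sum.sum pairs (λ p → ℂ-sum.sum E (λ x → coefficient a p *ᶜ χ (x ∙ δ p)))
          ≈⟨ ℂ-sum.sum-cong pairs (λ p → ℂ-ring.trans
               (ℂ-ring.sym (ℂ-sum.*-distribˡ-sum E (coefficient a p) _))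
               (ℂ-ring.*-congˡ (ℂ-sum.sum-cong E λ x → ℂ-ring.trans
                 (χ-cong (F.∙-comm x (δ p))) (ℂ-ring.sym (ℂ-ring.*-identityˡ _))))) ⟩
        ℂ-sum.sum pairs (λ p → coefficient a p *ᶜ transform one (δ p)) ∎

    open ≤-Reasoning

    -- Parseval for the function |transform a v|², whose Fourier coefficients are the correlations.
    fourth-moment-correlation : ∀ a → fourth-moment a ≈
      Q * sum (points d) (λ w → norm (correlation a w))
    fourth-moment-correlation a = begin-equality
      fourth-moment a
        ≈⟨ sum-cong (points d) (λ v → trans (sym (norm-ofReal (norm (transform a v))))
             (norm-cong (norm-transform-correlation a v))) ⟩
      sum (points d) (λ v → norm (ℂ-sum.sum (points d) (λ w → correlation a w *ᶜ χ (v ∙ w))))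
        ≈⟨ parseval (points d) _≟ᵖ_ (F.points-isEnumeration d) (λ v w → χ (v ∙ w)) Q orthogonality (correlation a) ⟩
      Q * sum (points d) (λ w → norm (correlation a w)) ∎

    norm-coefficient : ∀ {a} → Unimodular a → ∀ p → norm (coefficient a p) ≈ 1#
    norm-coefficient {a} |a|≈1 (y , y′) = begin-equality
      norm (a y *ᶜ conj (a y′))      ≈⟨ norm-* (a y) (conj (a y′)) ⟩
      norm (a y) * norm (conj (a y′)) ≈⟨ *-cong (|a|≈1 y) (trans (norm-conj (a y′)) (|a|≈1 y′)) ⟩
      1# * 1#                        ≈⟨ *-identityˡ 1# ⟩
      1#                             ∎

    -- The triangle inequality in squared form: r w terms of modulus 1 are summed.
    norm-correlation : ∀ {a} → Unimodular a → ∀ w → norm (correlation a w) ≤ r w * r w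
    norm-correlation {a} |a|≈1 w = begin
      norm (correlation a w)
        ≈⟨ norm-cong (ℂ-sum.sum-cong pairs λ p → ℂ-ring.*-congʳ (ℂ-ring.reflexive (≡.sym (ofReal-indicator (δ p ≟ᵖ w))))) ⟩
      norm (ℂ-sum.sum pairs (λ p → ofReal (indicator (δ p ≟ᵖ w)) *ᶜ coefficient a p))
        ≤⟨ norm-weighted-sum pairs (coefficient a) (λ p → indicator-nonNegative (δ p ≟ᵖ w)) ⟩
      r w * sum pairs (λ p → indicator (δ p ≟ᵖ w) * norm (coefficient a p))
        ≈⟨ *-congˡ (sum-cong pairs λ p → trans (*-congˡ (norm-coefficient |a|≈1 p)) (*-identityʳ _)) ⟩
      r w * r w ∎

    fourth-moment≤ : ∀ {a} → Unimodular a → fourth-moment a ≤ Q * Λ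
    fourth-moment≤ {a} |a|≈1 = begin
      fourth-moment a                                        ≈⟨ fourth-moment-correlation a ⟩
      Q * sum (points d) (λ w → norm (correlation a w))      ≤⟨ *-monoˡ-≤ 0≤Q (sum-mono-≤ (points d) (norm-correlation |a|≈1)) ⟩
      Q * Λ                                                  ∎

    -- For the constant weight there is no cancellation in the correlations. The equality lets the
    -- moment in the Salem condition determine Λ.
    fourth-moment-one : fourth-moment one ≈ Q * Λ
    fourth-moment-one = trans (fourth-moment-correlation one) (*-congˡ (sum-cong (points d) λ w →
      trans (norm-cong (correlation-one w)) (norm-ofReal (r w))))
      where
      correlation-one : ∀ w → correlation one w ≈ᶜ ofReal (r w)
      correlation-one w = ℂ-ring.trans
        (ℂ-sum.sum-cong pairs λ p → ℂ-ring.trans (ℂ-ring.*-congˡ 1*conj1)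
          (ℂ-ring.trans (ℂ-ring.*-identityʳ _) (ℂ-ring.reflexive (≡.sym (ofReal-indicator (δ p ≟ᵖ w))))))
        (ℂ-ring.sym (ofReal-sum pairs _))
        where
        1*conj1 : 1ᶜ *ᶜ conj 1ᶜ ≈ᶜ 1ᶜ
        1*conj1 = ℂ-ring.trans (z*conj-z 1ᶜ) (ofReal-cong norm-1)

    -- After Cauchy-Schwarz over the L points of E, the sum of fourth powers is extended to the
    -- whole space. Since E has no repetitions, this only adds nonnegative terms.
    restricted²≤ : Unique E → ∀ {a} → Unimodular a → restricted a * restricted a ≤ L * (Q * Λ)
    restricted²≤ E! {a} |a|≈1 = begin
      restricted a * restricted a
        ≤⟨ cauchy-schwarz E (λ _ → 0≤1) (λ x → 0≤x*x (norm (transform a x))) (λ x → ≤-reflexive (sym (*-identityˡ _))) ⟩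
      sum E (λ _ → 1#) * sum E (λ x → norm (transform a x) * norm (transform a x))
        ≤⟨ *-mono-≤ (≤-respʳ-≈ (sym sum-E-1) 0≤L) (sum-nonNegative E λ x → 0≤x*x (norm (transform a x)))
             (≤-reflexive sum-E-1)
             (sum-≤-enumeration _≟ᵖ_ (F.points-isEnumeration d) E! (λ x → 0≤x*x (norm (transform a x)))) ⟩
      L * fourth-moment a
        ≤⟨ *-monoˡ-≤ 0≤L (fourth-moment≤ |a|≈1) ⟩
      L * (Q * Λ) ∎

    -- Cauchy-Schwarz twice on the dual form: over the L² pairs, which removes the unimodular
    -- coefficients, and then, with the pairs grouped by their difference w, over w, which separates
    -- `r` from the transform of `one`. The two factors of the last step are Λ and Q Λ.
    restricted⁴≤ : ∀ {a} → Unimodular a →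
      (restricted a * restricted a) * (restricted a * restricted a) ≤ ((L * L) * (L * L)) * (Λ * (Q * Λ))
    restricted⁴≤ {a} |a|≈1 = begin
      (restricted a * restricted a) * (restricted a * restricted a)
        ≤⟨ *-mono-≤ (0≤x*x (restricted a)) (0≤x*x (restricted a)) D²≤ D²≤ ⟩
      ((L * L) * G) * ((L * L) * G)
        ≈⟨ solve 2 (λ l g → (l :* g) :* (l :* g) := (l :* l) :* (g :* g)) refl (L * L) G ⟩
      ((L * L) * (L * L)) * (G * G)
        ≤⟨ *-monoˡ-≤ (*-nonNegative (0≤x*x L) (0≤x*x L)) G²≤ ⟩
      ((L * L) * (L * L)) * (Λ * (Q * Λ)) ∎
      where
      dual : restricted a ≈ sum pairs (λ p → re (coefficient a p *ᶜ transform one (δ p)))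
      dual = trans (proj₁ (restricted-dual a)) (reflexive (re-sum pairs _))
      G = sum (points d) (λ w → r w * norm (transform one w))
      D²≤ : restricted a * restricted a ≤ (L * L) * G
      D²≤ = begin
        restricted a * restricted a
          ≈⟨ *-cong dual dual ⟩
        sum pairs (λ p → re (coefficient a p *ᶜ transform one (δ p))) * sum pairs (λ p → re (coefficient a p *ᶜ transform one (δ p)))
          ≤⟨ cauchy-schwarz pairs (λ _ → 0≤1) (λ p → norm-nonNegative (transform one (δ p))) (λ p → begin
               _ ≤⟨ re[z]²≤norm (coefficient a p *ᶜ transform one (δ p)) ⟩
               norm (coefficient a p *ᶜ transform one (δ p)) ≈⟨ norm-* (coefficient a p) _ ⟩
               norm (coefficient a p) * norm (transform one (δ p)) ≈⟨ *-congʳ (norm-coefficient |a|≈1 p) ⟩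
               1# * norm (transform one (δ p)) ∎) ⟩
        sum pairs (λ _ → 1#) * sum pairs (λ p → norm (transform one (δ p)))
          ≈⟨ *-cong sum-pairs-1 (sum-δ (λ w → norm (transform one w))) ⟩
        (L * L) * G ∎
      G²≤ : G * G ≤ Λ * (Q * Λ)
      G²≤ = begin
        G * G
          ≤⟨ cauchy-schwarz (points d) (λ w → 0≤x*x (r w)) (λ w → 0≤x*x (norm (transform one w)))
               (λ w → ≤-reflexive (solve 2 (λ a b → (a :* b) :* (a :* b) := (a :* a) :* (b :* b)) refl (r w) (norm (transform one w)))) ⟩
        Λ * fourth-moment one
          ≈⟨ *-congˡ fourth-moment-one ⟩
        Λ * (Q * Λ) ∎

  ν : F.Carrier → ℝ
  ν t = sum pairs (λ p → indicator (‖ δ p ‖ F.≟ t))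

  M : ℝ
  M = sum elements (λ t → ν t * ν t)

  L⁴≤Δ*M : (L * L) * (L * L) ≤ fromℕ (length (F.Δ E)) * M
  L⁴≤Δ*M = begin
    (L * L) * (L * L)
      ≤⟨ *-mono-≤ (0≤x*x L) (0≤x*x L) L²≤ L²≤ ⟩
    sum (F.Δ E) ν * sum (F.Δ E) ν
      ≤⟨ cauchy-schwarz (F.Δ E) (λ _ → 0≤1) (λ t → 0≤x*x (ν t)) (λ t → ≤-reflexive (sym (*-identityˡ _))) ⟩
    sum (F.Δ E) (λ _ → 1#) * sum (F.Δ E) (λ t → ν t * ν t)
      ≈⟨ *-congʳ (trans (sum-const (F.Δ E) 1#) (*-identityʳ _)) ⟩
    fromℕ (length (F.Δ E)) * sum (F.Δ E) (λ t → ν t * ν t)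
      ≤⟨ *-monoˡ-≤ (fromℕ-nonNegative (length (F.Δ E)))
           (sum-≤-enumeration F._≟_ F.elements-isEnumeration Δ! (λ t → 0≤x*x (ν t))) ⟩
    fromℕ (length (F.Δ E)) * M ∎
    where
    open ≤-Reasoning
    Δ! : Unique (F.Δ E)
    Δ! = DecUnique.deduplicate-! F._≟_ _
    L²≤ : L * L ≤ sum (F.Δ E) ν
    L²≤ = begin
      L * L
        ≈⟨ trans (sym sum-pairs-1) (sum-cartesianProductWith _,_ E E _) ⟩
      sum E (λ x → sum E (λ y → 1#))
        -- Membership of x and y in E puts their distance in Δ E, where it is met exactly once.
        ≤⟨ sum-mono-∈ E (λ x x∈E → sum-mono-∈ E λ y y∈E → ≤-reflexive (sym
             (trans (sum-cong (F.Δ E) λ t → sym (*-identityʳ _))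
               (sift-∈ F._≟_ Δ! (∈-deduplicate⁺ F._≟_ (∈-cartesianProductWith⁺ (λ x y → ‖ x ∸ᵛ y ‖) x∈E y∈E)) (λ _ → 1#))))) ⟩
      sum E (λ x → sum E (λ y → sum (F.Δ E) (λ t → indicator (‖ x ∸ᵛ y ‖ F.≟ t))))
        ≈⟨ sum-cartesianProductWith _,_ E E _ ⟨
      sum pairs (λ p → sum (F.Δ E) (λ t → indicator (‖ δ p ‖ F.≟ t)))
        ≈⟨ sum-swap pairs (F.Δ E) _ ⟩
      sum (F.Δ E) ν ∎

-- Exponential sums over distances

module Distances (R : CompleteOrderedField) {q : ℕ} (F : FiniteField q)
  {d : ℕ} (E : List (FiniteField.Point F d)) where
  open OrderedField R
  open RealSums R
  open Complex R
  open Characters R F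
  open Powers R
  private module F where
    open FiniteField F public
    open FieldProperties F public
  open F using (Point; points; origin; elements; _∙_; _∸ᵛ_; ‖_‖; _≟ᵖ_)
  open Energy R F E

  module CharacterSums (X : AdditiveCharacter F) where
    open AdditiveCharacter X
    open CharacterProperties X

    B : F.Carrier → ℂ
    B j = ℂ-sum.sum pairs (λ p → χ (j F.* ‖ δ p ‖))

    B-ν : ∀ j → B j ≈ᶜ ℂ-sum.sum elements (λ t → ofReal (ν t) *ᶜ χ (j F.* t))
    B-ν j = ℂ-ring.trans
      (ℂ-sum.sum-fibres F._≟_ F.elements-isEnumeration pairs (‖_‖ ∘ δ) (λ t → χ (j F.* t)))
      (ℂ-sum.sum-cong elements λ t → ℂ-ring.*-congʳ (ℂ-ring.trans
        (ℂ-sum.sum-cong pairs λ p → ℂ-ring.reflexive (≡.sym (ofReal-indicator (‖ δ p ‖ F.≟ t))))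
        (ℂ-ring.sym (ofReal-sum pairs _))))

    open ≤-Reasoning

    -- By `B-ν`, B is the Fourier transform of ν, and this is Parseval on the field.
    second-moment : sum elements (λ j → norm (B j)) ≈ fromℕ q * M
    second-moment = begin-equality
      sum elements (λ j → norm (B j))
        ≈⟨ sum-cong elements (λ j → norm-cong (B-ν j)) ⟩
      sum elements (λ j → norm (ℂ-sum.sum elements (λ t → ofReal (ν t) *ᶜ χ (j F.* t))))
        ≈⟨ parseval elements F._≟_ F.elements-isEnumeration (λ j t → χ (j F.* t)) (fromℕ q)
             orthogonality₁ (λ t → ofReal (ν t)) ⟩
      fromℕ q * sum elements (λ t → norm (ofReal (ν t)))
        ≈⟨ *-congˡ (sum-cong elements λ t → norm-ofReal (ν t)) ⟩
      fromℕ q * M ∎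

    norm-sum-1 : ∀ {A : Set} (xs : List A) {z : A → ℂ} {n} → sum xs (λ _ → 1#) ≈ n →
      (∀ x → z x ≈ᶜ 1ᶜ) → norm (ℂ-sum.sum xs z) ≈ n * n
    norm-sum-1 xs {z} {n} sum≈n z≈1 = trans (norm-cong eq) (norm-ofReal n)
      where
      eq : ℂ-sum.sum xs z ≈ᶜ ofReal n
      eq = ℂ-ring.trans (ℂ-sum.sum-cong xs z≈1)
        (ℂ-ring.trans (ℂ-ring.sym (ofReal-sum xs (λ _ → 1#))) (ofReal-cong sum≈n))

    norm-B-0 : norm (B F.0#) ≈ (L * L) * (L * L)
    norm-B-0 = norm-sum-1 pairs sum-pairs-1 λ p → ℂ-ring.trans (χ-cong (F.zeroˡ _)) χ-0

    module _ (2∤q : ¬ (2 ∣ q)) {j : F.Carrier} (j≢0 : j ≢ F.0#) where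

      -- Odd order enters here: in characteristic 2 the cross term -2j (x∙y) would disappear, and
      -- the bilinear form with it.
      -2j≢0 : F.- (j F.+ j) ≢ F.0#
      -2j≢0 -2j≡0 = j≢0 (F.x*y≡0⇒y≡0 (F.1+1≢0 2∤q)
        (≡.trans (F.[1+1]*x≡x+x j) (F.-x≡0⇒x≡0 -2j≡0)))

      module T = Transform (twist X (F.- (j F.+ j)) -2j≢0)

      phase : Point d → ℂ
      phase y = χ (j F.* ‖ y ‖)

      phase-unimodular : Unimodular phase
      phase-unimodular y = norm-χ _

      χ-expand : ∀ x y → χ (j F.* ‖ x ∸ᵛ y ‖) ≈ᶜ
        phase x *ᶜ (phase y *ᶜ χ (F.- (j F.+ j) F.* (x ∙ y)))
      χ-expand x y = ℂ-ring.trans (χ-cong (≡.trans (≡.cong (j F.*_) (F.‖∸ᵛ‖ x y)) (F.expand-distance j ‖ x ‖ ‖ y ‖ (x ∙ y))))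
        (ℂ-ring.trans (χ-+ _ _) (ℂ-ring.*-congˡ (χ-+ _ _)))

      B-transform : B j ≈ᶜ ℂ-sum.sum E (λ x → phase x *ᶜ T.transform phase x)
      B-transform = ℂ-ring.trans (ℂ-sum.sum-cartesianProductWith _,_ E E _)
        (ℂ-sum.sum-cong E λ x → ℂ-ring.trans (ℂ-sum.sum-cong E (χ-expand x))
          (ℂ-ring.sym (ℂ-sum.*-distribˡ-sum E (phase x) _)))

      -- Cauchy-Schwarz in x discards the outer phase. The phase in y stays inside the transform, as
      -- a unimodular weight.
      norm-B≤ : norm (B j) ≤ L * T.restricted phase
      norm-B≤ = begin
        norm (B j)
          ≈⟨ norm-cong (ℂ-ring.trans B-transform (ℂ-sum.sum-cong E λ x → ℂ-ring.sym (ℂ-ring.*-identityˡ _))) ⟩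
        norm (ℂ-sum.sum E (λ x → 1ᶜ *ᶜ (phase x *ᶜ T.transform phase x)))
          ≤⟨ norm-weighted-sum E (λ x → phase x *ᶜ T.transform phase x) (λ _ → 0≤1) ⟩
        sum E (λ _ → 1#) * sum E (λ x → 1# * norm (phase x *ᶜ T.transform phase x))
          ≈⟨ *-cong sum-E-1 (sum-cong E λ x → trans (*-identityˡ _)
               (trans (norm-* (phase x) _) (trans (*-congʳ (phase-unimodular x)) (*-identityˡ _)))) ⟩
        L * T.restricted phase ∎

      -- As `norm` is the squared modulus, this bounds |B(j)|⁴, and `norm-B⁴≤` bounds |B(j)|⁸.
      norm-B²≤ : Unique E → norm (B j) * norm (B j) ≤ (L * L) * (L * (Q * Λ))
      norm-B²≤ E! = begin
        norm (B j) * norm (B j)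
          ≤⟨ *-mono-≤ (norm-nonNegative (B j)) (norm-nonNegative (B j)) norm-B≤ norm-B≤ ⟩
        (L * D) * (L * D)
          ≈⟨ solve 2 (λ l D → (l :* D) :* (l :* D) := (l :* l) :* (D :* D)) refl L D ⟩
        (L * L) * (D * D)
          ≤⟨ *-monoˡ-≤ (0≤x*x L) (T.restricted²≤ E! phase-unimodular) ⟩
        (L * L) * (L * (Q * Λ)) ∎
        where D = T.restricted phase

      norm-B⁴≤ : (norm (B j) * norm (B j)) * (norm (B j) * norm (B j)) ≤
        ((L * L) * (L * L)) * (((L * L) * (L * L)) * (Λ * (Q * Λ)))
      norm-B⁴≤ = begin
        (norm (B j) * norm (B j)) * (norm (B j) * norm (B j))
          ≤⟨ *-mono-≤ (0≤x*x (norm (B j))) (0≤x*x (norm (B j))) sq sq ⟩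
        ((L * D) * (L * D)) * ((L * D) * (L * D))
          ≈⟨ solve 2 (λ l D → ((l :* D) :* (l :* D)) :* ((l :* D) :* (l :* D))
               := ((l :* l) :* (l :* l)) :* ((D :* D) :* (D :* D))) refl L D ⟩
        ((L * L) * (L * L)) * ((D * D) * (D * D))
          ≤⟨ *-monoˡ-≤ (0≤x*x (L * L)) (T.restricted⁴≤ phase-unimodular) ⟩
        ((L * L) * (L * L)) * (((L * L) * (L * L)) * (Λ * (Q * Λ))) ∎
        where
        D = T.restricted phase
        sq : norm (B j) * norm (B j) ≤ (L * D) * (L * D)
        sq = *-mono-≤ (norm-nonNegative (B j)) (norm-nonNegative (B j)) norm-B≤ norm-B≤

    private
      -- Twisting by -1 accounts for the sign in the definition of `fourier`.
      X⁻ : AdditiveCharacter F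
      X⁻ = twist X (F.- F.1#) F.-1≢0
      module T⁻ = Transform X⁻

    fourier-transform : ∀ x → fourier X E x ≈ᶜ ofReal (Q ⁻¹) *ᶜ T⁻.transform T⁻.one x
    fourier-transform x = ℂ-ring.*-congˡ (ℂ-sum.sum-cong E λ y →
      ℂ-ring.trans (χ-cong (≡.sym (F.-1*x≡-x (x ∙ y)))) (ℂ-ring.sym (ℂ-ring.*-identityˡ _)))

    norm²≤∣∣⁴ : ∀ z → norm z * norm z ≤ ∣ z ∣ ^ 4
    norm²≤∣∣⁴ z = begin
      norm z * norm z
        ≤⟨ *-mono-≤ (norm-nonNegative z) (norm-nonNegative z) norm≤ norm≤ ⟩
      ∣ z ∣ ^ 2 * ∣ z ∣ ^ 2
        ≈⟨ ^-homo-* ∣ z ∣ 2 2 ⟨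
      ∣ z ∣ ^ 4 ∎
      where
      norm≈ : norm z ≈ re z ^ 2 + im z ^ 2
      norm≈ = solve 2 (λ a b → a :* a :+ b :* b := a :^ 2 :+ b :^ 2) refl (re z) (im z)
      norm≤ : norm z ≤ ∣ z ∣ ^ 2
      norm≤ = ≤-trans (≤-reflexive norm≈) (Root.x≤root^n 1 (≤-respʳ-≈ norm≈ (norm-nonNegative z)))

    nonzero-moment : ℝ
    nonzero-moment = sum (F.nonzeroPoints d) (λ x → norm (T⁻.transform T⁻.one x) * norm (T⁻.transform T⁻.one x))

    -- The frequency 0, left out of the Salem norm, contributes exactly L⁴ to the full fourth
    -- moment.
    energy≈ : (L * L) * (L * L) + nonzero-moment ≈ Q * Λ
    energy≈ = begin-equality
      (L * L) * (L * L) + nonzero-moment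
        ≈⟨ +-cong (sym (trans (sift _≟ᵖ_ (F.points-isEnumeration d) origin f) (*-cong norm-0 norm-0)))
             (sum-filter _ (points d) f) ⟩
      sum (points d) (λ x → indicator (origin ≟ᵖ x) * f x) + sum (points d) (λ x → indicator (¬? (x ≟ᵖ origin)) * f x)
        ≈⟨ sum-distrib-+ (points d) _ _ ⟨
      sum (points d) (λ x → indicator (origin ≟ᵖ x) * f x + indicator (¬? (x ≟ᵖ origin)) * f x)
        ≈⟨ sum-cong (points d) (λ x → split x) ⟩
      sum (points d) f
        ≈⟨ T⁻.fourth-moment-one ⟩
      Q * Λ ∎
      where
      f : Point d → ℝ
      f x = norm (T⁻.transform T⁻.one x) * norm (T⁻.transform T⁻.one x)
      norm-0 : norm (T⁻.transform T⁻.one origin) ≈ L * L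
      norm-0 = norm-sum-1 E sum-E-1 λ y → ℂ-ring.trans (ℂ-ring.*-identityˡ _)
        (ℂ-ring.trans (χ-cong (≡.trans (≡.cong (F.- F.1# F.*_) (F.origin∙ y)) (F.zeroʳ _))) χ-0)
      split : ∀ x → indicator (origin ≟ᵖ x) * f x + indicator (¬? (x ≟ᵖ origin)) * f x ≈ f x
      split x = trans (sym (distribʳ (f x) _ _)) (trans (*-congʳ (total (x ≟ᵖ origin))) (*-identityˡ (f x)))
        where
        total : (p : Dec (x ≡ origin)) → indicator (origin ≟ᵖ x) + indicator (¬? p) ≈ 1#
        total (yes x≡0) = trans (+-congʳ (indicator-yes (origin ≟ᵖ x) (≡.sym x≡0))) (+-identityʳ 1#)
        total (no x≢0)  = trans (+-congʳ (indicator-no (origin ≟ᵖ x) (x≢0 ∘ ≡.sym))) (+-identityˡ 1#)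

    -- In the fourth power of the Salem condition the nonzero moment carries Q^(-5): four factors
    -- from the normalisation of `fourier` and one from the average over frequencies. The right side
    -- carries Q^(-4), so one factor Q remains.
    salem⇒energy≤ : ∀ {s C} → 0# < Q → 0# ≤ C → 0# ≤ power (length E) (1# - s) → IsSalem₄ X s C E →
      Q * Λ ≤ (L * L) * (L * L) + Q * (C ^ 4 * power (length E) (1# - s) ^ 4)
    salem⇒energy≤ {s} {C} 0<Q 0≤C 0≤pw salem = ≤-respˡ-≈ energy≈ (+-monoʳ-≤ _ (begin
      nonzero-moment
        ≈⟨ cancel ⟨
      Q ^ 5 * (i ^ 5 * nonzero-moment)
        ≤⟨ *-monoˡ-≤ (^-nonNegative 0≤Q 5) i⁵S≤ ⟩
      Q ^ 5 * (C * (i * pw)) ^ 4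
        ≈⟨ solve 4 (λ Q i C p → Q :^ 5 :* (C :* (i :* p)) :^ 4 := (Q :* i) :^ 4 :* (Q :* (C :^ 4 :* p :^ 4)))
             refl Q i C pw ⟩
      (Q * i) ^ 4 * (Q * (C ^ 4 * pw ^ 4))
        ≈⟨ *-congʳ (trans (^-congˡ 4 Qi≈1) (1^n≈1 4)) ⟩
      1# * (Q * (C ^ 4 * pw ^ 4))
        ≈⟨ *-identityˡ _ ⟩
      Q * (C ^ 4 * pw ^ 4) ∎))
      where
      i  = Q ⁻¹
      pw = power (length E) (1# - s)
      0≤i : 0# ≤ i
      0≤i = ⁻¹-nonNegative 0<Q
      Qi≈1 : Q * i ≈ 1#
      Qi≈1 = ⁻¹-inverseʳ Q (0<⇒≉0 0<Q)
      cancel : Q ^ 5 * (i ^ 5 * nonzero-moment) ≈ nonzero-moment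
      cancel = begin-equality
        Q ^ 5 * (i ^ 5 * nonzero-moment)   ≈⟨ *-assoc _ _ _ ⟨
        Q ^ 5 * i ^ 5 * nonzero-moment     ≈⟨ *-congʳ (^-distrib-* Q i 5) ⟨
        (Q * i) ^ 5 * nonzero-moment       ≈⟨ *-congʳ (trans (^-congˡ 5 Qi≈1) (1^n≈1 5)) ⟩
        1# * nonzero-moment                ≈⟨ *-identityˡ _ ⟩
        nonzero-moment                     ∎
      Y = i * ∑ (F.nonzeroPoints d) (λ x → ∣ fourier X E x ∣ ^ 4)
      norm-fourier : ∀ x → norm (fourier X E x) ≈ (i * i) * norm (T⁻.transform T⁻.one x)
      norm-fourier x = trans (norm-cong (fourier-transform x)) (trans (norm-* _ _) (*-congʳ (norm-ofReal i)))
      i⁵S≤Y : i ^ 5 * nonzero-moment ≤ Y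
      i⁵S≤Y = begin
        i ^ 5 * nonzero-moment
          ≈⟨ solve 2 (λ i S → i :^ 5 :* S := i :* (((i :* i) :* (i :* i)) :* S)) refl i nonzero-moment ⟩
        i * (((i * i) * (i * i)) * nonzero-moment)
          ≈⟨ *-congˡ (*-distribˡ-sum (F.nonzeroPoints d) _ _) ⟩
        i * sum (F.nonzeroPoints d) (λ x → ((i * i) * (i * i)) * (norm (T⁻.transform T⁻.one x) * norm (T⁻.transform T⁻.one x)))
          ≈⟨ *-congˡ (sum-cong (F.nonzeroPoints d) λ x → trans (square-product (i * i) (norm (T⁻.transform T⁻.one x)))
               (sym (*-cong (norm-fourier x) (norm-fourier x)))) ⟩
        i * sum (F.nonzeroPoints d) (λ x → norm (fourier X E x) * norm (fourier X E x))
          ≤⟨ *-monoˡ-≤ 0≤i (sum-mono-≤ (F.nonzeroPoints d) λ x → norm²≤∣∣⁴ (fourier X E x)) ⟩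
        Y ∎
        where
        square-product : ∀ a b → (a * a) * (b * b) ≈ (a * b) * (a * b)
        square-product = solve 2 (λ a b → (a :* a) :* (b :* b) := (a :* b) :* (a :* b)) refl
      0≤Y : 0# ≤ Y
      0≤Y = ≤-trans (*-nonNegative (^-nonNegative 0≤i 5)
        (sum-nonNegative (F.nonzeroPoints d) λ x → 0≤x*x (norm (T⁻.transform T⁻.one x)))) i⁵S≤Y
      i⁵S≤ : i ^ 5 * nonzero-moment ≤ (C * (i * pw)) ^ 4
      i⁵S≤ = begin
        i ^ 5 * nonzero-moment   ≤⟨ i⁵S≤Y ⟩
        Y                        ≤⟨ Root.x≤root^n 3 0≤Y ⟩
        root 4 Y ^ 4             ≤⟨ ^-monoˡ-≤ (Root.root-nonNegative 3 0≤Y) salem 4 ⟩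
        (C * (i * pw)) ^ 4       ∎

-- Spheres, and the number of distances

module Spheres (R : CompleteOrderedField) {q : ℕ} (F : FiniteField q) where
  open OrderedField R
  open RealSums R
  open ≤-Reasoning
  private module F where
    open FiniteField F public
    open FieldProperties F public
  open F using (Point; points; elements; ‖_‖)

  sum-points-1 : ∀ d → sum (points d) (λ _ → 1#) ≈ fromℕ q ^ d
  sum-points-1 zero    = +-identityʳ 1#
  sum-points-1 (suc d) = begin-equality
    sum (points (suc d)) (λ _ → 1#)                    ≈⟨ sum-cartesianProductWith _∷_ elements (points d) _ ⟩
    sum elements (λ _ → sum (points d) (λ _ → 1#))     ≈⟨ sum-const elements _ ⟩
    fromℕ (length elements) * sum (points d) (λ _ → 1#) ≈⟨ *-cong (reflexive (≡.cong fromℕ F.length-elements)) (sum-points-1 d) ⟩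
    fromℕ q * fromℕ q ^ d                              ∎

  -- Given one solution b, every solution is b or -b. If the two coincide, the bound merely counts
  -- it twice.
  square-solutions : ∀ s t → sum elements (λ a → indicator ((a F.* a F.+ s) F.≟ t)) ≤ 1# + 1#
  square-solutions s t = by-cases (any? (λ a → (a F.* a F.+ s) F.≟ t) elements)
    where
    Solution : F.Carrier → Set
    Solution a = a F.* a F.+ s ≡ t
    0≤2 : 0# ≤ 1# + 1#
    0≤2 = +-nonNegative 0≤1 0≤1
    by-cases : Dec (Any Solution elements) →
      sum elements (λ a → indicator ((a F.* a F.+ s) F.≟ t)) ≤ 1# + 1#
    by-cases (no ∄) = begin
      sum elements (λ a → indicator ((a F.* a F.+ s) F.≟ t))
        ≤⟨ sum-mono-∈ elements (λ a a∈ → ≤-reflexive (indicator-no ((a F.* a F.+ s) F.≟ t) λ sol →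
             ∄ (lose a∈ sol))) ⟩
      sum elements (λ _ → 0#)   ≈⟨ sum-zero elements ⟩
      0#                        ≤⟨ 0≤2 ⟩
      1# + 1#                   ∎
    by-cases (yes ∃b) = begin
      sum elements (λ a → indicator ((a F.* a F.+ s) F.≟ t))
        ≤⟨ sum-mono-≤ elements (λ a → bound a ((a F.* a F.+ s) F.≟ t)) ⟩
      sum elements (λ a → indicator (b F.≟ a) + indicator ((F.- b) F.≟ a))
        ≈⟨ sum-distrib-+ elements _ _ ⟩
      sum elements (λ a → indicator (b F.≟ a)) + sum elements (λ a → indicator ((F.- b) F.≟ a))
        ≈⟨ +-cong (sum-indicator F._≟_ F.elements-isEnumeration b) (sum-indicator F._≟_ F.elements-isEnumeration (F.- b)) ⟩
      1# + 1# ∎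
      where
      b = proj₁ (satisfied ∃b)
      bound : ∀ a (p : Dec (Solution a)) → indicator p ≤ indicator (b F.≟ a) + indicator ((F.- b) F.≟ a)
      bound a (no _)    = +-nonNegative (indicator-nonNegative (b F.≟ a)) (indicator-nonNegative ((F.- b) F.≟ a))
      bound a (yes sol) = [ (λ a≡b → begin
            1#                          ≈⟨ indicator-yes (b F.≟ a) (≡.sym a≡b) ⟨
            indicator (b F.≟ a)         ≤⟨ x≤x+y (indicator-nonNegative ((F.- b) F.≟ a)) ⟩
            _                           ∎)
        , (λ a≡-b → begin
            1#                          ≈⟨ indicator-yes ((F.- b) F.≟ a) (≡.sym a≡-b) ⟨
            indicator ((F.- b) F.≟ a)   ≤⟨ x≤x+y (indicator-nonNegative (b F.≟ a)) ⟩
            indicator ((F.- b) F.≟ a) + indicator (b F.≟ a) ≈⟨ +-comm _ _ ⟩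
            _                           ∎)
        ]′ (F.square-roots (F.+-cancelʳ s (≡.trans sol (≡.sym (proj₂ (satisfied ∃b))))))

  -- Fixing all coordinates but the first leaves an equation for the square of the first.
  sphere-size : ∀ d t → sum (points (suc d)) (λ x → indicator (‖ x ‖ F.≟ t)) ≤ (1# + 1#) * fromℕ q ^ d
  sphere-size d t = begin
    sum (points (suc d)) (λ x → indicator (‖ x ‖ F.≟ t))
      ≈⟨ sum-cartesianProductWith _∷_ elements (points d) _ ⟩
    sum elements (λ a → sum (points d) (λ x → indicator ((a F.* a F.+ ‖ x ‖) F.≟ t)))
      ≈⟨ sum-swap elements (points d) _ ⟩
    sum (points d) (λ x → sum elements (λ a → indicator ((a F.* a F.+ ‖ x ‖) F.≟ t)))
      ≤⟨ sum-mono-≤ (points d) (λ x → square-solutions ‖ x ‖ t) ⟩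
    sum (points d) (λ _ → 1# + 1#)
      ≈⟨ sum-cong (points d) (λ _ → *-identityʳ _) ⟨
    sum (points d) (λ _ → (1# + 1#) * 1#)
      ≈⟨ *-distribˡ-sum (points d) (1# + 1#) _ ⟨
    (1# + 1#) * sum (points d) (λ _ → 1#)
      ≈⟨ *-congˡ (sum-points-1 d) ⟩
    (1# + 1#) * fromℕ q ^ d ∎

-- From the energy to the number of distances

module Counting (R : CompleteOrderedField) {q : ℕ} (F : FiniteField q)
  {d : ℕ} (E : List (FiniteField.Point F (suc d))) where
  open OrderedField R
  open RealSums R
  open Complex R
  open Spheres R F
  open ≤-Reasoning
  private module F where
    open FiniteField F public
    open FieldProperties F public
  open F using (Point; points; elements; ‖_‖)
  open Energy R F E
  open Distances R F E

  -- ν t is the sum of `r` over the sphere of radius t. Cauchy-Schwarz on that sphere costs its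
  -- size.
  ν²≤ : ∀ t → ν t * ν t ≤ ((1# + 1#) * fromℕ q ^ d) *
    sum (points (suc d)) (λ w → indicator (‖ w ‖ F.≟ t) * (r w * r w))
  ν²≤ t = begin
    ν t * ν t
      ≈⟨ *-cong ν≈ ν≈ ⟩
    sum (points (suc d)) (λ w → r w * indicator (‖ w ‖ F.≟ t)) * sum (points (suc d)) (λ w → r w * indicator (‖ w ‖ F.≟ t))
      ≤⟨ cauchy-schwarz (points (suc d)) (λ w → indicator-nonNegative (‖ w ‖ F.≟ t))
           (λ w → term-nonNegative w) (λ w → ≤-reflexive (rearrange (r w) (indicator (‖ w ‖ F.≟ t)))) ⟩
    sum (points (suc d)) (λ w → indicator (‖ w ‖ F.≟ t)) * sum (points (suc d)) (λ w → indicator (‖ w ‖ F.≟ t) * (r w * r w))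
      ≤⟨ *-monoʳ-≤ (sum-nonNegative (points (suc d)) term-nonNegative) (sphere-size d t) ⟩
    ((1# + 1#) * fromℕ q ^ d) * sum (points (suc d)) (λ w → indicator (‖ w ‖ F.≟ t) * (r w * r w)) ∎
    where
    ν≈ : ν t ≈ sum (points (suc d)) (λ w → r w * indicator (‖ w ‖ F.≟ t))
    ν≈ = sum-δ (λ w → indicator (‖ w ‖ F.≟ t))
    term-nonNegative : ∀ w → 0# ≤ indicator (‖ w ‖ F.≟ t) * (r w * r w)
    term-nonNegative w = *-nonNegative (indicator-nonNegative (‖ w ‖ F.≟ t)) (0≤x*x (r w))
    rearrange : ∀ r i → (r * i) * (r * i) ≈ i * (i * (r * r))
    rearrange = solve 2 (λ r i → (r :* i) :* (r :* i) := i :* (i :* (r :* r))) refl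

  -- Each w lies on exactly one sphere, so the second moments of `r` over the spheres add up to Λ.
  M≤ : M ≤ ((1# + 1#) * fromℕ q ^ d) * Λ
  M≤ = begin
    M
      ≤⟨ sum-mono-≤ elements ν²≤ ⟩
    sum elements (λ t → ((1# + 1#) * fromℕ q ^ d) * sum (points (suc d)) (λ w → indicator (‖ w ‖ F.≟ t) * (r w * r w)))
      ≈⟨ *-distribˡ-sum elements _ _ ⟨
    ((1# + 1#) * fromℕ q ^ d) * sum elements (λ t → sum (points (suc d)) (λ w → indicator (‖ w ‖ F.≟ t) * (r w * r w)))
      ≈⟨ *-congˡ (sum-swap elements (points (suc d)) _) ⟩
    ((1# + 1#) * fromℕ q ^ d) * sum (points (suc d)) (λ w → sum elements (λ t → indicator (‖ w ‖ F.≟ t) * (r w * r w)))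
      ≈⟨ *-congˡ (sum-cong (points (suc d)) λ w → sift F._≟_ F.elements-isEnumeration ‖ w ‖ (λ _ → r w * r w)) ⟩
    ((1# + 1#) * fromℕ q ^ d) * Λ ∎

  0<fromℕ-q : 0# < fromℕ q
  0<fromℕ-q = 1≤⇒0< (≤-respˡ-≈ (+-identityʳ 1#) (fromℕ-mono-≤ F.0<q))

  0<Q : 0# < Q
  0<Q = ^-positive 0<fromℕ-q (suc d)

  L⁴ : ℝ
  L⁴ = (L * L) * (L * L)

  -- P will be |E|^(4-4s), K will be 1 + C⁴, and H is the constant in the bounds for B(j). Writing
  -- C⁴ as K - 1 lets both cases absorb the two terms of `energy` into a single factor K.
  module _ (X : AdditiveCharacter F) {P K H : ℝ} (0≤P : 0# ≤ P) (1≤K : 1# ≤ K) (0≤H : 0# ≤ H) (0<L : 0# < L)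
    (energy : Q * Λ ≤ L⁴ + Q * ((K - 1#) * P)) where
    open CharacterSums X

    private
      0≤K : 0# ≤ K
      0≤K = ≤-trans 0≤1 1≤K

      0<L⁴ : 0# < L⁴
      0<L⁴ = *-positive (*-positive 0<L 0<L) (*-positive 0<L 0<L)

      0≤K-1 : 0# ≤ K - 1#
      0≤K-1 = 0≤y-x 1≤K

      constant : ℝ
      constant = (K + K) + (1# + H)

      2K≤constant : K + K ≤ constant
      2K≤constant = x≤x+y (+-nonNegative 0≤1 0≤H)

      1+H≤constant : 1# + H ≤ constant
      1+H≤constant = ≤-respʳ-≈ (+-comm _ _) (x≤x+y (+-nonNegative 0≤K 0≤K))

      qM≤-large : Q * P ≤ L⁴ → fromℕ q * M ≤ (K + K) * L⁴
      qM≤-large QP≤L⁴ = begin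
        fromℕ q * M                                     ≤⟨ *-monoˡ-≤ (<⇒≤ 0<fromℕ-q) M≤ ⟩
        fromℕ q * (((1# + 1#) * fromℕ q ^ d) * Λ)
          ≈⟨ solve 3 (λ q p Λ → q :* (((:1 :+ :1) :* p) :* Λ) := (q :* p) :* Λ :+ (q :* p) :* Λ) refl (fromℕ q) (fromℕ q ^ d) Λ ⟩
        Q * Λ + Q * Λ                                   ≤⟨ +-mono-≤ QΛ≤ QΛ≤ ⟩
        K * L⁴ + K * L⁴                                 ≈⟨ distribʳ L⁴ K K ⟨
        (K + K) * L⁴                                    ∎
        where
        QΛ≤ : Q * Λ ≤ K * L⁴
        QΛ≤ = begin
          Q * Λ                       ≤⟨ energy ⟩
          L⁴ + Q * ((K - 1#) * P)     ≈⟨ solve 4 (λ l Q K P → l :+ Q :* ((K :- :1) :* P) := l :+ (K :- :1) :* (Q :* P)) refl L⁴ Q K P ⟩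
          L⁴ + (K - 1#) * (Q * P)     ≤⟨ +-monoʳ-≤ L⁴ (*-monoˡ-≤ 0≤K-1 QP≤L⁴) ⟩
          L⁴ + (K - 1#) * L⁴          ≈⟨ solve 2 (λ l K → l :+ (K :- :1) :* l := K :* l) refl L⁴ K ⟩
          K * L⁴                      ∎

      Λ≤-small : L⁴ ≤ Q * P → Λ ≤ K * P
      Λ≤-small L⁴≤QP = *-cancelˡ-≤ 0<Q (begin
        Q * Λ                          ≤⟨ energy ⟩
        L⁴ + Q * ((K - 1#) * P)        ≤⟨ +-monoˡ-≤ _ L⁴≤QP ⟩
        Q * P + Q * ((K - 1#) * P)     ≈⟨ solve 3 (λ Q K P → Q :* P :+ Q :* ((K :- :1) :* P) := Q :* (K :* P)) refl Q K P ⟩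
        Q * (K * P)                    ∎)

      -- The term j = 0 is L⁴. The share h = H L⁴ / q, which bounds each of the others, is granted
      -- to all q terms, which amounts to H L⁴.
      qM≤-small : (∀ j → j ≢ F.0# → fromℕ q * norm (B j) ≤ H * L⁴) → fromℕ q * M ≤ (1# + H) * L⁴
      qM≤-small B≤ = begin
        fromℕ q * M                            ≈⟨ second-moment ⟨
        sum elements (λ j → norm (B j))        ≤⟨ sum-mono-≤ elements (λ j → bound j (F.0# F.≟ j)) ⟩
        sum elements (λ j → indicator (F.0# F.≟ j) * L⁴ + h)
          ≈⟨ sum-distrib-+ elements _ _ ⟩
        sum elements (λ j → indicator (F.0# F.≟ j) * L⁴) + sum elements (λ _ → h)
          ≈⟨ +-cong (sift F._≟_ F.elements-isEnumeration F.0# (λ _ → L⁴))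
               (trans (sum-const elements h) (*-congʳ (reflexive (≡.cong fromℕ F.length-elements)))) ⟩
        L⁴ + fromℕ q * h                       ≈⟨ +-congˡ (trans (*-comm _ _) (÷-*-cancel (H * L⁴) (0<⇒≉0 0<fromℕ-q))) ⟩
        L⁴ + H * L⁴                            ≈⟨ solve 2 (λ l H → l :+ H :* l := (:1 :+ H) :* l) refl L⁴ H ⟩
        (1# + H) * L⁴                          ∎
        where
        h = H * L⁴ ÷ fromℕ q
        0≤h : 0# ≤ h
        0≤h = *-nonNegative (*-nonNegative 0≤H (<⇒≤ 0<L⁴)) (⁻¹-nonNegative 0<fromℕ-q)
        bound : ∀ j (p : Dec (F.0# ≡ j)) → norm (B j) ≤ indicator p * L⁴ + h
        bound j (yes ≡.refl) = begin
          norm (B F.0#)    ≈⟨ norm-B-0 ⟩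
          L⁴               ≈⟨ *-identityˡ L⁴ ⟨
          1# * L⁴          ≤⟨ x≤x+y 0≤h ⟩
          1# * L⁴ + h      ∎
        bound j (no 0≢j) = begin
          norm (B j)       ≤⟨ *-cancelˡ-≤ 0<fromℕ-q (≤-respʳ-≈ (sym (trans (*-comm _ _) (÷-*-cancel (H * L⁴) (0<⇒≉0 0<fromℕ-q))))
                                (B≤ j (0≢j ∘ ≡.sym))) ⟩
          h                ≈⟨ trans (+-congʳ (zeroˡ L⁴)) (+-identityˡ h) ⟨
          0# * L⁴ + h      ∎

    -- The exponential sums are consulted only when `L⁴ ≤ Q * P`, hence their bound may presuppose Λ
    -- ≤ K P. The constant is the sum of those of the two cases, 2K and 1 + H.
    distances-bound : (Λ ≤ K * P → ∀ j → j ≢ F.0# → fromℕ q * norm (B j) ≤ H * L⁴) →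
      ((K + K) + (1# + H)) ⁻¹ * fromℕ q ≤ fromℕ (length (F.Δ E))
    distances-bound B≤ = ≤-respˡ-≈ (*-comm _ _) (x≤y*z⇒x*y⁻¹≤z 0<constant (*-cancelˡ-≤ 0<L⁴ (begin
      L⁴ * fromℕ q                                   ≤⟨ *-monoʳ-≤ (<⇒≤ 0<fromℕ-q) L⁴≤Δ*M ⟩
      fromℕ (length (F.Δ E)) * M * fromℕ q           ≈⟨ solve 3 (λ D M q → D :* M :* q := D :* (q :* M)) refl _ M (fromℕ q) ⟩
      fromℕ (length (F.Δ E)) * (fromℕ q * M)         ≤⟨ *-monoˡ-≤ (fromℕ-nonNegative (length (F.Δ E))) qM≤ ⟩
      fromℕ (length (F.Δ E)) * (constant * L⁴)       ≈⟨ solve 3 (λ D k l → D :* (k :* l) := l :* (k :* D)) refl _ constant L⁴ ⟩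
      L⁴ * (constant * fromℕ (length (F.Δ E)))       ∎)))
      where
      0<constant : 0# < constant
      0<constant = begin-strict
        0#         <⟨ 0<1 ⟩
        1#         ≤⟨ x≤x+y 0≤H ⟩
        1# + H     ≤⟨ 1+H≤constant ⟩
        constant   ∎
      qM≤ : fromℕ q * M ≤ constant * L⁴
      qM≤ = [ (λ QP≤L⁴ → ≤-trans (qM≤-large QP≤L⁴) (*-monoʳ-≤ (<⇒≤ 0<L⁴) 2K≤constant))
            , (λ L⁴≤QP → ≤-trans (qM≤-small (B≤ (Λ≤-small L⁴≤QP))) (*-monoʳ-≤ (<⇒≤ 0<L⁴) 1+H≤constant))
            ]′ (≤-total (Q * P) L⁴)

-- Thresholds

module Thresholds (R : CompleteOrderedField) where
  open OrderedField R
  open Powers R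
  open Complex R using (norm; norm-nonNegative)
  open ≤-Reasoning

  -- N stands for |B(j)|², p for |E|^(1-s), and g for the loss caused by the constant in |E| ≫ q^a.
  module _ {q Q L N Λ p K g : ℝ} (0≤q : 0# ≤ q) (0≤Q : 0# ≤ Q) (0≤L : 0# ≤ L) (0≤Λ : 0# ≤ Λ)
    (1≤K : 1# ≤ K) (1≤g : 1# ≤ g) (Λ≤ : Λ ≤ K * p ^ 4) where
    private
      L⁴ = (L * L) * (L * L)
      0≤K = ≤-trans 0≤1 1≤K
      0≤g = ≤-trans 0≤1 1≤g
      0≤L⁴ : 0# ≤ L⁴
      0≤L⁴ = 0≤x*x (L * L)

      x≤y*x : ∀ {x y} → 1# ≤ y → 0# ≤ x → x ≤ y * x
      x≤y*x 1≤y 0≤x = ≤-respˡ-≈ (*-identityˡ _) (*-monoʳ-≤ 0≤x 1≤y)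

      1≤x*y : ∀ {x y} → 1# ≤ x → 1# ≤ y → 1# ≤ x * y
      1≤x*y 1≤x 1≤y = ≤-trans 1≤y (x≤y*x 1≤x (≤-trans 0≤1 1≤y))

    qN≤-from-square : N * N ≤ (L * L) * (L * (Q * Λ)) → p ^ 4 * (Q * q ^ 2) ≤ g * L ^ 5 →
      q * N ≤ (K * g) * L⁴
    qN≤-from-square N²≤ P≤ = square-cancel-≤ (*-nonNegative 0≤H 0≤L⁴) (begin
      (q * N) * (q * N)
        ≈⟨ solve 2 (λ q N → (q :* N) :* (q :* N) := (q :* q) :* (N :* N)) refl q N ⟩
      (q * q) * (N * N)
        ≤⟨ *-monoˡ-≤ (0≤x*x q) N²≤ ⟩
      (q * q) * ((L * L) * (L * (Q * Λ)))
        ≤⟨ *-monoˡ-≤ (0≤x*x q) (*-monoˡ-≤ (0≤x*x L) (*-monoˡ-≤ 0≤L (*-monoˡ-≤ 0≤Q Λ≤))) ⟩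
      (q * q) * ((L * L) * (L * (Q * (K * p ^ 4))))
        ≈⟨ solve 5 (λ q L Q K P → (q :* q) :* ((L :* L) :* (L :* (Q :* (K :* P))))
             := (K :* ((L :* L) :* L)) :* (P :* (Q :* q :^ 2))) refl q L Q K (p ^ 4) ⟩
      (K * ((L * L) * L)) * (p ^ 4 * (Q * q ^ 2))
        ≤⟨ *-monoˡ-≤ (*-nonNegative 0≤K (*-nonNegative (0≤x*x L) 0≤L)) P≤ ⟩
      (K * ((L * L) * L)) * (g * L ^ 5)
        ≈⟨ solve 3 (λ K L g → (K :* ((L :* L) :* L)) :* (g :* L :^ 5)
             := (K :* g) :* (((L :* L) :* (L :* L)) :* ((L :* L) :* (L :* L)))) refl K L g ⟩
      H * (L⁴ * L⁴)
        ≤⟨ x≤y*x (1≤x*y 1≤K 1≤g) (*-nonNegative 0≤H (0≤x*x L⁴)) ⟩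
      H * (H * (L⁴ * L⁴))
        ≈⟨ solve 2 (λ H l → H :* (H :* (l :* l)) := (H :* l) :* (H :* l)) refl H L⁴ ⟩
      (H * L⁴) * (H * L⁴) ∎)
      where
      H = K * g
      0≤H : 0# ≤ H
      0≤H = *-nonNegative 0≤K 0≤g

    qN≤-from-fourth : (N * N) * (N * N) ≤ L⁴ * (L⁴ * (Λ * (Q * Λ))) → p ^ 8 * (Q * q ^ 4) ≤ g * L ^ 8 →
      q * N ≤ ((K * K) * g) * L⁴
    qN≤-from-fourth N⁴≤ P≤ = square-cancel-≤ (*-nonNegative 0≤H 0≤L⁴) (square-cancel-≤ (0≤x*x (H * L⁴)) (begin
      ((q * N) * (q * N)) * ((q * N) * (q * N))
        ≈⟨ solve 2 (λ q N → ((q :* N) :* (q :* N)) :* ((q :* N) :* (q :* N))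
             := ((q :* q) :* (q :* q)) :* ((N :* N) :* (N :* N))) refl q N ⟩
      ((q * q) * (q * q)) * ((N * N) * (N * N))
        ≤⟨ *-monoˡ-≤ (0≤x*x (q * q)) N⁴≤ ⟩
      ((q * q) * (q * q)) * (L⁴ * (L⁴ * (Λ * (Q * Λ))))
        ≤⟨ *-monoˡ-≤ (0≤x*x (q * q)) (*-monoˡ-≤ 0≤L⁴ (*-monoˡ-≤ 0≤L⁴
             (*-mono-≤ 0≤Λ (*-nonNegative 0≤Q 0≤Λ) Λ≤ (*-monoˡ-≤ 0≤Q Λ≤)))) ⟩
      ((q * q) * (q * q)) * (L⁴ * (L⁴ * ((K * p ^ 4) * (Q * (K * p ^ 4)))))
        ≈⟨ solve 5 (λ q l Q K p → ((q :* q) :* (q :* q)) :* (l :* (l :* ((K :* p :^ 4) :* (Q :* (K :* p :^ 4)))))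
             := ((K :* K) :* (l :* l)) :* (p :^ 8 :* (Q :* q :^ 4))) refl q L⁴ Q K p ⟩
      ((K * K) * (L⁴ * L⁴)) * (p ^ 8 * (Q * q ^ 4))
        ≤⟨ *-monoˡ-≤ (*-nonNegative (0≤x*x K) (0≤x*x L⁴)) P≤ ⟩
      ((K * K) * (L⁴ * L⁴)) * (g * L ^ 8)
        ≈⟨ solve 4 (λ K l g L → ((K :* K) :* (l :* l)) :* (g :* L :^ 8)
             := ((K :* K) :* g) :* ((l :* l) :* (((L :* L) :* (L :* L)) :* ((L :* L) :* (L :* L))))) refl K L⁴ g L ⟩
      H * L¹⁶
        -- Again H ≥ 1 is used, here to raise H to H⁴ and thus complete a fourth power.
        ≤⟨ x≤y*x 1≤H (*-nonNegative 0≤H 0≤L¹⁶) ⟩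
      H * (H * L¹⁶)
        ≤⟨ x≤y*x (1≤x*y 1≤H 1≤H) (*-nonNegative 0≤H (*-nonNegative 0≤H 0≤L¹⁶)) ⟩
      (H * H) * (H * (H * L¹⁶))
        ≈⟨ solve 2 (λ H l → (H :* H) :* (H :* (H :* ((l :* l) :* (l :* l))))
             := ((H :* l) :* (H :* l)) :* ((H :* l) :* (H :* l))) refl H L⁴ ⟩
      ((H * L⁴) * (H * L⁴)) * ((H * L⁴) * (H * L⁴)) ∎))
      where
      H = (K * K) * g
      1≤H : 1# ≤ H
      1≤H = 1≤x*y (1≤x*y 1≤K 1≤K) 1≤g
      0≤H : 0# ≤ H
      0≤H = ≤-trans 0≤1 1≤H
      L¹⁶ = (L⁴ * L⁴) * (L⁴ * L⁴)
      0≤L¹⁶ : 0# ≤ L¹⁶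
      0≤L¹⁶ = 0≤x*x (L⁴ * L⁴)

  -- The condition p^(u+1) q^(D+1) ≪ |E|^w with p = |E|^(1-s) reads |E|^e ≫ q^(D+1), so the
  -- threshold satisfies a e = D + 1. From 1 ≤ e ≤ D + 1 follow 1 ≤ a ≤ D + 1, the range in which
  -- `power q a` is under control.
  module _ {d : ℕ} {s a : ℝ} (0≤s : 0# ≤ s) (2s≤1 : s * fromℕ 2 ≤ 1#) (u w D : ℕ)
    (1≤e : 1# ≤ fromℕ w - fromℕ (suc u) * (1# - s))
    (e≤D : fromℕ w - fromℕ (suc u) * (1# - s) ≤ fromℕ (suc D))
    (ae≈D : a * (fromℕ w - fromℕ (suc u) * (1# - s)) ≈ fromℕ (suc D)) where
    private
      e = fromℕ w - fromℕ (suc u) * (1# - s)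
      x = 1# - s

      1≤a : 1# ≤ a
      1≤a = *-cancelʳ-≤ (1≤⇒0< 1≤e) (begin
        1# * e          ≈⟨ *-identityˡ e ⟩
        e               ≤⟨ e≤D ⟩
        fromℕ (suc D)   ≈⟨ ae≈D ⟨
        a * e           ∎)

      a≤D : a ≤ fromℕ (suc D)
      a≤D = begin
        a               ≈⟨ *-identityʳ a ⟨
        a * 1#          ≤⟨ *-monoˡ-≤ (≤-trans 0≤1 1≤a) 1≤e ⟩
        a * e           ≈⟨ ae≈D ⟩
        fromℕ (suc D)   ∎

      x≤1 : x ≤ 1#
      x≤1 = ≤-respʳ-≈ (x-y+y≈x 1# s) (x≤x+y 0≤s)

      1≤2x : 1# ≤ x * fromℕ 2
      1≤2x = begin
        1#                          ≈⟨ x-y+y≈x 1# (s * fromℕ 2) ⟨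
        (1# - s * fromℕ 2) + s * fromℕ 2 ≤⟨ +-monoʳ-≤ _ 2s≤1 ⟩
        (1# - s * fromℕ 2) + 1#     ≈⟨ solve 1 (λ s → (:1 :- s :* :fromℕ 2) :+ :1 := (:1 :- s) :* :fromℕ 2) refl s ⟩
        x * fromℕ 2                 ∎

    0<threshold : 0# < a
    0<threshold = 1≤⇒0< 1≤a

    -- The ingredient in which the two thresholds differ: a bound for B(j), j ≠ 0, whose constant H
    -- is uniform in the field, the character and E.
    SmallSums : ℝ → ℝ → ℝ → Set (lsuc 0ℓ)
    SmallSums K g H = ∀ {q} (F : FiniteField q) → ¬ (2 ∣ q) → (X : AdditiveCharacter F) →
      let open FiniteField F using (Point) in
      (E : List (Point (suc d))) → Unique E →
      let open Energy R F E
          open Distances.CharacterSums R F E X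
          p = power (length E) x
      in p ^ suc u * fromℕ q ^ suc D ≤ g * fromℕ (length E) ^ w →
         Λ ≤ K * p ^ 4 → ∀ j → j ≢ FiniteField.0# F →
         fromℕ q * norm (B j) ≤ H * ((L * L) * (L * L))

    admissible : (∀ {K g} → 1# ≤ K → 1# ≤ g → ∃ λ H → 0# ≤ H × SmallSums K g H) →
      Admissible (suc d) s a
    admissible small C c 0<C 0<c = constant ⁻¹ , ⁻¹-positive 0<constant , λ {q} F 2∤q X E E! salem cqᵃ≤L →
      let module E  = Energy R F E
          module CE = Counting R F E
          module SE = Distances.CharacterSums R F E X
          p = power (length E) x
          1≤q = ≤-respˡ-≈ (+-identityʳ 1#) (fromℕ-mono-≤ (FieldProperties.0<q F))
          1≤L , transfer = power-transfer {q} {length E} {c₁} {x} {a} u w D (suc D) 1≤q 0<c₁ c₁≤1 x≤1 1≤2x 1≤a a≤D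
            (1≤⇒0< 1≤e) (≤-reflexive (sym ae≈D)) (≤-trans (*-monoʳ-≤ (0≤power {q} 1≤q) c₁≤c) cqᵃ≤L)
          0≤p = Power.power-nonNegative (length E) 1≤L {x} {1} (≤-respʳ-≈ (sym (+-identityʳ 1#)) x≤1) 1≤2x
          energy = SE.salem⇒energy≤ {s} {C} CE.0<Q (<⇒≤ 0<C) 0≤p salem
      in CE.distances-bound X {p ^ 4} {K} {H} (^-nonNegative 0≤p 4) 1≤K 0≤H (1≤⇒0< 1≤L)
           (≤-respʳ-≈ (+-congˡ (*-congˡ (*-congʳ K-1))) energy)
           (H-small F 2∤q X E E! (drop-c {p ^ suc u} {fromℕ q ^ suc D} {fromℕ (length E) ^ w} transfer))
      where
      -- `power-transfer` asks for a constant at most 1. Lowering c only weakens the hypothesis on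
      -- |E|.
      minimum = common-lower-bound 0<c 0<1
      c₁ = proj₁ minimum
      0<c₁ : 0# < c₁
      0<c₁ = proj₁ (proj₂ minimum)
      c₁≤c : c₁ ≤ c
      c₁≤c = proj₁ (proj₂ (proj₂ minimum))
      c₁≤1 : c₁ ≤ 1#
      c₁≤1 = proj₂ (proj₂ (proj₂ minimum))
      K = 1# + C ^ 4
      -- The factor c₁^w on the left of `power-transfer`, moved to the right.
      g = (c₁ ^ w) ⁻¹
      0<c₁^w = ^-positive 0<c₁ w
      1≤K : 1# ≤ K
      1≤K = x≤x+y (^-nonNegative (<⇒≤ 0<C) 4)
      K-1 : C ^ 4 ≈ K - 1#
      K-1 = trans (sym (x+y-y≈x (C ^ 4) 1#)) (+-congʳ (+-comm _ _))
      1≤g : 1# ≤ g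
      1≤g = ≤-respʳ-≈ (*-identityˡ g) (x*z≤y⇒x≤y*z⁻¹ 0<c₁^w (≤-trans (≤-reflexive (*-identityˡ _))
        (≤-respʳ-≈ (1^n≈1 w) (^-monoˡ-≤ (<⇒≤ 0<c₁) c₁≤1 w))))
      chosen = small 1≤K 1≤g
      H = proj₁ chosen
      0≤H : 0# ≤ H
      0≤H = proj₁ (proj₂ chosen)
      H-small : SmallSums K g H
      H-small = proj₂ (proj₂ chosen)
      constant = (K + K) + (1# + H)
      0<constant : 0# < constant
      0<constant = +-positiveˡ (+-positiveˡ (1≤⇒0< 1≤K) (≤-trans 0≤1 1≤K)) (+-nonNegative 0≤1 0≤H)
      0≤power : ∀ {q} → 1# ≤ fromℕ q → 0# ≤ power q a
      0≤power {q} 1≤q = Power.power-nonNegative q 1≤q {a} {suc D} a≤D (begin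
        1#            ≤⟨ 1≤fromℕ-suc 1 ⟩
        fromℕ 2       ≈⟨ *-identityˡ _ ⟨
        1# * fromℕ 2  ≤⟨ *-monoʳ-≤ (fromℕ-nonNegative 2) 1≤a ⟩
        a * fromℕ 2   ∎)
      drop-c : ∀ {x y z} → x * (y * c₁ ^ w) ≤ z → x * y ≤ g * z
      drop-c h = ≤-respʳ-≈ (*-comm _ _) (x*z≤y⇒x≤y*z⁻¹ 0<c₁^w (≤-respˡ-≈ (sym (*-assoc _ _ _)) h))

  -- That -b belongs to the set concerns the exponent -(-b), which is only `≈` to b; hence the
  -- quantification over a. The set consists of negatives of positive exponents, so 0 bounds it.
  inf≤ : ∀ {d s b} → (∀ {a} → a ≈ b → 0# < a × Admissible d s a) → α₄⟨ d , s ⟩≤ b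
  inf≤ {d} {s} {b} h = ≤-respʳ-≈ (-‿involutive b) (neg-antitone-≤ (sup-upper P (_ , -b∈P) bounded (- b) -b∈P)) ,
    proj₂ (h refl)
    where
    P : Pred ℝ (lsuc 0ℓ)
    P x = 0# < - x × Admissible d s (- x)
    -b∈P : P (- b)
    -b∈P = h (-‿involutive b)
    bounded : ∃ (IsUpperBound P)
    bounded = 0# , λ x (0<-x , _) → ≤-respˡ-≈ (-‿involutive x) (≤-respʳ-≈ -0#≈0# (neg-antitone-≤ (<⇒≤ 0<-x)))

  module _ {d : ℕ} {s : ℝ} (1≤4s : 1# ≤ fromℕ 4 * s) (2s≤1 : s * fromℕ 2 ≤ 1#) where
    private
      0≤s : 0# ≤ s
      0≤s = *-cancelˡ-≤ (fromℕ-positive 3) (≤-respˡ-≈ (sym (zeroʳ _)) (≤-trans 0≤1 1≤4s))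

      4s≤2 : fromℕ 4 * s ≤ fromℕ 2
      4s≤2 = begin
        fromℕ 4 * s                ≈⟨ solve 1 (λ s → :fromℕ 4 :* s := s :* :fromℕ 2 :+ s :* :fromℕ 2) refl s ⟩
        s * fromℕ 2 + s * fromℕ 2  ≤⟨ +-mono-≤ 2s≤1 2s≤1 ⟩
        1# + 1#                    ≈⟨ +-congˡ (+-identityʳ 1#) ⟨
        fromℕ 2                    ∎

    1≤4s+1 : 1# ≤ fromℕ 4 * s + 1#
    1≤4s+1 = ≤-respʳ-≈ (+-comm _ _) (x≤x+y (≤-trans 0≤1 1≤4s))

    1≤8s : 1# ≤ fromℕ 8 * s
    1≤8s = begin
      1#                         ≤⟨ 1≤4s ⟩
      fromℕ 4 * s                ≤⟨ x≤x+y (≤-trans 0≤1 1≤4s) ⟩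
      fromℕ 4 * s + fromℕ 4 * s  ≈⟨ solve 1 (λ s → :fromℕ 4 :* s :+ :fromℕ 4 :* s := :fromℕ 8 :* s) refl s ⟩
      fromℕ 8 * s                ∎

    private
      e₁ : fromℕ 5 - fromℕ 4 * (1# - s) ≈ fromℕ 4 * s + 1#
      e₁ = solve 1 (λ s → :fromℕ 5 :- :fromℕ 4 :* (:1 :- s) := :fromℕ 4 :* s :+ :1) refl s

      e₂ : fromℕ 8 - fromℕ 8 * (1# - s) ≈ fromℕ 8 * s
      e₂ = solve 1 (λ s → :fromℕ 8 :- :fromℕ 8 :* (:1 :- s) := :fromℕ 8 :* s) refl s

      e₁≤ : fromℕ 4 * s + 1# ≤ fromℕ (suc d +ⁿ 2)
      e₁≤ = begin
        fromℕ 4 * s + 1#      ≤⟨ +-monoˡ-≤ 1# 4s≤2 ⟩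
        fromℕ 2 + 1#          ≈⟨ +-comm _ _ ⟩
        fromℕ 3               ≤⟨ fromℕ-mono-≤ (ℕ.m≤n+m 3 d) ⟩
        fromℕ (d +ⁿ 3)        ≡⟨ ≡.cong fromℕ (ℕ.+-suc d 2) ⟩
        fromℕ (suc d +ⁿ 2)    ∎

      e₂≤ : fromℕ 8 * s ≤ fromℕ (suc d +ⁿ 4)
      e₂≤ = begin
        fromℕ 8 * s                ≈⟨ solve 1 (λ s → :fromℕ 4 :* s :+ :fromℕ 4 :* s := :fromℕ 8 :* s) refl s ⟨
        fromℕ 4 * s + fromℕ 4 * s  ≤⟨ +-mono-≤ 4s≤2 4s≤2 ⟩
        fromℕ 2 + fromℕ 2          ≈⟨ fromℕ-homo-+ 2 2 ⟨
        fromℕ 4                    ≤⟨ fromℕ-mono-≤ (ℕ.m≤n+m 4 (suc d)) ⟩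
        fromℕ (suc d +ⁿ 4)         ∎

    -- The numbers 3, 5, d + 2 encode p⁴ q^(n+2) ≪ |E|⁵ in dimension n = d + 1. This is what remains
    -- of (q N)² ≪ |E|⁸ after inserting N² ≤ |E|³ Q Λ and Λ ≤ K p⁴.
    below-b₁ : ∀ {a} → a * (fromℕ 4 * s + 1#) ≈ fromℕ (suc d +ⁿ 2) → 0# < a × Admissible (suc d) s a
    below-b₁ {a} eq = 0<threshold {d} 0≤s 2s≤1 3 5 (d +ⁿ 2) 1≤e e≤D ae≈D ,
      admissible 0≤s 2s≤1 3 5 (d +ⁿ 2) 1≤e e≤D ae≈D λ {K} {g} 1≤K 1≤g →
        K * g , *-nonNegative (≤-trans 0≤1 1≤K) (≤-trans 0≤1 1≤g) , λ {q} F 2∤q X E E! P≤ Λ≤ j j≢0 →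
          let open Energy R F E
              module SE = Distances.CharacterSums R F E X
          in qN≤-from-square {fromℕ q} {Q} {L} {norm (SE.B j)} {Λ} {power (length E) (1# - s)} {K} {g}
               (fromℕ-nonNegative q) 0≤Q 0≤L 0≤Λ 1≤K 1≤g Λ≤
               (SE.norm-B²≤ 2∤q j≢0 E!)
               (≤-respˡ-≈ (*-congˡ (^-homo-* (fromℕ q) (suc d) 2)) P≤)
      where
      1≤e = ≤-respʳ-≈ (sym e₁) 1≤4s+1
      e≤D = ≤-respˡ-≈ (sym e₁) e₁≤
      ae≈D = trans (*-congˡ e₁) eq

    -- The numbers 7, 8, d + 4 encode p⁸ q^(n+4) ≪ |E|⁸ in dimension n = d + 1. This is what remains
    -- of (q N)⁴ ≪ |E|¹⁶ after inserting N⁴ ≤ |E|⁸ Q Λ² and Λ ≤ K p⁴.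
    below-b₂ : ∀ {a} → a * (fromℕ 8 * s) ≈ fromℕ (suc d +ⁿ 4) → 0# < a × Admissible (suc d) s a
    below-b₂ {a} eq = 0<threshold {d} 0≤s 2s≤1 7 8 (d +ⁿ 4) 1≤e e≤D ae≈D ,
      admissible 0≤s 2s≤1 7 8 (d +ⁿ 4) 1≤e e≤D ae≈D λ {K} {g} 1≤K 1≤g →
        (K * K) * g , *-nonNegative (0≤x*x K) (≤-trans 0≤1 1≤g) , λ {q} F 2∤q X E E! P≤ Λ≤ j j≢0 →
          let open Energy R F E
              module SE = Distances.CharacterSums R F E X
          in qN≤-from-fourth {fromℕ q} {Q} {L} {norm (SE.B j)} {Λ} {power (length E) (1# - s)} {K} {g}
               (fromℕ-nonNegative q) 0≤Q 0≤L 0≤Λ 1≤K 1≤g Λ≤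
               (SE.norm-B⁴≤ 2∤q j≢0)
               (≤-respˡ-≈ (*-congˡ (^-homo-* (fromℕ q) (suc d) 4)) P≤)
      where
      1≤e = ≤-respʳ-≈ (sym e₂) 1≤8s
      e≤D = ≤-respˡ-≈ (sym e₂) e₂≤
      ae≈D = trans (*-congˡ e₂) eq

theorem6 : (R : CompleteOrderedField) → let open Reals R in
    (d : ℕ) → 2 ≤ⁿ d →
    (s : ℝ) → 1# ÷ fromℕ 4 ≤ s → s ≤ 1# ÷ fromℕ 2 →
    let b₁ = fromℕ (d +ⁿ 2) ÷ (fromℕ 4 * s + 1#)
        b₂ = fromℕ (d +ⁿ 4) ÷ (fromℕ 8 * s)
    in
    (α₄⟨ d , s ⟩≤ (b₁ ⊓ b₂))
    × (s ≤ 1# ÷ fromℕ 4 + 1# ÷ fromℕ d → α₄⟨ d , s ⟩≤ b₁)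
    × (1# ÷ fromℕ 4 + 1# ÷ fromℕ d ≤ s → α₄⟨ d , s ⟩≤ b₂)
theorem6 R (suc d) 2≤d s ¼≤s s≤½ =
  -- The minimum is `≈` to one of b₁ and b₂, and admissibility is available for every exponent `≈`
  -- to either.
  [ (λ eq → inf≤ λ a≈ → b₁-admissible (trans a≈ eq))
  , (λ eq → inf≤ λ a≈ → b₂-admissible (trans a≈ eq))
  ]′ (⊓-sel b₁ b₂) , (λ _ → inf≤ b₁-admissible) , (λ _ → inf≤ b₂-admissible)
  where
  open OrderedField R
  open Thresholds R
  open import Algebra.Construct.NaturalChoice.Min totalOrder using (⊓-sel)

  b₁ = fromℕ (suc d +ⁿ 2) ÷ (fromℕ 4 * s + 1#)
  b₂ = fromℕ (suc d +ⁿ 4) ÷ (fromℕ 8 * s)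

  1≤4s : 1# ≤ fromℕ 4 * s
  1≤4s = ≤-respˡ-≈ (trans (*-comm _ _) (÷-*-cancel 1# (0<⇒≉0 (fromℕ-positive 3)))) (*-monoˡ-≤ (fromℕ-nonNegative 4) ¼≤s)

  2s≤1 : s * fromℕ 2 ≤ 1#
  2s≤1 = ≤-respʳ-≈ (÷-*-cancel 1# (0<⇒≉0 (fromℕ-positive 1))) (*-monoʳ-≤ (fromℕ-nonNegative 2) s≤½)

  b₁-admissible : ∀ {a} → a ≈ b₁ → 0# < a × Admissible (suc d) s a
  b₁-admissible a≈b₁ = below-b₁ 1≤4s 2s≤1
    (trans (*-congʳ a≈b₁) (÷-*-cancel _ (0<⇒≉0 (1≤⇒0< (1≤4s+1 {d} 1≤4s 2s≤1)))))

  b₂-admissible : ∀ {a} → a ≈ b₂ → 0# < a × Admissible (suc d) s a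
  b₂-admissible a≈b₂ = below-b₂ 1≤4s 2s≤1
    (trans (*-congʳ a≈b₂) (÷-*-cancel _ (0<⇒≉0 (1≤⇒0< (1≤8s {d} 1≤4s 2s≤1)))))
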